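{- The decision problem MatrixHasDerectSeq is in $\mathrm{NP}$.
   Context: Let $D$ be a finite index set with powerset $\mathcal{P}(D)$ and $M\in\{0,1,*\}^{D\times D}$ a symmetric matrix. For $X,Y\in\mathcal{P}(D)$ let $H^M_{X,Y}=\{(i,j)\in X\times Y\mid M_{i,j}=*\}$. A relation $R\subseteq D\times D'$ is rectangular if for all $i,j\in D$ and $i',j'\in D'$, $(i,i'),(i,j'),(j,i')\in R$ implies $(j,j')\in R$. A matrix over $\{0,1,*\}$ is pure if it has no $0$s or has no $1$s. A set $\mathcal{L}'\subseteq\mathcal{P}(D)$ is $M$-purifying if, for all $X,Y\in\mathcal{L}'$, the submatrix $M|_{X\times Y}$ is pure. A $\mathcal{P}(D)$-$M$-derectangularising sequence of length $k$ ($k\geq 2$) is a sequence $D_1,\dots,D_k$ of subsets of $D$ such that $\{D_1,\dots,D_k\}$ is $M$-purifying and the relation $H^M_{D_1,D_2}\circ H^M_{D_2,D_3}\circ\dots\circ H^M_{D_{k-1},D_k}$ is not rectangular. Here $R\circ S=\{(a,c)\mid (a,b)\in R\text{ and }(b,c)\in S\text{ for some }b\}$. Problem MatrixHasDerectSeq. Input: a finite index set $D$ and a symmetric matrix $M\in\{0,1,*\}^{D\times D}$ (represented as an array). Output: "Yes" if there is a $\mathcal{P}(D)$-$M$-derectangularising sequence (of any length); "no" otherwise. -}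

module Defs where

open import Data.Bool.Base using (Bool; true)
open import Data.Fin.Base using (Fin)
open import Data.Fin.Subset using (Subset; _∈_)
open import Data.List.Base as List using (List; []; _∷_; _++_; [_]; concat; length)
open import Data.Maybe.Base using (Maybe; just; nothing)
open import Data.Nat.Base using (ℕ; zero; suc; _+_; _*_; _^_)
open import Data.Product.Base using (Σ-syntax; ∃; ∃-syntax; _×_; _,_)
open import Data.Sum.Base using (_⊎_; inj₁; inj₂; map₂; [_,_]′)
open import Data.Vec.Base as Vec using (Vec; []; _∷_)
import Data.Vec.Membership.Propositional as VecMembership
open import Function.Base using (_∘_)
open import Function.Bundles using (_↔_; _⇔_)
open import Level using (0ℓ)
open import Relation.Binary.Construct.Composition using (_;_)
open import Relation.Binary.Core using (REL; Rel)
open import Relation.Binary.PropositionalEquality.Core using (_≡_; _≢_)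
open import Relation.Nullary.Negation.Core using (¬_)
open import Relation.Unary using (Pred)

Finite : Set → Set
Finite A = ∃[ n ] (A ↔ Fin n)

data Cell (A W : Set) : Set where
  blank : Cell A W
  input : A → Cell A W
  bit   : Bool → Cell A W
  work  : W → Cell A W

data Move : Set where
  left stay right : Move

-- A two-way infinite tape. `before` lists the cells to the left of the head,
-- nearest first; `after` those to its right. All other cells are blank.

record Tape (A W : Set) : Set where
  constructor tape
  field
    before : List (Cell A W)
    head   : Cell A W
    after  : List (Cell A W)

open Tape public using (head)

module _ {A W : Set} where

  load : List (Cell A W) → Tape A W
  load []       = tape [] blank []
  load (x ∷ xs) = tape [] x xs

  move : Move → Tape A W → Tape A W
  move left  (tape []       x rs)       = tape []       blank (x ∷ rs)
  move left  (tape (l ∷ ls) x rs)       = tape ls       l     (x ∷ rs)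
  move stay  t                          = t
  move right (tape ls       x [])       = tape (x ∷ ls) blank []
  move right (tape ls       x (r ∷ rs)) = tape (x ∷ ls) r     rs

  act : Cell A W × Move → Tape A W → Tape A W
  act (y , m) (tape ls _ rs) = move m (tape ls y rs)

-- Deterministic Turing machines with an input tape, a certificate tape and any
-- number of work tapes, all of them readable and writable.

record Machine (A : Set) : Set₁ where
  field
    State        : Set
    Work         : Set
    input-finite : Finite A
    state-finite : Finite State
    work-finite  : Finite Work
    workTapes    : ℕ

  tapes : ℕ
  tapes = 2 + workTapes

  field
    start : State
    -- inj₁ true halts and accepts; inj₁ false halts and rejects.
    δ     : State → Vec (Cell A Work) tapes →
            Bool ⊎ (State × Vec (Cell A Work × Move) tapes)

  Config : Set
  Config = State × Vec (Tape A Work) tapes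

  initial : List A → List Bool → Config
  initial w u =
    start , load (List.map input w) ∷ load (List.map bit u)
          ∷ Vec.replicate workTapes (load [])

  step : Config → Bool ⊎ Config
  step (q , ts) =
    map₂ (λ (q′ , as) → q′ , Vec.zipWith act as ts) (δ q (Vec.map head ts))

  -- nothing: not halted within the given number of steps.
  run : ℕ → Config → Maybe Bool
  run zero    c = nothing
  run (suc t) c = [ just , run t ]′ (step c)

-- L has a polynomial-time verifier: a machine that halts on every input w
-- and certificate u in time polynomial in the length of w alone, such that
-- w is in L exactly when some u is accepted. Only polynomially many bits of
-- u can be read in that time, so the length of u need not be bounded.
-- Every polynomial is dominated by some c * n ^ k + c.

InNP : {A : Set} → Pred (List A) 0ℓ → Set₁
InNP {A} L =
  Σ[ V ∈ Machine A ] ∃[ c ] ∃[ k ]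
    let open Machine V
        verdict : List A → List Bool → Maybe Bool
        verdict w u = run (c * length w ^ k + c) (initial w u)
    in (∀ w u → ∃[ b ] verdict w u ≡ just b)
     × (∀ w → L w ⇔ (∃[ u ] verdict w u ≡ just true))

data Entry : Set where
  𝟎 𝟏 ∗ : Entry

Matrix : ℕ → Set
Matrix n = Fin n → Fin n → Entry

Symmetric : ∀ {n} → Matrix n → Set
Symmetric M = ∀ i j → M i j ≡ M j i

Rectangular : {D D′ : Set} → REL D D′ 0ℓ → Set
Rectangular R = ∀ i j i′ j′ → R i i′ → R i j′ → R j i′ → R j j′

module _ {n : ℕ} (M : Matrix n) where

  open VecMembership using () renaming (_∈_ to _∈ᵛ_)

  H : Subset n → Subset n → Rel (Fin n) 0ℓ
  H X Y i j = i ∈ X × j ∈ Y × M i j ≡ ∗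

  PureOn : Subset n → Subset n → Set
  PureOn X Y = (∀ i j → i ∈ X → j ∈ Y → M i j ≢ 𝟎)
             ⊎ (∀ i j → i ∈ X → j ∈ Y → M i j ≢ 𝟏)

  Purifying : Pred (Subset n) 0ℓ → Set
  Purifying ℒ = ∀ X Y → ℒ X → ℒ Y → PureOn X Y

  composite : ∀ {k} → Vec (Subset n) (2 + k) → Rel (Fin n) 0ℓ
  composite (X ∷ Y ∷ [])     = H X Y
  composite (X ∷ Y ∷ Z ∷ Ds) = H X Y ; composite (Y ∷ Z ∷ Ds)

  Derectangularising : ∀ {k} → Vec (Subset n) (2 + k) → Set
  Derectangularising Ds =
    Purifying (_∈ᵛ Ds) × ¬ Rectangular (composite Ds)

  HasDerectSeq : Set
  HasDerectSeq = ∃[ k ] Σ[ Ds ∈ Vec (Subset n) (2 + k) ] Derectangularising Ds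

data Symbol : Set where
  entry  : Entry → Symbol
  endRow : Symbol

-- Row by row, each row closed by endRow; the index set is Fin n.
encode : ∀ {n} → Matrix n → List Symbol
encode M =
  concat (List.tabulate λ i → List.tabulate (entry ∘ M i) ++ [ endRow ])

-- Words that do not encode a symmetric matrix are not in the language.
MatrixHasDerectSeq : Pred (List Symbol) 0ℓ
MatrixHasDerectSeq w =
  ∃[ n ] Σ[ M ∈ Matrix n ] (w ≡ encode M × Symmetric M × HasDerectSeq M)

{-# OPTIONS --safe #-}
module Submission where

-- The certificate lists sets D₁ , D₂ , … of indices. Starting from F₁ = {a} and an
-- arbitrary G₁ with D₁ = F₁ ∪ G₁, the verifier computes F_t = D_t ∩ N(F_{t-1}) and
-- G_t = D_t ∩ N(G_{t-1}), N(S) being the set of indices that have a ∗ with some index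
-- of S, and it records the pairs of indices that occur in a common D_t. A ∗-walk from
-- the last set back to the first thus exists exactly when its end is in F_t or G_t,
-- and the relation is not rectangular if some index is in F_t ∩ G_t and another in
-- F_t ∖ G_t. The family is purifying iff there are no M b a = 𝟎 and M a′ b′ = 𝟏 with
-- {b , b′} and {a , a′} recorded.
--
-- Polynomially many sets suffice: a failure of rectangularity is witnessed by three
-- walks, so each set may be shrunk to the three indices that the walks visit there.
-- Each triple is labelled by three bits over-approximating which of its indices are
-- reachable from the end of the third walk. Validity of a sequence of labelled triples
-- is a condition on neighbours, so loops can be erased, which leaves at most 8 n³ sets.
--
-- The verifier is written in a language whose loops run along a tape of at most
-- |w| cells that the loop body does not move. Hence every program stops in
-- polynomial time, on every input and certificate.

open import Defs
open import Data.Bool.Base using (Bool; true; false; not; _∧_; _∨_; T; if_then_else_)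
import Data.Bool.Properties as Bool
open import Data.Empty using (⊥)
open import Data.Fin.Base using (Fin; zero; suc; toℕ)
import Data.Fin.Properties as Fin
open import Data.Fin.Properties using (1↔⊤; 2↔Bool; +↔⊎; *↔×; toℕ<n; any?; injective⇒≤)
open import Data.Fin.Subset using (Subset; _∈_)
open import Data.Fin.Subset.Properties using (_∈?_)
open import Data.List.Base as List using (List; []; _∷_; _++_; length; _ʳ++_; tabulate; concat; [_])
import Data.List.Membership.DecPropositional as DecMembership
open import Data.List.Membership.Propositional using () renaming (_∈_ to _∈ˡ_)
open import Data.List.Membership.Propositional.Properties using (∈-lookup; ∈-map⁻)
open import Data.List.Properties
  using (length-map; length-ʳ++; map-ʳ++; ++-assoc; ++-identityʳ; ++-ʳ++; length-tabulate;
    map-++; map-tabulate; ʳ++-ʳ++)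
open import Data.List.Relation.Binary.Subset.Propositional using () renaming (_⊆_ to _⊆ˡ_)
open import Data.List.Relation.Unary.All as All using ([]; _∷_)
open import Data.List.Relation.Unary.All.Properties using (¬Any⇒All¬)
open import Data.List.Relation.Unary.AllPairs using ([]; _∷_)
open import Data.List.Relation.Unary.Any using (here; there)
open import Data.List.Relation.Unary.Unique.Propositional using (Unique)
open import Data.Maybe.Base as Maybe using (Maybe; just; nothing; maybe)
open import Data.Maybe.Properties using (just-injective)
open import Data.Nat.Base using (ℕ; zero; suc; _+_; _*_; _≡ᵇ_; _<_; _≤_; z≤n; s≤s; _^_)
open import Data.Nat.Properties
  using (+-suc; +-identityʳ; ≡ᵇ⇒≡; ≡⇒≡ᵇ; m≤n⇒∃[o]m+o≡n; <⇒≤; module ≤-Reasoning; *-assoc;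
    *-comm; *-distribʳ-+; *-distribˡ-+; *-identityʳ; *-monoʳ-≤; *-monoˡ-≤; +-assoc; +-comm;
    +-mono-≤; +-monoʳ-≤; +-monoˡ-≤; [m*n]*[o*p]≡[m*o]*[n*p]; ^-identityʳ; ^-monoʳ-≤; ^-monoˡ-≤;
    m^n>0; m≤m+n; m≤n*m; m≤n+m; m≤n⇒m≤1+n; n≤1+n; ≤-refl; ≤-reflexive; ≤-trans)
open import Data.Product.Base using (Σ-syntax; ∃-syntax; _×_; _,_; proj₁; proj₂)
open import Data.Product.Function.NonDependent.Propositional using (_×-↔_)
open import Data.Sum.Base using (_⊎_; inj₁; inj₂)
open import Data.Sum.Function.Propositional using (_⊎-↔_)
open import Data.Unit.Base using (⊤; tt)
open import Data.Vec.Base as Vec using (Vec; []; _∷_; lookup; _[_]≔_; updateAt; fromList; toList)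
open import Data.Vec.Membership.Propositional.Properties using (∈-fromList⁻; ∈-toList⁻)
open import Data.Vec.Properties
  using (lookup-replicate; map-updateAt; updateAt-id; updateAt-updateAt; lookup∘updateAt;
    lookup∘updateAt′; lookup-map; updateAt-cong-local; lookup∘tabulate; []=⇒lookup; lookup⇒[]=;
    toList∘fromList)
open import Function.Base using (_∘_; id)
open import Function.Bundles using (_↔_; mk↔ₛ′; module Injection; _⇔_; mk⇔; module Equivalence)
open import Function.Construct.Identity using (↔-id)
open import Function.Properties.Inverse using (↔-sym; ↔-trans; ↔⇒↣)
open import Level using (0ℓ)
open import Relation.Binary.Definitions using (DecidableEquality)
open import Relation.Binary.PropositionalEquality
  using (_≡_; _≢_; refl; sym; trans; cong; cong₂; subst; module ≡-Reasoning; _≗_)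
open import Relation.Nullary.Decidable using (Dec; yes; no; _×-dec_; ¬?; does; via-injection)
open import Relation.Nullary.Negation.Core using (contradiction; ¬_)
open import Relation.Unary using (Pred)

-- Looping programs and their compilation to Turing machines

-- The obstacle is that non-rectangularity asserts the absence of a walk. Shrinking the sets only
-- removes walks, but cutting out a segment between two equal triples may create the forbidden walk
-- from `b′` to `a₂`, because the indices related to `a₂` can differ at the two places. Absence is
-- certified by a choice of marked indices that includes the origin `a₂` and is closed under every
-- link. Such a certificate survives the cut if it also agrees at both places. On three indices it
-- amounts to three bits, whence 8 labels for each of the n³ triples.
--
-- F₁ has to be a singleton so that the index in F ∩ G and the one in F ∖ G are related to the same
-- `a`. G₁ may be arbitrary: the former index is related to some `a₂` in G₁, the latter to no index
-- of G₁ at all.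
--
-- Pairs suffice for purity because a violation involves just two indices of each of two sets. So n²
-- bits replace the list of sets, and the certificate is read only once.
--
-- The number of steps is fixed at 8 n³, and a bit of the certificate tells at each step whether to
-- move or to stand still.

finite-⊤ : Finite ⊤
finite-⊤ = 1 , ↔-sym 1↔⊤

finite-Bool : Finite Bool
finite-Bool = 2 , ↔-sym 2↔Bool

finite-⊎ : ∀ {A B} → Finite A → Finite B → Finite (A ⊎ B)
finite-⊎ (m , f) (n , g) = m + n , ↔-trans (f ⊎-↔ g) (↔-sym +↔⊎)

finite-× : ∀ {A B} → Finite A → Finite B → Finite (A × B)
finite-× (m , f) (n , g) = m * n , ↔-trans (f ×-↔ g) (↔-sym *↔×)

finite-↔ : ∀ {A B} → A ↔ B → Finite B → Finite A
finite-↔ f (n , g) = n , ↔-trans f g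

finite-Entry : Finite Entry
finite-Entry = 3 , mk↔ₛ′
  (λ { 𝟎 → zero ; 𝟏 → suc zero ; ∗ → suc (suc zero) })
  (λ { zero → 𝟎 ; (suc zero) → 𝟏 ; (suc (suc zero)) → ∗ })
  (λ { zero → refl ; (suc zero) → refl ; (suc (suc zero)) → refl })
  (λ { 𝟎 → refl ; 𝟏 → refl ; ∗ → refl })

finite-Symbol : Finite Symbol
finite-Symbol = finite-↔ symbol↔ (finite-⊎ finite-Entry finite-⊤)
  where
  symbol↔ : Symbol ↔ (Entry ⊎ ⊤)
  symbol↔ = mk↔ₛ′
    (λ { (entry e) → inj₁ e ; endRow → inj₂ tt })
    (λ { (inj₁ e) → entry e ; (inj₂ _) → endRow })
    (λ { (inj₁ e) → refl ; (inj₂ _) → refl })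
    (λ { (entry e) → refl ; endRow → refl })

-- One work cell. On the matrix tape it holds a symbol and, in met, whether the
-- two indices have occurred in a common set; on the two tapes indexed by D it
-- holds the values at an index of the sets D_t, F_t, G_t and of auxiliary
-- sets.

record Datum : Set where
  constructor datum
  field
    sym?                          : Maybe Symbol
    met inD inF inG hot cur image : Bool

open Datum public

finite-Datum : Finite Datum
finite-Datum = finite-↔ datum↔
  (finite-× (finite-↔ maybe↔ (finite-⊎ finite-Symbol finite-⊤))
    (finite-× b (finite-× b (finite-× b (finite-× b (finite-× b (finite-× b b)))))))
  where
  b = finite-Bool
  maybe↔ : Maybe Symbol ↔ (Symbol ⊎ ⊤)
  maybe↔ = mk↔ₛ′
    (λ { (just s) → inj₁ s ; nothing → inj₂ tt })
    (λ { (inj₁ s) → just s ; (inj₂ _) → nothing })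
    (λ { (inj₁ s) → refl ; (inj₂ _) → refl })
    (λ { (just s) → refl ; nothing → refl })
  datum↔ : Datum ↔ (Maybe Symbol × Bool × Bool × Bool × Bool × Bool × Bool × Bool)
  datum↔ = mk↔ₛ′
    (λ (datum s x₁ x₂ x₃ x₄ x₅ x₆ x₇) → s , x₁ , x₂ , x₃ , x₄ , x₅ , x₆ , x₇)
    (λ (s , x₁ , x₂ , x₃ , x₄ , x₅ , x₆ , x₇) → datum s x₁ x₂ x₃ x₄ x₅ x₆ x₇)
    (λ _ → refl) (λ _ → refl)

vacant : Datum
vacant = datum nothing false false false false false false false

-- Stores, looping programs and their meaning

record Zip : Set where
  constructor _▸_
  field
    passed ahead : List Datum

open Zip public

current : Zip → Datum
current (_ ▸ [])      = vacant
current (_ ▸ (x ∷ _)) = x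

-- Past the last cell nothing is written, so no program lengthens a zip and every loop stays bounded
-- by the length of the input.
put : Datum → Zip → Zip
put y (ls ▸ [])       = ls ▸ []
put y (ls ▸ (_ ∷ rs)) = ls ▸ (y ∷ rs)

advance : Zip → Zip
advance (ls ▸ [])       = ls ▸ []
advance (ls ▸ (x ∷ rs)) = (x ∷ ls) ▸ rs

advanceIf : Bool → Zip → Zip
advanceIf false z = z
advanceIf true  z = advance z

toStart : Zip → Zip
toStart (ls ▸ rs) = [] ▸ (ls ʳ++ rs)

size : Zip → ℕ
size (ls ▸ rs) = length ls + length rs

record Store : Set where
  constructor store
  field
    ok flag : Bool
    zips    : Vec Zip 6
    cert    : List Bool

open Store public

record Effect : Set where
  constructor effect
  field
    pass next       : Bool
    new₀ new₁ new₂ : Datum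

open Effect public

-- `perform` can clear `ok` but not set it, so a failed check is final.

data Prog : Set where
  perform : Vec Bool 6 → Bool → (Bool → Bool → Datum → Datum → Datum → Effect) → Prog
  _⨾_    : Prog → Prog → Prog
  rewind : Fin 6 → Prog
  loop   : Fin 6 → Prog → Prog

infixr 5 _⨾_

-- Past its end the certificate reads as `false`, which the walk takes as an order to stand still;
-- short certificates thus need no padding.
peek : List Bool → Bool
peek []      = false
peek (b ∷ _) = b

popIf : Bool → List Bool → List Bool
popIf false u       = u
popIf true  []      = []
popIf true  (_ ∷ u) = u

writes : Effect → Vec Zip 6 → Vec Datum 6
writes e (_ ∷ _ ∷ _ ∷ zs) = new₀ e ∷ new₁ e ∷ new₂ e ∷ Vec.map current zs

effectAt : (Bool → Bool → Datum → Datum → Datum → Effect) → Store → Effect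
effectAt f (store _ x (z₀ ∷ z₁ ∷ z₂ ∷ _) u) = f x (peek u) (current z₀) (current z₁) (current z₂)

adjust : Bool → Datum → Zip → Zip
adjust b y z = advanceIf b (put y z)

onZip : Fin 6 → (Zip → Zip) → Store → Store
onZip k f (store o x zs u) = store o x (updateAt zs k f) u

iter : {A : Set} → ℕ → (A → A) → A → A
iter zero    f x = x
iter (suc n) f x = iter n f (f x)

iter-suc : ∀ {S : Set} m (f : S → S) x → iter (suc m) f x ≡ f (iter m f x)
iter-suc zero    f x = refl
iter-suc (suc m) f x = iter-suc m f (f x)

iter-+ : ∀ {S : Set} k m (f : S → S) x → iter (k + m) f x ≡ iter m f (iter k f x)
iter-+ zero    m f x = refl
iter-+ (suc k) m f x = iter-+ k m f (f x)

iter-* : ∀ {S : Set} m k (f : S → S) x → iter m (iter k f) x ≡ iter (m * k) f x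
iter-* zero    k f x = refl
iter-* (suc m) k f x = trans (iter-* m k f (iter k f x)) (sym (iter-+ k (m * k) f x))

iter-cong : ∀ {S : Set} {f g : S → S} m → (∀ x → f x ≡ g x) → ∀ x → iter m f x ≡ iter m g x
iter-cong zero            eq x = refl
iter-cong {g = g} (suc m) eq x = trans (iter-cong m eq _) (cong (iter m g) (eq x))

runway : Fin 6 → Store → ℕ
runway k σ = length (ahead (lookup (zips σ) k))

⟦_⟧ : Prog → Store → Store
⟦ perform bs rd f ⟧ σ = let e = effectAt f σ in
  store (pass e ∧ ok σ) (next e)
        (Vec.zipWith (λ b (y , z) → adjust b y z) bs (Vec.zip (writes e (zips σ)) (zips σ)))
        (popIf rd (cert σ))
⟦ p ⨾ q ⟧    σ = ⟦ q ⟧ (⟦ p ⟧ σ)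
⟦ rewind k ⟧ σ = onZip k toStart σ
⟦ loop k p ⟧ σ = iter (runway k σ) (onZip k advance ∘ ⟦ p ⟧) σ

sameSlot : ∀ {n} → Fin n → Fin n → Bool
sameSlot zero    zero    = true
sameSlot zero    (suc _) = false
sameSlot (suc _) zero    = false
sameSlot (suc i) (suc j) = sameSlot i j

moves : Prog → Fin 6 → Bool
moves (perform bs _ _) k = lookup bs k
moves (p ⨾ q)      k = moves p k ∨ moves q k
moves (rewind l)   k = sameSlot l k
moves (loop l p)   k = sameSlot l k ∨ moves p k

-- Every loop terminates because its body does not move the zip that drives it.
WellFormed : Prog → Set
WellFormed (perform _ _ _) = ⊤
WellFormed (p ⨾ q)     = WellFormed p × WellFormed q
WellFormed (rewind _)  = ⊤
WellFormed (loop k p)  = T (not (moves p k)) × WellFormed p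

-- Polynomial running time

cost : Prog → ℕ → ℕ
cost (perform _ _ _) N = 1
cost (p ⨾ q)     N = cost p N + cost q N
-- One move off the current square, one for each datum passed, one back from the blank.
cost (rewind _)  N = 2 + N
-- Each lap adds a test for the end and a move; one last test finds the end.
cost (loop _ p)  N = N * (cost p N + 2) + 1

-- Degrees of consecutive programs are added, which is coarser than the maximum but lets
-- monotonicity of powers bound both summands.
degree : Prog → ℕ
degree (perform _ _ _) = 0
degree (p ⨾ q)     = degree p + degree q
degree (rewind _)  = 1
degree (loop _ p)  = suc (degree p)

factor : Prog → ℕ
factor (perform _ _ _) = 1
factor (p ⨾ q)     = factor p + factor q
factor (rewind _)  = 2
factor (loop _ p)  = factor p + 2

-- With base `suc N` every power is at least 1, also for the empty word, and so absorbs the additive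
-- constants.
cost≤ : ∀ p N → cost p N ≤ factor p * suc N ^ degree p
cost≤ (perform _ _ _) N = ≤-refl
cost≤ (p ⨾ q) N = begin
  cost p N + cost q N
    ≤⟨ +-mono-≤ (cost≤ p N) (cost≤ q N) ⟩
  factor p * suc N ^ degree p + factor q * suc N ^ degree q
    ≤⟨ +-mono-≤ (*-monoʳ-≤ (factor p) (^-monoʳ-≤ (suc N) (m≤m+n (degree p) (degree q))))
                (*-monoʳ-≤ (factor q) (^-monoʳ-≤ (suc N) (m≤n+m (degree q) (degree p)))) ⟩
  factor p * suc N ^ (degree p + degree q) + factor q * suc N ^ (degree p + degree q)
    ≡⟨ *-distribʳ-+ (suc N ^ (degree p + degree q)) (factor p) (factor q) ⟨
  (factor p + factor q) * suc N ^ (degree p + degree q) ∎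
  where open ≤-Reasoning
cost≤ (rewind _) N = begin
  2 + N              ≤⟨ +-monoʳ-≤ 2 (m≤m+n N (N + 0)) ⟩
  2 + 2 * N          ≡⟨ *-distribˡ-+ 2 1 N ⟨
  2 * suc N          ≡⟨ cong (2 *_) (^-identityʳ (suc N)) ⟨
  2 * suc N ^ 1      ∎
  where open ≤-Reasoning
cost≤ (loop _ p) N = begin
  N * (cost p N + 2) + 1
    ≤⟨ +-mono-≤ (*-monoʳ-≤ N body) (≤-trans (m^n>0 (suc N) (degree p)) (m≤n*m S (factor p + 2) ⦃ 2+nonZero ⦄)) ⟩
  N * ((factor p + 2) * S) + (factor p + 2) * S
    ≡⟨ +-comm (N * ((factor p + 2) * S)) _ ⟩
  suc N * ((factor p + 2) * S)
    ≡⟨ *-assoc (suc N) (factor p + 2) S ⟨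
  suc N * (factor p + 2) * S
    ≡⟨ cong (_* S) (*-comm (suc N) (factor p + 2)) ⟩
  (factor p + 2) * suc N * S
    ≡⟨ *-assoc (factor p + 2) (suc N) S ⟩
  (factor p + 2) * (suc N * S) ∎
  where
  open ≤-Reasoning
  open import Data.Nat.Base using (NonZero; >-nonZero)
  S = suc N ^ degree p
  2+nonZero : NonZero (factor p + 2)
  2+nonZero = >-nonZero (≤-trans (s≤s z≤n) (m≤n+m 2 (factor p)))
  body : cost p N + 2 ≤ (factor p + 2) * S
  body = begin
    cost p N + 2              ≤⟨ +-mono-≤ (cost≤ p N) (*-monoʳ-≤ 2 (m^n>0 (suc N) (degree p))) ⟩
    factor p * S + 2 * S      ≡⟨ *-distribʳ-+ S (factor p) 2 ⟨
    (factor p + 2) * S        ∎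

^-distribʳ-* : ∀ k m n → (m * n) ^ k ≡ m ^ k * n ^ k
^-distribʳ-* zero    m n = refl
^-distribʳ-* (suc k) m n = begin
  m * n * (m * n) ^ k       ≡⟨ cong (m * n *_) (^-distribʳ-* k m n) ⟩
  m * n * (m ^ k * n ^ k)   ≡⟨ [m*n]*[o*p]≡[m*o]*[n*p] m n (m ^ k) (n ^ k) ⟩
  m * m ^ k * (n * n ^ k)   ∎
  where open ≡-Reasoning

-- This brings the bound into the shape that `InNP` asks for. If n is positive, 1 + n ≤ 2 n; the
-- second summand covers n = 0.
[1+n]^k≤ : ∀ n k → suc n ^ k ≤ 2 ^ k * n ^ k + 2 ^ k
[1+n]^k≤ zero k = begin
  1 ^ k              ≤⟨ ^-monoˡ-≤ k (s≤s (z≤n {1})) ⟩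
  2 ^ k              ≤⟨ m≤n+m (2 ^ k) (2 ^ k * 0 ^ k) ⟩
  2 ^ k * 0 ^ k + 2 ^ k ∎
  where open ≤-Reasoning
[1+n]^k≤ n@(suc m) k = begin
  suc n ^ k             ≤⟨ ^-monoˡ-≤ k (s≤s (≤-trans (m≤n+m n m) (≤-reflexive (cong (m +_) (sym (+-identityʳ n)))))) ⟩
  (2 * n) ^ k           ≡⟨ ^-distribʳ-* k 2 n ⟩
  2 ^ k * n ^ k         ≤⟨ m≤m+n _ (2 ^ k) ⟩
  2 ^ k * n ^ k + 2 ^ k ∎
  where open ≤-Reasoning

-- Compilation to a Turing machine

Square : Set
Square = Cell Symbol Datum

Track : Set
Track = Tape Symbol Datum

Action : Set
Action = Square × Move

-- The machine model puts the certificate tape second. It is inserted between the matrix zip, which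
-- lives on the input tape, and the zips on the work tapes; `slot` renumbers accordingly.
spread : ∀ {n} {A : Set} → A → Vec A (suc n) → Vec A (2 + n)
spread y (x ∷ xs) = x ∷ y ∷ xs

slot : ∀ {n} → Fin (suc n) → Fin (2 + n)
slot zero    = zero
slot (suc k) = suc (suc k)

readDatum : Square → Datum
readDatum (work x) = x
readDatum _        = vacant

readBit : Square → Bool
readBit (bit b) = b
readBit _       = false

whenMoving : Bool → Move
whenMoving false = stay
whenMoving true  = right

-- A blank is neither overwritten nor passed, in step with `put` and `advance` at the end of a zip.
onDatum : Bool → Datum → Square → Action
onDatum b y (work _) = work y , whenMoving b
onDatum b y h        = h , stay

onBit : Bool → Square → Action
onBit rd (bit b) = bit b , whenMoving rd
onBit rd h       = h , stay

keep : Square → Action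
keep h = h , stay

solo : ∀ {n} → Fin n → Move → Vec Square n → Vec Action n
solo zero    m (h ∷ hs) = (h , m) ∷ Vec.map keep hs
solo (suc k) m (h ∷ hs) = keep h ∷ solo k m hs

Point : Prog → Set
Point (perform _ _ _) = ⊤
Point (p ⨾ q)         = Point p ⊎ Point q
Point (rewind _)      = Bool
Point (loop _ p)      = Bool ⊎ Point p

finite-Point : ∀ p → Finite (Point p)
finite-Point (perform _ _ _) = finite-⊤
finite-Point (p ⨾ q)         = finite-⊎ (finite-Point p) (finite-Point q)
finite-Point (rewind _)      = finite-Bool
finite-Point (loop _ p)      = finite-⊎ finite-Bool (finite-Point p)

entryPoint : ∀ p → Point p
entryPoint (perform _ _ _) = tt
entryPoint (p ⨾ q)         = inj₁ (entryPoint p)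
entryPoint (rewind _)      = false
entryPoint (loop _ p)      = inj₁ false

Outcome : Set → Set
Outcome S = S × (Bool × Bool) × Vec Action 7

mapState : ∀ {S S′} → (S → S′) → Outcome S → Outcome S′
mapState f (s , rest) = f s , rest

isBlank : Square → Bool
isBlank blank = true
isBlank _     = false

effectOf : (Bool → Bool → Datum → Datum → Datum → Effect) → Bool → Vec Square 7 → Effect
effectOf f x (h₀ ∷ hu ∷ h₁ ∷ h₂ ∷ _) = f x (readBit hu) (readDatum h₀) (readDatum h₁) (readDatum h₂)

newData : Effect → Vec Square 7 → Vec Datum 6
newData e (_ ∷ _ ∷ _ ∷ _ ∷ hs) = new₀ e ∷ new₁ e ∷ new₂ e ∷ Vec.map readDatum hs

unspread : ∀ {n} {A : Set} → Vec A (2 + n) → Vec A (suc n)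
unspread (x ∷ _ ∷ xs) = x ∷ xs

performActions : Vec Bool 6 → Bool → Effect → Vec Square 7 → Vec Action 7
performActions bs rd e hs =
  spread (onBit rd (lookup hs (suc zero)))
         (Vec.zipWith (λ b (y , h) → onDatum b y h) bs (Vec.zip (newData e hs) (unspread hs)))

-- `nothing` means that control leaves the program.
transition : ∀ p → Point p → Bool × Bool → Vec Square 7 → Outcome (Maybe (Point p))
transition (perform bs rd f) _ (o , x) hs = let e = effectOf f x hs in
  nothing , (pass e ∧ o , next e) , performActions bs rd e hs
transition (p ⨾ q) (inj₁ s) c hs =
  mapState (just ∘ maybe inj₁ (inj₂ (entryPoint q))) (transition p s c hs)
transition (p ⨾ q) (inj₂ s) c hs = mapState (Maybe.map inj₂) (transition q s c hs)
-- The first move is unconditional: at the right end the head is on a blank that must not be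
-- mistaken for the left one.
transition (rewind k) false c hs = just true , c , solo (slot k) left hs
transition (rewind k) true  c hs with isBlank (lookup hs (slot k))
... | true  = nothing , c , solo (slot k) right hs
... | false = just true , c , solo (slot k) left hs
transition (loop k p) (inj₁ false) c hs with isBlank (lookup hs (slot k))
... | true  = nothing , c , Vec.map keep hs
... | false = just (inj₂ (entryPoint p)) , c , Vec.map keep hs
transition (loop k p) (inj₁ true) c hs = just (inj₁ false) , c , solo (slot k) right hs
transition (loop k p) (inj₂ s) c hs =
  mapState (just ∘ maybe inj₂ (inj₁ true)) (transition p s c hs)

data Phase : Set where
  pad₀ pad₁ done : Phase
  copy           : Bool → Phase

finite-Phase : Finite Phase
finite-Phase = finite-↔ phase↔ (finite-⊎ finite-⊤ (finite-⊎ finite-⊤ (finite-⊎ finite-⊤ finite-Bool)))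
  where
  phase↔ : Phase ↔ (⊤ ⊎ ⊤ ⊎ ⊤ ⊎ Bool)
  phase↔ = mk↔ₛ′
    (λ { pad₀ → inj₁ tt ; pad₁ → inj₂ (inj₁ tt) ; done → inj₂ (inj₂ (inj₁ tt)) ; (copy b) → inj₂ (inj₂ (inj₂ b)) })
    (λ { (inj₁ _) → pad₀ ; (inj₂ (inj₁ _)) → pad₁ ; (inj₂ (inj₂ (inj₁ _))) → done ; (inj₂ (inj₂ (inj₂ b))) → copy b })
    (λ { (inj₁ _) → refl ; (inj₂ (inj₁ _)) → refl ; (inj₂ (inj₂ (inj₁ _))) → refl ; (inj₂ (inj₂ (inj₂ b))) → refl })
    (λ { pad₀ → refl ; pad₁ → refl ; done → refl ; (copy b) → refl })

symbolDatum : Symbol → Datum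
symbolDatum s = datum (just s) false false false false false false false

inFirstRow : Bool → Symbol → Bool
inFirstRow b (entry _) = b
inFirstRow b endRow    = false

extend : Bool → Square → Action
extend true  h = work vacant , right
extend false h = h , stay

moveAll : Move → Vec Square 7 → Vec Action 7
moveAll m (h₀ ∷ hu ∷ hs) = (h₀ , m) ∷ keep hu ∷ Vec.map (_, m) hs

continue : {S : Set} → Outcome S → Bool ⊎ ((S × (Bool × Bool)) × Vec Action 7)
continue (s , c , as) = inj₂ ((s , c) , as)

-- The first two moves put an explicit blank to the left of every tape. Then the
-- input is turned into data and the other work tapes get as many cells as the
-- first row has entries.
machine : Prog → Machine Symbol
machine p = record
  { State        = (Phase ⊎ Point p) × (Bool × Bool)
  ; Work         = Datum
  ; input-finite = finite-Symbol
  ; state-finite = finite-× (finite-⊎ finite-Phase (finite-Point p)) (finite-× finite-Bool finite-Bool)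
  ; work-finite  = finite-Datum
  ; workTapes    = 5
  ; start        = inj₁ pad₀ , true , false
  ; δ            = δ
  }
  where
  δ : (Phase ⊎ Point p) × (Bool × Bool) → Vec Square 7 →
      Bool ⊎ (((Phase ⊎ Point p) × (Bool × Bool)) × Vec Action 7)
  δ (inj₁ pad₀ , c) hs = continue (inj₁ pad₁ , c , moveAll left hs)
  δ (inj₁ pad₁ , c) hs = continue (inj₁ (copy true) , c , moveAll right hs)
  δ (inj₁ done , o , _) hs = inj₁ o
  δ (inj₁ (copy b) , c) (input s ∷ hu ∷ hs) =
    continue ( inj₁ (copy (inFirstRow b s)) , c
       , (work (symbolDatum s) , right) ∷ keep hu ∷ Vec.map (extend (inFirstRow b s)) hs)
  δ (inj₁ (copy b) , c) hs = continue (inj₂ (entryPoint p) , c , Vec.map keep hs)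
  δ (inj₂ s , c) hs = continue (mapState (maybe inj₂ (inj₁ done)) (transition p s c hs))

-- Invariants of execution: sizes of zips and lengths of runways

size-put : ∀ y z → size (put y z) ≡ size z
size-put y (ls ▸ [])       = refl
size-put y (ls ▸ (_ ∷ rs)) = refl

size-advance : ∀ z → size (advance z) ≡ size z
size-advance (ls ▸ [])       = refl
size-advance (ls ▸ (_ ∷ rs)) = sym (+-suc (length ls) (length rs))

size-adjust : ∀ b y z → size (adjust b y z) ≡ size z
size-adjust false y z = size-put y z
size-adjust true  y z = trans (size-advance (put y z)) (size-put y z)

size-toStart : ∀ z → size (toStart z) ≡ size z
size-toStart (ls ▸ rs) = length-ʳ++ ls

sizes : Store → Vec ℕ 6
sizes σ = Vec.map size (zips σ)

sizes-onZip : ∀ k {f} σ → (∀ z → size (f z) ≡ size z) → sizes (onZip k f σ) ≡ sizes σ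
sizes-onZip k σ eq = trans (map-updateAt (zips σ) k (eq _)) (updateAt-id k (sizes σ))

sizes-zipWith : ∀ {n} (bs : Vec Bool n) (ys : Vec Datum n) zs →
  Vec.map size (Vec.zipWith (λ b (y , z) → adjust b y z) bs (Vec.zip ys zs)) ≡ Vec.map size zs
sizes-zipWith []       []       []       = refl
sizes-zipWith (b ∷ bs) (y ∷ ys) (z ∷ zs) = cong₂ _∷_ (size-adjust b y z) (sizes-zipWith bs ys zs)

sizes-iter : ∀ n {f : Store → Store} σ → (∀ σ → sizes (f σ) ≡ sizes σ) → sizes (iter n f σ) ≡ sizes σ
sizes-iter zero    σ eq = refl
sizes-iter (suc n) σ eq = trans (sizes-iter n _ eq) (eq σ)

sizes-⟦⟧ : ∀ p σ → sizes (⟦ p ⟧ σ) ≡ sizes σ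
sizes-⟦⟧ (perform bs rd f) σ = sizes-zipWith bs (writes (effectAt f σ) (zips σ)) (zips σ)
sizes-⟦⟧ (p ⨾ q)    σ = trans (sizes-⟦⟧ q (⟦ p ⟧ σ)) (sizes-⟦⟧ p σ)
sizes-⟦⟧ (rewind k) σ = sizes-onZip k σ size-toStart
sizes-⟦⟧ (loop k p) σ = sizes-iter (runway k σ) σ
  (λ τ → trans (sizes-onZip k (⟦ p ⟧ τ) size-advance) (sizes-⟦⟧ p τ))

sameSlot-refl : ∀ {n} (k : Fin n) → sameSlot k k ≡ true
sameSlot-refl zero    = refl
sameSlot-refl (suc k) = sameSlot-refl k

sameSlot-≢ : ∀ {n} {k l : Fin n} → T (not (sameSlot l k)) → k ≢ l
sameSlot-≢ {k = k} t refl = subst (T ∘ not) (sameSlot-refl k) t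

T-not-∨ˡ : ∀ a {b} → T (not (a ∨ b)) → T (not a)
T-not-∨ˡ false _ = tt

T-not-∨ʳ : ∀ a {b} → T (not (a ∨ b)) → T (not b)
T-not-∨ʳ false t = t

runway-onZip : ∀ {k l} f σ → T (not (sameSlot l k)) → runway k (onZip l f σ) ≡ runway k σ
runway-onZip {k} {l} f σ t = cong (length ∘ ahead) (lookup∘updateAt′ k l (sameSlot-≢ t) (zips σ))

ahead-put : ∀ y z → length (ahead (put y z)) ≡ length (ahead z)
ahead-put y (ls ▸ [])      = refl
ahead-put y (ls ▸ (_ ∷ _)) = refl

runway-zipWith : ∀ {n} (k : Fin n) (bs : Vec Bool n) (ys : Vec Datum n) zs → T (not (lookup bs k)) →
  length (ahead (lookup (Vec.zipWith (λ b (y , z) → adjust b y z) bs (Vec.zip ys zs)) k))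
    ≡ length (ahead (lookup zs k))
runway-zipWith zero    (false ∷ bs) (y ∷ ys) (z ∷ zs) t = ahead-put y z
runway-zipWith (suc k) (_ ∷ bs)     (_ ∷ ys) (_ ∷ zs) t = runway-zipWith k bs ys zs t

runway-iter : ∀ {k} n {f : Store → Store} σ → (∀ σ → runway k (f σ) ≡ runway k σ) →
  runway k (iter n f σ) ≡ runway k σ
runway-iter zero    σ eq = refl
runway-iter (suc n) σ eq = trans (runway-iter n _ eq) (eq σ)

-- The meaning of a loop fixes the number of laps on entry, whereas the machine tests for the end
-- before each lap. This invariance reconciles the two.
runway-⟦⟧ : ∀ p {k} σ → T (not (moves p k)) → runway k (⟦ p ⟧ σ) ≡ runway k σ
runway-⟦⟧ (perform bs rd f) {k} σ t = runway-zipWith k bs (writes (effectAt f σ) (zips σ)) (zips σ) t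
runway-⟦⟧ (p ⨾ q) {k} σ t =
  trans (runway-⟦⟧ q (⟦ p ⟧ σ) (T-not-∨ʳ (moves p k) t)) (runway-⟦⟧ p σ (T-not-∨ˡ (moves p k) t))
runway-⟦⟧ (rewind l) σ t = runway-onZip toStart σ t
runway-⟦⟧ (loop l p) {k} σ t = runway-iter (runway l σ) σ
  (λ τ → trans (runway-onZip advance (⟦ p ⟧ τ) (T-not-∨ˡ (sameSlot l k) t))
               (runway-⟦⟧ p τ (T-not-∨ʳ (sameSlot l k) t)))

-- Stores as tape contents

onTape : Zip → Track
-- Tapes are compared as lists, so visited blanks are explicit: the left one stems from the padding
-- moves, the right one from the end of the copying phase.
onTape (ls ▸ [])       = tape (List.map work ls ++ List.[ blank ]) blank []
onTape (ls ▸ (x ∷ rs)) = tape (List.map work ls ++ List.[ blank ]) (work x) (List.map work rs ++ List.[ blank ])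

-- The certificate is only read forwards. The squares `ls` behind the head are therefore arbitrary,
-- and later statements quantify over them existentially.
certTape : List Square → List Bool → Track
certTape ls []      = tape ls blank []
certTape ls (b ∷ u) = tape ls (bit b) (List.map bit u)

tapesOf : List Square → Store → Vec Track 7
tapesOf ls σ = spread (certTape ls (cert σ)) (Vec.map onTape (zips σ))

act-keep : ∀ (t : Track) → act (keep (head t)) t ≡ t
act-keep (tape _ _ _) = refl

act-head : ∀ m (t : Track) → act (head t , m) t ≡ move m t
act-head m (tape _ _ _) = refl

heads : ∀ {n} → Vec Track n → Vec Square n
heads = Vec.map head

apply : ∀ {n} → Vec Action n → Vec Track n → Vec Track n
apply = Vec.zipWith act

apply-keep : ∀ {n} (ts : Vec Track n) → apply (Vec.map keep (heads ts)) ts ≡ ts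
apply-keep []       = refl
apply-keep (t ∷ ts) = cong₂ _∷_ (act-keep t) (apply-keep ts)

apply-solo : ∀ {n} (k : Fin n) m (ts : Vec Track n) →
  apply (solo k m (heads ts)) ts ≡ updateAt ts k (move m)
apply-solo zero    m (t ∷ ts) = cong₂ _∷_ (act-head m t) (apply-keep ts)
apply-solo (suc k) m (t ∷ ts) = cong₂ _∷_ (act-keep t) (apply-solo k m ts)

-- Commutation is asked only at the entry concerned, because `move right` matches `advance` only on
-- a zip that is not at its end.
updateAt-spread : ∀ {A B : Set} {n} (k : Fin (suc n)) {f : A → A} {g : B → B} {h : A → B} (y : B) xs →
  g (h (lookup xs k)) ≡ h (f (lookup xs k)) →
  updateAt (spread y (Vec.map h xs)) (slot k) g ≡ spread y (Vec.map h (updateAt xs k f))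
updateAt-spread zero    y (x ∷ xs) eq = cong (λ z → z ∷ y ∷ _) eq
updateAt-spread (suc k) y (x ∷ xs) eq = cong (λ zs → _ ∷ y ∷ zs) (sym (map-updateAt xs k (sym eq)))

lookup-heads : ∀ k ls σ → lookup (heads (tapesOf ls σ)) (slot k) ≡ head (onTape (lookup (zips σ) k))
lookup-heads zero    ls (store _ _ (z ∷ zs) _) = refl
lookup-heads (suc k) ls (store _ _ (z ∷ zs) _) =
  trans (lookup-map k head (Vec.map onTape zs)) (cong head (lookup-map k onTape zs))

move-advance : ∀ ls x rs → move right (onTape (ls ▸ (x ∷ rs))) ≡ onTape ((x ∷ ls) ▸ rs)
move-advance ls x []       = refl
move-advance ls x (_ ∷ _) = refl

onDatum-correct : ∀ b y z → act (onDatum b y (head (onTape z))) (onTape z) ≡ onTape (adjust b y z)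
onDatum-correct false y (ls ▸ [])       = refl
onDatum-correct true  y (ls ▸ [])       = refl
onDatum-correct false y (ls ▸ (x ∷ rs)) = refl
onDatum-correct true  y (ls ▸ (x ∷ rs)) = move-advance ls y rs

onBit-correct : ∀ rd ls u → ∃[ ls′ ] act (onBit rd (head (certTape ls u))) (certTape ls u) ≡ certTape ls′ (popIf rd u)
onBit-correct false ls []          = ls , refl
onBit-correct false ls (b ∷ u)     = ls , refl
onBit-correct true  ls []          = ls , refl
onBit-correct true  ls (b ∷ [])    = bit b ∷ ls , refl
onBit-correct true  ls (b ∷ c ∷ u) = bit b ∷ ls , refl

readDatum-correct : ∀ z → readDatum (head (onTape z)) ≡ current z
readDatum-correct (ls ▸ [])      = refl
readDatum-correct (ls ▸ (_ ∷ _)) = refl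

readBit-correct : ∀ ls u → readBit (head (certTape ls u)) ≡ peek u
readBit-correct ls []      = refl
readBit-correct ls (_ ∷ _) = refl

effect-correct : ∀ f ls σ → effectOf f (flag σ) (heads (tapesOf ls σ)) ≡ effectAt f σ
effect-correct f ls (store _ x (z₀ ∷ z₁ ∷ z₂ ∷ _) u)
  rewrite readDatum-correct z₀ | readDatum-correct z₁ | readDatum-correct z₂ | readBit-correct ls u = refl

readData-correct : ∀ {n} (zs : Vec Zip n) → Vec.map readDatum (heads (Vec.map onTape zs)) ≡ Vec.map current zs
readData-correct []       = refl
readData-correct (z ∷ zs) = cong₂ _∷_ (readDatum-correct z) (readData-correct zs)

newData-correct : ∀ e ls σ → newData e (heads (tapesOf ls σ)) ≡ writes e (zips σ)
newData-correct e ls (store _ x (z₀ ∷ z₁ ∷ z₂ ∷ zs) u) = cong (λ ds → _ ∷ _ ∷ _ ∷ ds) (readData-correct zs)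

adjust-correct : ∀ {n} (bs : Vec Bool n) ys zs →
  apply (Vec.zipWith (λ b (y , h) → onDatum b y h) bs (Vec.zip ys (heads (Vec.map onTape zs)))) (Vec.map onTape zs)
    ≡ Vec.map onTape (Vec.zipWith (λ b (y , z) → adjust b y z) bs (Vec.zip ys zs))
adjust-correct []       []       []       = refl
adjust-correct (b ∷ bs) (y ∷ ys) (z ∷ zs) = cong₂ _∷_ (onDatum-correct b y z) (adjust-correct bs ys zs)

apply-spread : ∀ {n} a t (as : Vec Action (suc n)) ts → apply (spread a as) (spread t ts) ≡ spread (act a t) (apply as ts)
apply-spread a t (_ ∷ as) (_ ∷ ts) = refl

unspread-heads : ∀ ls σ → unspread (heads (tapesOf ls σ)) ≡ heads (Vec.map onTape (zips σ))
unspread-heads ls (store _ _ (_ ∷ _) _) = refl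

cert-head : ∀ ls σ → lookup (heads (tapesOf ls σ)) (suc zero) ≡ head (certTape ls (cert σ))
cert-head ls (store _ _ (_ ∷ _) _) = refl

perform-correct : ∀ bs rd f ls σ → let ts = tapesOf ls σ in
  ∃[ ls′ ] apply (performActions bs rd (effectOf f (flag σ) (heads ts)) (heads ts)) ts
             ≡ tapesOf ls′ (⟦ perform bs rd f ⟧ σ)
perform-correct bs rd f ls σ
  rewrite effect-correct f ls σ | newData-correct (effectAt f σ) ls σ | unspread-heads ls σ | cert-head ls σ
  with onBit-correct rd ls (cert σ)
... | ls′ , eq = ls′ , trans (apply-spread (onBit rd (head (certTape ls (cert σ)))) (certTape ls (cert σ)) _ _)
                        (cong₂ spread eq (adjust-correct bs (writes (effectAt f σ) (zips σ)) (zips σ)))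

ʳ++-++ : ∀ {A : Set} (xs {ys zs} : List A) → (xs ʳ++ ys) ++ zs ≡ xs ʳ++ (ys ++ zs)
ʳ++-++ []       = refl
ʳ++-++ (x ∷ xs) = ʳ++-++ xs

-- Simulation of programs by the machine

module Simulation (p₀ : Prog) where

  open Machine (machine p₀) using (δ; step; run; Config; initial)

  Control : Set
  Control = Phase ⊎ Point p₀

  data _⟶⟨_⟩_ : Config → ℕ → Config → Set where
    stop : ∀ {c} → c ⟶⟨ 0 ⟩ c
    then : ∀ {c c′ c″ t} → step c ≡ inj₂ c′ → c′ ⟶⟨ t ⟩ c″ → c ⟶⟨ suc t ⟩ c″

  _▹_ : ∀ {c c′ c″ s t} → c ⟶⟨ s ⟩ c′ → c′ ⟶⟨ t ⟩ c″ → c ⟶⟨ s + t ⟩ c″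
  stop     ▹ r = r
  then e q ▹ r = then e (q ▹ r)

  run-⟶ : ∀ {c c′ t} r → c ⟶⟨ t ⟩ c′ → run (t + r) c ≡ run r c′
  run-⟶ r stop = refl
  run-⟶ r (then e q) rewrite e = run-⟶ r q

  at : Control → Store → List Square → Config
  at s σ ls = (s , ok σ , flag σ) , tapesOf ls σ

  -- The machine belongs to the whole program `p₀`, but the induction runs over its subprograms. A
  -- subprogram is known only through the place `emb` of its points in the control and the state `k`
  -- to which it exits.
  Embeds : (p : Prog) → (Point p → Control) → Control → Set
  Embeds p emb k = ∀ s c hs → δ (emb s , c) hs ≡ continue (mapState (maybe emb k) (transition p s c hs))

  step-δ : ∀ {s c s′ c′ as} ts {ts′} → δ (s , c) (heads ts) ≡ inj₂ ((s′ , c′) , as) →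
    apply as ts ≡ ts′ → step ((s , c) , ts) ≡ inj₂ ((s′ , c′) , ts′)
  step-δ ts e refl rewrite e = refl

  Bounded : ℕ → Store → Set
  Bounded N σ = ∀ k → lookup (sizes σ) k ≤ N

  bounded-⟦⟧ : ∀ {N} p σ → Bounded N σ → Bounded N (⟦ p ⟧ σ)
  bounded-⟦⟧ p σ b k rewrite sizes-⟦⟧ p σ = b k

  -- The left end of a tape is at its explicit blank; `scanned ls R` is a tape on
  -- which the data ls remain to be passed on the way there.
  scanned : List Datum → List Square → Track
  scanned []       R = tape [] blank R
  scanned (x ∷ ls) R = tape (List.map work ls ++ List.[ blank ]) (work x) R

  move-left : ∀ ls h R → move left (tape (List.map work ls ++ List.[ blank ]) h R) ≡ scanned ls (h ∷ R)
  move-left []      h R = refl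
  move-left (_ ∷ _) h R = refl

  returned : List Datum → List Square → Track
  returned ls R = move right (tape [] blank (List.map work ls ʳ++ R))

  returned-toStart : ∀ ls rs → returned ls (List.map work rs ++ List.[ blank ]) ≡ onTape (toStart (ls ▸ rs))
  returned-toStart ls rs = trans (cong (move right ∘ tape [] blank) split) (restart (ls ʳ++ rs))
    where
    split : List.map work ls ʳ++ (List.map work rs ++ List.[ blank ])
              ≡ List.map work (ls ʳ++ rs) ++ List.[ blank ]
    split = trans (sym (ʳ++-++ (List.map work ls))) (cong (_++ List.[ blank ]) (sym (map-ʳ++ work ls)))
    restart : ∀ xs → move right (tape [] blank (List.map work xs ++ List.[ blank ])) ≡ onTape ([] ▸ xs)
    restart []      = refl
    restart (_ ∷ _) = refl

  leave-start : ∀ ls rs → move left (onTape (ls ▸ rs)) ≡ scanned ls (List.map work rs ++ List.[ blank ])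
  leave-start ls []       = move-left ls blank []
  leave-start ls (x ∷ rs) = move-left ls (work x) _

  updateAt-≔ : ∀ {A : Set} {n} (xs : Vec A n) k f {x} → updateAt (xs [ k ]≔ x) k f ≡ xs [ k ]≔ f x
  updateAt-≔ xs k f = updateAt-updateAt k xs

  heads-≔ : ∀ {n} (ts : Vec Track n) k {t} → lookup (heads (ts [ k ]≔ t)) k ≡ head t
  heads-≔ ts k = trans (lookup-map k head (ts [ k ]≔ _)) (cong head (lookup∘updateAt k ts))

  lookup-tapesOf : ∀ k ls σ → lookup (tapesOf ls σ) (slot k) ≡ onTape (lookup (zips σ) k)
  lookup-tapesOf zero    ls (store _ _ (z ∷ zs) _) = refl
  lookup-tapesOf (suc k) ls (store _ _ (z ∷ zs) _) = lookup-map k onTape zs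

  rewind-more : ∀ k c hs → isBlank (lookup hs (slot k)) ≡ false →
    transition (rewind k) true c hs ≡ (just true , c , solo (slot k) left hs)
  rewind-more k c hs e rewrite e = refl

  rewind-end : ∀ k c hs → isBlank (lookup hs (slot k)) ≡ true →
    transition (rewind k) true c hs ≡ (nothing , c , solo (slot k) right hs)
  rewind-end k c hs e rewrite e = refl

  loop-more : ∀ k p c hs → isBlank (lookup hs (slot k)) ≡ false →
    transition (loop k p) (inj₁ false) c hs ≡ (just (inj₂ (entryPoint p)) , c , Vec.map keep hs)
  loop-more k p c hs e rewrite e = refl

  loop-end : ∀ k p c hs → isBlank (lookup hs (slot k)) ≡ true →
    transition (loop k p) (inj₁ false) c hs ≡ (nothing , c , Vec.map keep hs)
  loop-end k p c hs e rewrite e = refl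

  enter : ∀ p {emb k} → Embeds p emb k → ∀ {s c s′ c′ as} ts {ts′} →
    transition p s c (heads ts) ≡ (s′ , c′ , as) → apply as ts ≡ ts′ →
    step ((emb s , c) , ts) ≡ inj₂ ((maybe emb k s′ , c′) , ts′)
  enter p H {s} {c} ts e eq = step-δ ts (trans (H s c (heads ts)) (cong (continue ∘ mapState (maybe _ _)) e)) eq

  rewind-scan : ∀ k {emb exit} → Embeds (rewind k) emb exit → ∀ c ts ls R →
    ((emb true , c) , ts [ slot k ]≔ scanned ls R) ⟶⟨ length ls + 1 ⟩
    ((exit , c) , ts [ slot k ]≔ returned ls R)
  rewind-scan k H c ts [] R = then
    (enter (rewind k) H ts′ (rewind-end k c (heads ts′) (cong isBlank (heads-≔ ts (slot k))))
      (trans (apply-solo (slot k) right ts′) (updateAt-≔ ts (slot k) (move right))))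
    stop
    where ts′ = ts [ slot k ]≔ scanned [] R
  rewind-scan k H c ts (x ∷ ls) R = then
    (enter (rewind k) H ts′ (rewind-more k c (heads ts′) (cong isBlank (heads-≔ ts (slot k))))
      (trans (apply-solo (slot k) left ts′)
        (trans (updateAt-≔ ts (slot k) (move left)) (cong (ts [ slot k ]≔_) (move-left ls (work x) R)))))
    (rewind-scan k H c ts ls (work x ∷ R))
    where ts′ = ts [ slot k ]≔ scanned (x ∷ ls) R

  Simulated : ∀ p (emb : Point p → Control) → Control → ℕ → List Square → Store → Set
  Simulated p emb exit N ls σ = ∃[ t ] ∃[ ls′ ]
    t ≤ cost p N × (at (emb (entryPoint p)) σ ls ⟶⟨ t ⟩ at exit (⟦ p ⟧ σ) ls′)

  simulate-rewind : ∀ k {emb exit} → Embeds (rewind k) emb exit → ∀ N ls σ → Bounded N σ →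
    Simulated (rewind k) emb exit N ls σ
  simulate-rewind k {emb} {exit} H N ls σ b =
    suc (length behind + 1) , ls , bound , then
      (enter (rewind k) H ts refl (trans (apply-solo (slot k) left ts)
        (updateAt-cong-local (slot k) ts
          (trans (cong (move left) (lookup-tapesOf k ls σ)) (leave-start behind front)))))
      (subst (λ ts′ → ((emb true , _) , ts [ slot k ]≔ scanned behind R) ⟶⟨ length behind + 1 ⟩ ((exit , _) , ts′))
        (updateAt-spread k {f = toStart} {h = onTape} (certTape ls (cert σ)) (zips σ) (returned-toStart behind front))
        (rewind-scan k H (ok σ , flag σ) ts behind R))
    where
    ts   = tapesOf ls σ
    behind = passed (lookup (zips σ) k)
    front = ahead (lookup (zips σ) k)
    R    = List.map work front ++ List.[ blank ]
    bound : suc (length behind + 1) ≤ 2 + N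
    bound = s≤s (≤-trans (≤-reflexive (+-comm (length behind) 1))
      (s≤s (≤-trans (m≤m+n (length behind) (length front))
        (subst (_≤ N) (lookup-map k size (zips σ)) (b k)))))

  at-end : ∀ z → length (ahead z) ≡ 0 → isBlank (head (onTape z)) ≡ true
  at-end (ls ▸ []) _ = refl

  not-at-end : ∀ z {r} → length (ahead z) ≡ suc r → isBlank (head (onTape z)) ≡ false
  not-at-end (ls ▸ (_ ∷ _)) _ = refl

  move-onTape : ∀ z {r} → length (ahead z) ≡ suc r → move right (onTape z) ≡ onTape (advance z)
  move-onTape (ls ▸ (x ∷ rs)) _ = move-advance ls x rs

  ahead-advance : ∀ z {r} → length (ahead z) ≡ suc r → length (ahead (advance z)) ≡ r
  ahead-advance (ls ▸ (_ ∷ _)) refl = refl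

  -- Induction on the number `r` of laps left. The simulation of the body is a hypothesis, which
  -- keeps the recursion of `simulate` structural in the program.
  simulate-loop : ∀ k p {emb exit} → Embeds (loop k p) emb exit → T (not (moves p k)) → ∀ N →
    (∀ ls σ → Bounded N σ → Simulated p (emb ∘ inj₂) (emb (inj₁ true)) N ls σ) →
    ∀ r ls σ → runway k σ ≡ r → Bounded N σ → ∃[ t ] ∃[ ls′ ]
      t ≤ r * (cost p N + 2) + 1 ×
      (at (emb (inj₁ false)) σ ls ⟶⟨ t ⟩ at exit (iter r (onZip k advance ∘ ⟦ p ⟧) σ) ls′)
  simulate-loop k p H wf N body zero ls σ r≡ b = 1 , ls , ≤-refl , then
    (enter (loop k p) H ts (loop-end k p (ok σ , flag σ) (heads ts)
        (trans (cong isBlank (lookup-heads k ls σ)) (at-end (lookup (zips σ) k) r≡)))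
      (apply-keep ts))
    stop
    where ts = tapesOf ls σ
  simulate-loop k p {emb} {exit} H wf N body (suc r) ls σ r≡ b with body ls σ b
  ... | t , ls₁ , t≤ , run₁ with simulate-loop k p H wf N body r ls₁ (onZip k advance (⟦ p ⟧ σ))
                                 (trans (cong (length ∘ ahead) (lookup∘updateAt k (zips (⟦ p ⟧ σ))))
                                   (ahead-advance (lookup (zips (⟦ p ⟧ σ)) k) σ₁≡))
                                 (bounded-advance (⟦ p ⟧ σ) (bounded-⟦⟧ p σ b))
    where
    σ₁≡ : runway k (⟦ p ⟧ σ) ≡ suc r
    σ₁≡ = trans (runway-⟦⟧ p σ wf) r≡
    bounded-advance : ∀ σ → Bounded N σ → Bounded N (onZip k advance σ)
    bounded-advance σ b l = subst (λ ns → lookup ns l ≤ N) (sym (sizes-onZip k σ size-advance)) (b l)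
  ... | t′ , ls₂ , t′≤ , run₂ =
    suc (t + suc t′) , ls₂ , bound ,
    then
      (enter (loop k p) H ts (loop-more k p (ok σ , flag σ) (heads ts)
          (trans (cong isBlank (lookup-heads k ls σ)) (not-at-end (lookup (zips σ) k) r≡)))
        (apply-keep ts))
      (run₁ ▹ then
        (enter (loop k p) H ts₁ refl (trans (apply-solo (slot k) right ts₁)
          (updateAt-spread k {f = advance} {h = onTape} (certTape ls₁ (cert σ₁)) (zips σ₁)
            (move-onTape (lookup (zips σ₁) k) (trans (runway-⟦⟧ p σ wf) r≡)))))
        run₂)
    where
    ts  = tapesOf ls σ
    σ₁  = ⟦ p ⟧ σ
    ts₁ = tapesOf ls₁ σ₁
    bound : suc (t + suc t′) ≤ cost p N + 2 + r * (cost p N + 2) + 1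
    bound = begin
      suc (t + suc t′)                              ≤⟨ s≤s (+-mono-≤ t≤ (s≤s t′≤)) ⟩
      suc (cost p N + suc (r * (cost p N + 2) + 1)) ≡⟨ cong suc (+-suc (cost p N) _) ⟩
      2 + (cost p N + (r * (cost p N + 2) + 1))     ≡⟨ cong (2 +_) (+-assoc (cost p N) _ 1) ⟨
      2 + (cost p N + r * (cost p N + 2) + 1)       ≡⟨ cong (_+ 1) (+-assoc 2 (cost p N) _) ⟨
      2 + cost p N + r * (cost p N + 2) + 1         ≡⟨ cong (λ a → a + r * (cost p N + 2) + 1) (+-comm 2 (cost p N)) ⟩
      cost p N + 2 + r * (cost p N + 2) + 1         ∎
      where open ≤-Reasoning

  simulate : ∀ p {emb exit} → Embeds p emb exit → WellFormed p → ∀ N ls σ → Bounded N σ →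
    Simulated p emb exit N ls σ
  simulate (perform bs rd f) H _ N ls σ b with perform-correct bs rd f ls σ
  ... | ls′ , eq = 1 , ls′ , ≤-refl , then (enter (perform bs rd f) H (tapesOf ls σ) (performed (effect-correct f ls σ)) eq) stop
    where
    performed : ∀ {e} → effectOf f (flag σ) (heads (tapesOf ls σ)) ≡ e →
      transition (perform bs rd f) tt (ok σ , flag σ) (heads (tapesOf ls σ)) ≡
        (nothing , (pass e ∧ ok σ , next e) ,
         performActions bs rd (effectOf f (flag σ) (heads (tapesOf ls σ))) (heads (tapesOf ls σ)))
    performed refl = refl
  simulate (p ⨾ q) {emb} {exit} H (wp , wq) N ls σ b
    with simulate p {emb ∘ inj₁} {emb (inj₂ (entryPoint q))} Hp wp N ls σ b
    where
    Hp : Embeds p (emb ∘ inj₁) (emb (inj₂ (entryPoint q)))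
    Hp s c hs with transition p s c hs | H (inj₁ s) c hs
    ... | just _  , _ | e = e
    ... | nothing , _ | e = e
  ... | t , ls₁ , t≤ , run₁ with simulate q {emb ∘ inj₂} {exit} Hq wq N ls₁ (⟦ p ⟧ σ) (bounded-⟦⟧ p σ b)
    where
    Hq : Embeds q (emb ∘ inj₂) exit
    Hq s c hs with transition q s c hs | H (inj₂ s) c hs
    ... | just _  , _ | e = e
    ... | nothing , _ | e = e
  ... | t′ , ls₂ , t′≤ , run₂ = t + t′ , ls₂ , +-mono-≤ t≤ t′≤ , run₁ ▹ run₂
  simulate (rewind k) H _ N ls σ b = simulate-rewind k H N ls σ b
  simulate (loop k p) {emb} {exit} H (nm , wp) N ls σ b
    with simulate-loop k p {emb} {exit} H nm N
           (λ ls σ b → simulate p {emb ∘ inj₂} {emb (inj₁ true)} Hp wp N ls σ b) (runway k σ) ls σ refl b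
    where
    Hp : Embeds p (emb ∘ inj₂) (emb (inj₁ true))
    Hp s c hs with transition p s c hs | H (inj₂ s) c hs
    ... | just _  , _ | e = e
    ... | nothing , _ | e = e
  ... | t , ls′ , t≤ , r = t , ls′ ,
    ≤-trans t≤ (+-monoˡ-≤ 1 (*-monoˡ-≤ (cost p N + 2) runway≤)) , r
    where
    runway≤ : runway k σ ≤ N
    runway≤ = ≤-trans (m≤n+m _ (length (passed (lookup (zips σ) k))))
      (subst (_≤ N) (lookup-map k size (zips σ)) (b k))

-- Loading the input, and the total time

extendBy : Bool → List Datum → List Datum
extendBy true  as = vacant ∷ as
extendBy false as = as

widen : Bool → List Symbol → List Datum → List Datum
widen b []      as = as
widen b (s ∷ w) as = widen (inFirstRow b s) w (extendBy (inFirstRow b s) as)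

copiedWith : List Datum → List Datum → List Bool → Store
copiedWith ms as u = store true false ((ms ▸ []) ∷ Vec.replicate 5 (as ▸ [])) u

-- Copying leaves the heads at the right end, so the data lie reversed in `passed` until `prepare`
-- rewinds them.
copied : List Symbol → List Bool → Store
copied w = copiedWith (List.map symbolDatum w ʳ++ []) (widen true w [])

length-widen : ∀ b w as → length (widen b w as) ≤ length w + length as
length-widen b []      as = ≤-refl
length-widen b (s ∷ w) as with inFirstRow b s
... | true  = ≤-trans (length-widen true w (vacant ∷ as)) (≤-reflexive (+-suc (length w) (length as)))
... | false = m≤n⇒m≤1+n (length-widen false w as)

module _ (p₀ : Prog) where

  open Simulation p₀
  open Machine (machine p₀) using (run; initial; step)

  unread : List Datum → List Symbol → Track
  unread ms []      = onTape (ms ▸ [])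
  unread ms (s ∷ w) = tape (List.map work ms ++ List.[ blank ]) (input s) (List.map input w)

  copying : List Datum → List Symbol → List Datum → List Bool → Vec Track 7
  copying ms w as u = unread ms w ∷ certTape [] u ∷ Vec.replicate 5 (onTape (as ▸ []))

  unread-next : ∀ ms s w →
    move right (tape (List.map work ms ++ List.[ blank ]) (work (symbolDatum s)) (List.map input w))
      ≡ unread (symbolDatum s ∷ ms) w
  unread-next ms s []      = refl
  unread-next ms s (_ ∷ _) = refl

  extended : ∀ x ms s w as u → let ts = copying ms (s ∷ w) as u in
    apply ((work (symbolDatum s) , right) ∷ keep (head (certTape [] u)) ∷
           Vec.map (extend x) (heads (Vec.replicate 5 (onTape (as ▸ []))))) ts
      ≡ copying (symbolDatum s ∷ ms) w (extendBy x as) u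
  extended true  ms s w as u = cong₂ (λ t t′ → t ∷ t′ ∷ Vec.replicate 5 (onTape ((vacant ∷ as) ▸ [])))
    (unread-next ms s w) (act-keep (certTape [] u))
  extended false ms s w as u = cong₂ (λ t t′ → t ∷ t′ ∷ Vec.replicate 5 (onTape (as ▸ [])))
    (unread-next ms s w) (act-keep (certTape [] u))

  run-copy : ∀ b w ms as u {c} →
    ((inj₁ (copy b) , c) , copying ms w as u) ⟶⟨ length w + 1 ⟩
    ((inj₂ (entryPoint p₀) , c) , tapesOf [] (copiedWith (List.map symbolDatum w ʳ++ ms) (widen b w as) u))
  run-copy b []      ms as u {c} = then
    (step-δ {s = inj₁ (copy b)} {c = c} {as = Vec.map keep (heads ts)} ts refl (apply-keep ts)) stop
    where ts = copying ms [] as u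
  run-copy b (s ∷ w) ms as u {c} = then
    (step-δ {s = inj₁ (copy b)} {c = c} (copying ms (s ∷ w) as u) refl (extended (inFirstRow b s) ms s w as u))
    (run-copy (inFirstRow b s) w (symbolDatum s ∷ ms) (extendBy (inFirstRow b s) as) u)

  run-pad : ∀ w u → initial w u ⟶⟨ 2 ⟩ ((inj₁ (copy true) , true , false) , copying [] w [] u)
  run-pad []      []      = then refl (then refl stop)
  run-pad []      (_ ∷ _) = then refl (then refl stop)
  run-pad (_ ∷ _) []      = then refl (then refl stop)
  run-pad (_ ∷ _) (_ ∷ _) = then refl (then refl stop)

  bounded-copied : ∀ w u → Bounded (length w) (copied w u)
  bounded-copied w u zero = ≤-reflexive (trans (+-identityʳ _)
    (trans (length-ʳ++ (List.map symbolDatum w)) (trans (+-identityʳ _) (length-map symbolDatum w))))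
  bounded-copied w u (suc k) = subst (_≤ length w) (sym (array k))
    (≤-trans (≤-reflexive (+-identityʳ _)) (subst (length (widen true w []) ≤_) (+-identityʳ _) (length-widen true w [])))
    where
    array : ∀ k → lookup (sizes (copied w u)) (suc k) ≡ length (widen true w []) + 0
    array k = trans (lookup-map k size (Vec.replicate 5 (widen true w [] ▸ [])))
      (cong size (lookup-replicate k (widen true w [] ▸ [])))

  -- The fuel covers two padding moves, one step per symbol and one to leave the copying phase, the
  -- program itself, and the halting step.
  verdict : WellFormed p₀ → ∀ w u fuel → 2 + (length w + 1 + (cost p₀ (length w) + 1)) ≤ fuel →
    run fuel (initial w u) ≡ just (ok (⟦ p₀ ⟧ (copied w u)))
  verdict wf w u fuel enough with simulate p₀ {inj₂} {inj₁ done} (λ _ _ _ → refl) wf (length w) [] (copied w u) (bounded-copied w u)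
  ... | t , ls , t≤ , r with m≤n⇒∃[o]m+o≡n (≤-trans (+-monoʳ-≤ 2 (+-monoʳ-≤ (length w + 1) (+-monoˡ-≤ 1 t≤))) enough)
  ...   | o , refl = begin
    run (2 + (length w + 1 + (t + 1)) + o) (initial w u)
      ≡⟨ cong (λ n → run n (initial w u)) (cong (2 +_) (trans (cong (_+ o) (sym (+-assoc (length w + 1) t 1))) (+-assoc (length w + 1 + t) 1 o))) ⟩
    run (2 + (length w + 1 + t) + suc o) (initial w u)
      ≡⟨ run-⟶ (suc o) (run-pad w u ▹ (run-copy true w [] [] u ▹ r)) ⟩
    run (suc o) (at (inj₁ done) (⟦ p₀ ⟧ (copied w u)) ls)
      ≡⟨⟩
    just (ok (⟦ p₀ ⟧ (copied w u))) ∎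
    where open ≡-Reasoning

  timeFactor timeDegree : ℕ
  timeDegree = suc (degree p₀)
  timeFactor = (4 + factor p₀) * 2 ^ timeDegree

  time≤ : ∀ N → 2 + (N + 1 + (cost p₀ N + 1)) ≤ timeFactor * N ^ timeDegree + timeFactor
  time≤ N = begin
    2 + (N + 1 + (cost p₀ N + 1))
      ≡⟨ solve 2 (λ n c → con 2 :+ (n :+ con 1 :+ (c :+ con 1)) := n :+ con 4 :+ c) refl N (cost p₀ N) ⟩
    N + 4 + cost p₀ N
      ≤⟨ +-mono-≤ N+4≤ (≤-trans (cost≤ p₀ N) (*-monoʳ-≤ (factor p₀) (^-monoʳ-≤ (suc N) (n≤1+n (degree p₀))))) ⟩
    4 * X + factor p₀ * X
      ≡⟨ *-distribʳ-+ X 4 (factor p₀) ⟨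
    (4 + factor p₀) * X
      ≤⟨ *-monoʳ-≤ (4 + factor p₀) ([1+n]^k≤ N timeDegree) ⟩
    (4 + factor p₀) * (2 ^ timeDegree * N ^ timeDegree + 2 ^ timeDegree)
      ≡⟨ solve 3 (λ a b c → a :* (b :* c :+ b) := a :* b :* c :+ a :* b) refl (4 + factor p₀) (2 ^ timeDegree) (N ^ timeDegree) ⟩
    timeFactor * N ^ timeDegree + timeFactor ∎
    where
    open ≤-Reasoning
    open import Data.Nat.Solver using (module +-*-Solver)
    open +-*-Solver
    X = suc N ^ timeDegree
    N+4≤ : N + 4 ≤ 4 * X
    N+4≤ = begin
      N + 4               ≤⟨ +-monoˡ-≤ 4 (m≤n*m N 4) ⟩
      4 * N + 4           ≡⟨ solve 1 (λ n → con 4 :* n :+ con 4 := con 4 :* (con 1 :+ n)) refl N ⟩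
      4 * suc N           ≡⟨ cong (4 *_) (*-identityʳ (suc N)) ⟨
      4 * (suc N * 1)     ≤⟨ *-monoʳ-≤ 4 (*-monoʳ-≤ (suc N) (m^n>0 (suc N) (degree p₀))) ⟩
      4 * X               ∎

-- Sweeps along the index tapes and through the matrix

-- A record, so that the program can be recovered from the type.
record _∶_⟿_ (p : Prog) (σ τ : Store) : Set where
  constructor runs
  field result : ⟦ p ⟧ σ ≡ τ

open _∶_⟿_ public

infixr 5 _⊚_

_⊚_ : ∀ {p q σ τ υ} → p ∶ σ ⟿ τ → q ∶ τ ⟿ υ → (p ⨾ q) ∶ σ ⟿ υ
_⊚_ {q = q} (runs e) (runs e′) = runs (trans (cong ⟦ q ⟧ e) e′)

infix 4 _∶_⟿_

Zips₃ : Set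
Zips₃ = Vec Zip 3

pattern matrix  = zero
pattern rows    = suc zero
pattern columns = suc (suc zero)

along-matrix along-columns nowhere : Vec Bool 6
along-matrix  = true  ∷ false ∷ false ∷ false ∷ false ∷ false ∷ []
along-columns = false ∷ false ∷ true  ∷ false ∷ false ∷ false ∷ []
nowhere       = false ∷ false ∷ false ∷ false ∷ false ∷ false ∷ []

put-here : ∀ z → put (current z) z ≡ z
put-here (ls ▸ [])      = refl
put-here (ls ▸ (_ ∷ _)) = refl

ready : ∀ {n} → Bool → Bool → List Datum → (V C : Fin n → Datum) → Zips₃ → List Bool → Store
ready o x ms V C ts u = store o x (([] ▸ ms) ∷ ([] ▸ tabulate V) ∷ ([] ▸ tabulate C) ∷ ts) u

ʳ++-involutive : ∀ {A : Set} (xs : List A) → (xs ʳ++ []) ʳ++ [] ≡ xs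
ʳ++-involutive xs = trans (ʳ++-ʳ++ xs) (++-identityʳ xs)

Update₁ : Set
Update₁ = Bool → Bool → Datum → Bool × Bool × Datum

-- Both the row tape and the column tape receive the new value, so that they
-- agree afterwards.
sweepBody : Bool → Update₁ → Prog
sweepBody rd f = perform along-columns rd
  (λ x b m r c → let (k , x′ , v) = f x b r in effect k x′ m v v)

sweep : Bool → Update₁ → Prog
sweep rd f = loop rows (sweepBody rd f) ⨾ rewind rows ⨾ rewind columns

record Swept : Set where
  constructor swept
  field
    ok′ flag′ : Bool
    data′     : List Datum
    cert′     : List Bool

open Swept

prepend : Datum → Swept → Swept
prepend v (swept o x vs u) = swept o x (v ∷ vs) u

accum : Bool → Update₁ → ∀ {n} → (Fin n → Datum) → Bool → Bool → List Bool → Swept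
accum rd f {zero}  V o x u = swept o x [] u
accum rd f {suc n} V o x u = let (k , x′ , v) = f x (peek u) (V zero) in
  prepend v (accum rd f (V ∘ suc) (k ∧ o) x′ (popIf rd u))

keep₃ : (t₁ t₂ t₃ : Zip) → _≡_ {A = Zips₃}
  (put (current t₁) t₁ ∷ put (current t₂) t₂ ∷ put (current t₃) t₃ ∷ []) (t₁ ∷ t₂ ∷ t₃ ∷ [])
keep₃ t₁ t₂ t₃ rewrite put-here t₁ | put-here t₂ | put-here t₃ = refl

sweep-loop : ∀ rd f {n} (V C : Fin n → Datum) m rl cl ts o x u → let a = accum rd f V o x u in
  iter n (onZip rows advance ∘ ⟦ sweepBody rd f ⟧)
    (store o x (m ∷ (rl ▸ tabulate V) ∷ (cl ▸ tabulate C) ∷ ts) u)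
    ≡ store (ok′ a) (flag′ a) (m ∷ ((data′ a ʳ++ rl) ▸ []) ∷ ((data′ a ʳ++ cl) ▸ []) ∷ ts) (cert′ a)
sweep-loop rd f {zero}  V C m rl cl ts o x u = refl
sweep-loop rd f {suc n} V C m rl cl (t₁ ∷ t₂ ∷ t₃ ∷ []) o x u
  rewrite put-here m | keep₃ t₁ t₂ t₃
  = sweep-loop rd f (V ∘ suc) (C ∘ suc) m _ _ (t₁ ∷ t₂ ∷ t₃ ∷ []) _ _ _

sweep-spec : ∀ rd f {n} (V C : Fin n → Datum) ms ts o x u → let a = accum rd f V o x u in
  ⟦ sweep rd f ⟧ (ready o x ms V C ts u)
    ≡ store (ok′ a) (flag′ a) (([] ▸ ms) ∷ ([] ▸ data′ a) ∷ ([] ▸ data′ a) ∷ ts) (cert′ a)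
sweep-spec rd f V C ms ts o x u
  rewrite length-tabulate V = trans
    (cong ⟦ rewind rows ⨾ rewind columns ⟧ (sweep-loop rd f V C ([] ▸ ms) [] [] ts o x u))
    (cong (λ vs → store (ok′ a) (flag′ a) (([] ▸ ms) ∷ ([] ▸ vs) ∷ ([] ▸ vs) ∷ ts) (cert′ a)) (ʳ++-involutive (data′ a)))
  where a = accum rd f V o x u

sweep-ready : ∀ {rd f n} {V V′ : Fin n → Datum} C {ms ts o o′ x x′ u u′} →
  accum rd f V o x u ≡ swept o′ x′ (tabulate V′) u′ →
  sweep rd f ∶ ready o x ms V C ts u ⟿ ready o′ x′ ms V′ V′ ts u′
sweep-ready {rd} {f} {V = V} C {ms} {ts} {o} {x = x} {u = u} eq = runs (trans (sweep-spec rd f V C ms ts o x u)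
  (cong (λ a → store (ok′ a) (flag′ a) (([] ▸ ms) ∷ ([] ▸ data′ a) ∷ ([] ▸ data′ a) ∷ ts) (cert′ a)) eq))

Update₂ : Set
Update₂ = Datum → Datum → Datum → Bool × Datum × Datum

gridCell : Update₂ → Prog
gridCell f = perform along-matrix false
  (λ x b m r c → let (k , m′ , r′) = f m r c in effect k x m′ r′ c)

gridRowEnd : (Datum → Bool) → Prog
gridRowEnd e = perform along-matrix false (λ x b m r c → effect (e m) x m r c)

gridRow : Update₂ → (Datum → Bool) → Prog
gridRow f e = loop columns (gridCell f) ⨾ rewind columns ⨾ gridRowEnd e

grid : Update₂ → (Datum → Bool) → Prog
grid f e = loop rows (gridRow f e)

gridSweep : Update₂ → Prog
gridSweep f = grid f (λ _ → true) ⨾ rewind rows ⨾ rewind matrix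

separator : Datum
separator = symbolDatum endRow

matrixCells : ∀ {k n} → (Fin k → Fin n → Datum) → List Datum
matrixCells {zero}  N = []
matrixCells {suc k} N = tabulate (N zero) ++ separator ∷ matrixCells (N ∘ suc)

record Scanned : Set where
  constructor scanned
  field
    okₛ    : Bool
    rowₛ   : Datum
    cellsₛ : List Datum

open Scanned

scanRow : Update₂ → ∀ {n} → (ms cs : Fin n → Datum) → Bool → Datum → Scanned
scanRow f {zero}  ms cs o r = scanned o r []
scanRow f {suc n} ms cs o r = let (k , m′ , r′) = f (ms zero) r (cs zero)
                                  (scanned o″ r″ ms″) = scanRow f (ms ∘ suc) (cs ∘ suc) (k ∧ o) r′
                              in scanned o″ r″ (m′ ∷ ms″)

row-loop : ∀ f {n} (ms cs : Fin n → Datum) ml rest rl r rs cl ts o x u → let a = scanRow f ms cs o r in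
  iter n (onZip columns advance ∘ ⟦ gridCell f ⟧)
    (store o x ((ml ▸ (tabulate ms ++ rest)) ∷ (rl ▸ (r ∷ rs)) ∷ (cl ▸ tabulate cs) ∷ ts) u)
    ≡ store (okₛ a) x (((cellsₛ a ʳ++ ml) ▸ rest) ∷ (rl ▸ (rowₛ a ∷ rs)) ∷ ((tabulate cs ʳ++ cl) ▸ []) ∷ ts) u
row-loop f {zero}  ms cs ml rest rl r rs cl ts o x u = refl
row-loop f {suc n} ms cs ml rest rl r rs cl (t₁ ∷ t₂ ∷ t₃ ∷ []) o x u
  rewrite keep₃ t₁ t₂ t₃
  = row-loop f (ms ∘ suc) (cs ∘ suc) _ rest rl _ rs _ (t₁ ∷ t₂ ∷ t₃ ∷ []) _ x u

row-spec : ∀ f e {n} (ms cs : Fin n → Datum) ml rest rl r rs ts o x u → e separator ≡ true →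
  let a = scanRow f ms cs o r in
  ⟦ gridRow f e ⟧ (store o x ((ml ▸ (tabulate ms ++ separator ∷ rest)) ∷ (rl ▸ (r ∷ rs)) ∷ ([] ▸ tabulate cs) ∷ ts) u)
    ≡ store (okₛ a) x (((separator ∷ (cellsₛ a ʳ++ ml)) ▸ rest) ∷ (rl ▸ (rowₛ a ∷ rs)) ∷ ([] ▸ tabulate cs) ∷ ts) u
row-spec f e ms cs ml rest rl r rs (t₁ ∷ t₂ ∷ t₃ ∷ []) o x u e-sep
  rewrite length-tabulate cs = trans
    (cong ⟦ rewind columns ⨾ gridRowEnd e ⟧ (row-loop f ms cs ml (separator ∷ rest) rl r rs [] (t₁ ∷ t₂ ∷ t₃ ∷ []) o x u))
    (trans (row-end ((tabulate cs ʳ++ []) ʳ++ []))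
      (cong (λ vs → store (okₛ a) x (((separator ∷ (cellsₛ a ʳ++ ml)) ▸ rest) ∷ (rl ▸ (rowₛ a ∷ rs)) ∷ ([] ▸ vs) ∷ t₁ ∷ t₂ ∷ t₃ ∷ []) u)
            (ʳ++-involutive (tabulate cs))))
  where
  a = scanRow f ms cs o r
  row-end : ∀ {o ml r} vs →
    ⟦ gridRowEnd e ⟧ (store o x ((ml ▸ (separator ∷ rest)) ∷ (rl ▸ (r ∷ rs)) ∷ ([] ▸ vs) ∷ t₁ ∷ t₂ ∷ t₃ ∷ []) u)
      ≡ store o x (((separator ∷ ml) ▸ rest) ∷ (rl ▸ (r ∷ rs)) ∷ ([] ▸ vs) ∷ t₁ ∷ t₂ ∷ t₃ ∷ []) u
  row-end vs rewrite put-here ([] ▸ vs) | keep₃ t₁ t₂ t₃ | e-sep = refl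

thread : ∀ {k} → (Fin k → Bool → Bool) → Bool → Bool
thread {zero}  K o = o
thread {suc k} K o = thread (K ∘ suc) (K zero o)

module _ (f : Update₂) (e : Datum → Bool) (e-sep : e separator ≡ true) {n} (cs : Fin n → Datum) where

  grid-loop : ∀ {k} (N N′ : Fin k → Fin n → Datum) (V V′ : Fin k → Datum) (K : Fin k → Bool → Bool) →
    (∀ j o → scanRow f (N j) cs o (V j) ≡ scanned (K j o) (V′ j) (tabulate (N′ j))) →
    ∀ ml rl ts o x u →
    iter k (onZip rows advance ∘ ⟦ gridRow f e ⟧)
      (store o x ((ml ▸ matrixCells N) ∷ (rl ▸ tabulate V) ∷ ([] ▸ tabulate cs) ∷ ts) u)
      ≡ store (thread K o) x (((matrixCells N′ ʳ++ ml) ▸ []) ∷ ((tabulate V′ ʳ++ rl) ▸ []) ∷ ([] ▸ tabulate cs) ∷ ts) u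
  grid-loop {zero}  N N′ V V′ K eq ml rl ts o x u = refl
  grid-loop {suc k} N N′ V V′ K eq ml rl ts o x u
    rewrite ++-ʳ++ (tabulate (N′ zero)) {separator ∷ matrixCells (N′ ∘ suc)} {ml} = trans
      (cong (iter k (onZip rows advance ∘ ⟦ gridRow f e ⟧) ∘ onZip rows advance)
        (trans (row-spec f e (N zero) cs ml (matrixCells (N ∘ suc)) rl (V zero) (tabulate (V ∘ suc)) ts o x u e-sep)
          (cong (λ a → store (okₛ a) x (((separator ∷ (cellsₛ a ʳ++ ml)) ▸ matrixCells (N ∘ suc)) ∷ (rl ▸ (rowₛ a ∷ tabulate (V ∘ suc))) ∷ ([] ▸ tabulate cs) ∷ ts) u) (eq zero o))))
      (grid-loop (N ∘ suc) (N′ ∘ suc) (V ∘ suc) (V′ ∘ suc) (K ∘ suc) (eq ∘ suc) _ _ ts (K zero o) x u)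

  grid-spec : ∀ {k} (N N′ : Fin k → Fin n → Datum) (V V′ : Fin k → Datum) (K : Fin k → Bool → Bool) →
    (∀ j o → scanRow f (N j) cs o (V j) ≡ scanned (K j o) (V′ j) (tabulate (N′ j))) →
    ∀ ts o x u →
    ⟦ grid f e ⟧ (store o x (([] ▸ matrixCells N) ∷ ([] ▸ tabulate V) ∷ ([] ▸ tabulate cs) ∷ ts) u)
      ≡ store (thread K o) x (((matrixCells N′ ʳ++ []) ▸ []) ∷ ((tabulate V′ ʳ++ []) ▸ []) ∷ ([] ▸ tabulate cs) ∷ ts) u
  grid-spec N N′ V V′ K eq ts o x u rewrite length-tabulate V = grid-loop N N′ V V′ K eq [] [] ts o x u

-- A pass changes the matrix and the row tape but leaves the column tape `C` alone. All rows see the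
-- same column data, so one independent equation per row describes the pass.
gridSweep-spec : ∀ f {n} (N N′ : Fin n → Fin n → Datum) (V V′ C : Fin n → Datum) (K : Fin n → Bool → Bool) →
  (∀ j o → scanRow f (N j) C o (V j) ≡ scanned (K j o) (V′ j) (tabulate (N′ j))) →
  ∀ ts o x u →
  (gridSweep f) ∶ ready o x (matrixCells N) V C ts u ⟿ ready (thread K o) x (matrixCells N′) V′ C ts u
gridSweep-spec f N N′ V V′ C K eq ts o x u = runs (trans
  (cong ⟦ rewind rows ⨾ rewind matrix ⟧ (grid-spec f (λ _ → true) refl C N N′ V V′ K eq ts o x u))
  (cong₂ (λ ms vs → store (thread K o) x (([] ▸ ms) ∷ ([] ▸ vs) ∷ ([] ▸ tabulate C) ∷ ts) u)
    (ʳ++-involutive (matrixCells N′)) (ʳ++-involutive (tabulate V′))))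

-- Images, checks and quantifiers computed by passes

any₁ : ∀ {n} → (Fin n → Bool) → Bool → Bool
any₁ {zero}  φ b = b
any₁ {suc n} φ b = any₁ (φ ∘ suc) (b ∨ φ zero)

all₁ : ∀ {n} → (Fin n → Bool) → Bool → Bool
all₁ {zero}  φ b = b
all₁ {suc n} φ b = all₁ (φ ∘ suc) (φ zero ∧ b)

all₂ : ∀ {m n} → (Fin m → Fin n → Bool) → Bool → Bool
all₂ φ = thread (λ j → all₁ (φ j))

thread-id : ∀ {k} o → thread {k} (λ _ → id) o ≡ o
thread-id {zero}  o = refl
thread-id {suc k} o = thread-id {k} o

-- The argument set is read from `cur` on the column tape, unchanged during the pass, while the row
-- tape accumulates the result in `image`. The sweep that follows turns `image` into the new `cur`
-- on both tapes.
imageCell : (Datum → Bool) → Update₂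
imageCell rel m r c = true , m , record r { image = image r ∨ (cur c ∧ rel m) }

mapSweep : (Bool → Datum → Datum) → Prog
mapSweep g = sweep false (λ x _ r → true , x , g x r)

imageOf : (Datum → Bool) → Prog
imageOf rel = gridSweep (imageCell rel) ⨾ mapSweep (λ _ r → record r { cur = image r ; image = false })

scanRow-image : ∀ (rel : Datum → Bool) {n} (ms cs : Fin n → Datum) o r → scanRow (imageCell rel) ms cs o r
  ≡ scanned o (record r { image = any₁ (λ i → cur (cs i) ∧ rel (ms i)) (image r) }) (tabulate ms)
scanRow-image rel {zero}  ms cs o r = refl
scanRow-image rel {suc n} ms cs o r
  rewrite scanRow-image rel (ms ∘ suc) (cs ∘ suc) o (record r { image = image r ∨ (cur (cs zero) ∧ rel (ms zero)) }) = refl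

accum-map : ∀ (g : Bool → Datum → Datum) {n} (V : Fin n → Datum) o x u →
  accum false (λ x _ r → true , x , g x r) V o x u ≡ swept o x (tabulate (g x ∘ V)) u
accum-map g {zero}  V o x u = refl
accum-map g {suc n} V o x u rewrite accum-map g (V ∘ suc) o x u = refl

mapSweep-spec : ∀ (g : Bool → Datum → Datum) {n} (V C : Fin n → Datum) ms ts o x u →
  (mapSweep g) ∶ ready o x ms V C ts u ⟿ ready o x ms (g x ∘ V) (g x ∘ V) ts u
mapSweep-spec g V C ms ts o x u = sweep-ready C (accum-map g V o x u)

imageRow : (Datum → Bool) → ∀ {n} → (Fin n → Fin n → Datum) → (Fin n → Datum) → Fin n → Datum
imageRow rel N V j =
  record (V j) { cur = any₁ (λ i → cur (V i) ∧ rel (N j i)) (image (V j)) ; image = false }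

imageOf-spec : ∀ rel {n} (N : Fin n → Fin n → Datum) (V : Fin n → Datum) ts o x u → let V′ = imageRow rel N V in
  (imageOf rel) ∶ ready o x (matrixCells N) V V ts u ⟿ ready o x (matrixCells N) V′ V′ ts u
imageOf-spec rel {n} N V ts o x u =
  subst (λ o′ → gridSweep (imageCell rel) ∶ ready o x (matrixCells N) V V ts u ⟿ ready o′ x (matrixCells N) _ V ts u)
    (thread-id {n} o)
    (gridSweep-spec (imageCell rel) N N V _ V (λ _ → id) (λ j o → scanRow-image rel (N j) V o (V j)) ts o x u) ⊚
  mapSweep-spec _ _ V (matrixCells N) ts o x u

bitAt : ∀ {n} → List Bool → Fin n → Bool
bitAt u zero    = peek u
bitAt u (suc j) = bitAt (popIf true u) j

dropBits : ℕ → List Bool → List Bool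
dropBits zero    u = u
dropBits (suc n) u = dropBits n (popIf true u)

readSweep : (Bool → Bool → Datum → Datum) → Prog
readSweep g = sweep true (λ x b r → true , x , g x b r)

accum-read : ∀ (g : Bool → Bool → Datum → Datum) {n} (V : Fin n → Datum) o x u →
  accum true (λ x b r → true , x , g x b r) V o x u
    ≡ swept o x (tabulate (λ j → g x (bitAt u j) (V j))) (dropBits n u)
accum-read g {zero}  V o x u = refl
accum-read g {suc n} V o x u rewrite accum-read g (V ∘ suc) o x (popIf true u) = refl

readSweep-spec : ∀ (g : Bool → Bool → Datum → Datum) {n} (V C : Fin n → Datum) ms ts o x u → let V′ = λ j → g x (bitAt u j) (V j) in
  (readSweep g) ∶ ready o x ms V C ts u ⟿ ready o x ms V′ V′ ts (dropBits n u)
readSweep-spec g V C ms ts o x u = sweep-ready C (accum-read g V o x u)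

rememberCell : Update₂
rememberCell m r c = true , record m { met = met m ∨ (inD r ∧ inD c) } , r

remember : Prog
remember = gridSweep rememberCell

scanRow-remember : ∀ {n} (ms cs : Fin n → Datum) o r → scanRow rememberCell ms cs o r
  ≡ scanned o r (tabulate (λ i → record (ms i) { met = met (ms i) ∨ (inD r ∧ inD (cs i)) }))
scanRow-remember {zero}  ms cs o r = refl
scanRow-remember {suc n} ms cs o r rewrite scanRow-remember (ms ∘ suc) (cs ∘ suc) o r = refl

rememberRow : ∀ {n} → (Fin n → Fin n → Datum) → (Fin n → Datum) → Fin n → Fin n → Datum
rememberRow N V j i = record (N j i) { met = met (N j i) ∨ (inD (V j) ∧ inD (V i)) }

remember-spec : ∀ {n} (N : Fin n → Fin n → Datum) (V : Fin n → Datum) ts o x u →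
  remember ∶ ready o x (matrixCells N) V V ts u ⟿ ready o x (matrixCells (rememberRow N V)) V V ts u
remember-spec {n} N V ts o x u =
  subst (λ o′ → remember ∶ ready o x (matrixCells N) V V ts u ⟿ ready o′ x (matrixCells (rememberRow N V)) V V ts u)
    (thread-id {n} o)
    (gridSweep-spec rememberCell N (rememberRow N V) V V V (λ _ → id) (λ j o → scanRow-remember (N j) V o (V j)) ts o x u)

checkGrid : (Datum → Datum → Datum → Bool) → Prog
checkGrid φ = gridSweep (λ m r c → φ m r c , m , r)

scanRow-check : ∀ (φ : Datum → Datum → Datum → Bool) {n} (ms cs : Fin n → Datum) o r → scanRow (λ m r c → φ m r c , m , r) ms cs o r
  ≡ scanned (all₁ (λ i → φ (ms i) r (cs i)) o) r (tabulate ms)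
scanRow-check φ {zero}  ms cs o r = refl
scanRow-check φ {suc n} ms cs o r rewrite scanRow-check φ (ms ∘ suc) (cs ∘ suc) (φ (ms zero) r (cs zero) ∧ o) r = refl

checkGrid-spec : ∀ (φ : Datum → Datum → Datum → Bool) {n} (N : Fin n → Fin n → Datum) (V : Fin n → Datum) ts o x u →
  (checkGrid φ) ∶ ready o x (matrixCells N) V V ts u ⟿ ready (all₂ (λ j i → φ (N j i) (V j) (V i)) o) x (matrixCells N) V V ts u
checkGrid-spec φ N V ts o x u =
  gridSweep-spec _ N N V V V _ (λ j o → scanRow-check φ (N j) V o (V j)) ts o x u

checkSweep : (Datum → Bool) → (Datum → Datum) → Prog
checkSweep φ g = sweep false (λ x _ r → φ r , x , g r)

accum-check : ∀ (φ : Datum → Bool) (g : Datum → Datum) {n} (V : Fin n → Datum) o x u →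
  accum false (λ x _ r → φ r , x , g r) V o x u ≡ swept (all₁ (φ ∘ V) o) x (tabulate (g ∘ V)) u
accum-check φ g {zero}  V o x u = refl
accum-check φ g {suc n} V o x u rewrite accum-check φ g (V ∘ suc) (φ (V zero) ∧ o) x u = refl

checkSweep-spec : ∀ (φ : Datum → Bool) (g : Datum → Datum) {n} (V C : Fin n → Datum) ms ts o x u →
  (checkSweep φ g) ∶ ready o x ms V C ts u ⟿ ready (all₁ (φ ∘ V) o) x ms (g ∘ V) (g ∘ V) ts u
checkSweep-spec φ g V C ms ts o x u = sweep-ready C (accum-check φ g V o x u)

existsSweep : (Datum → Bool) → Prog
existsSweep φ = sweep false (λ x _ r → true , x ∨ φ r , r)

accum-exists : ∀ (φ : Datum → Bool) {n} (V : Fin n → Datum) o x u →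
  accum false (λ x _ r → true , x ∨ φ r , r) V o x u ≡ swept o (any₁ (φ ∘ V) x) (tabulate V) u
accum-exists φ {zero}  V o x u = refl
accum-exists φ {suc n} V o x u rewrite accum-exists φ (V ∘ suc) o (x ∨ φ (V zero)) u = refl

existsSweep-spec : ∀ (φ : Datum → Bool) {n} (V : Fin n → Datum) ms ts o x u →
  (existsSweep φ) ∶ ready o x ms V V ts u ⟿ ready o (any₁ (φ ∘ V) x) ms V V ts u
existsSweep-spec φ V ms ts o x u = sweep-ready V (accum-exists φ V o x u)

-- The flag carries the mark hot to the next index.
shiftSweep : Prog
shiftSweep = sweep false (λ x _ r → true , hot r , record r { hot = x })

-- The sequence `κ` is one place longer than the tape: the flag brings in κ 0 on the left and
-- carries κ n away on the right.
accum-shift : ∀ {n} (V : Fin n → Datum) o x u (κ : ℕ → Bool) → x ≡ κ 0 → (∀ j → hot (V j) ≡ κ (suc (toℕ j))) →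
  accum false (λ x _ r → true , hot r , record r { hot = x }) V o x u
    ≡ swept o (κ n) (tabulate (λ j → record (V j) { hot = κ (toℕ j) })) u
accum-shift {zero}  V o x u κ refl eq = refl
accum-shift {suc n} V o x u κ refl eq
  rewrite accum-shift (V ∘ suc) o (hot (V zero)) u (κ ∘ suc) (eq zero) (eq ∘ suc) = refl

shiftSweep-spec : ∀ {n} (V C : Fin n → Datum) ms ts o x u (κ : ℕ → Bool) → x ≡ κ 0 → (∀ j → hot (V j) ≡ κ (suc (toℕ j))) →
  let V′ = λ j → record (V j) { hot = κ (toℕ j) } in
  shiftSweep ∶ ready o x ms V C ts u ⟿ ready o (κ n) ms V′ V′ ts u
shiftSweep-spec V C ms ts o x u κ x≡ eq = sweep-ready C (accum-shift V o x u κ x≡ eq)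

-- This forces F₁ to have at most one element whatever the certificate says.
pickFirst : ∀ {n} → Bool → (Fin n → Bool) → Fin n → Bool
pickFirst x β zero    = β zero ∧ not x
pickFirst x β (suc j) = pickFirst (x ∨ β zero) (β ∘ suc) j

pickSweep : Prog
pickSweep = sweep true (λ x b r → true , x ∨ b , record r { inF = b ∧ not x })

accum-pick : ∀ {n} (V : Fin n → Datum) o x u →
  accum true (λ x b r → true , x ∨ b , record r { inF = b ∧ not x }) V o x u
    ≡ swept o (any₁ {n} (bitAt u) x) (tabulate (λ j → record (V j) { inF = pickFirst x (bitAt u) j })) (dropBits n u)
accum-pick {zero}  V o x u = refl
accum-pick {suc n} V o x u rewrite accum-pick (V ∘ suc) o (x ∨ peek u) (popIf true u) = refl

pickSweep-spec : ∀ {n} (V C : Fin n → Datum) ms ts o x u →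
  let V′ = λ j → record (V j) { inF = pickFirst x (bitAt u) j } in
  pickSweep ∶ ready o x ms V C ts u ⟿ ready o (any₁ {n} (bitAt u) x) ms V′ V′ ts (dropBits n u)
pickSweep-spec V C ms ts o x u = sweep-ready C (accum-pick V o x u)

-- The verifier

setFlag : Bool → Prog
setFlag b = perform nowhere false (λ _ _ m r c → effect true b m r c)

readFlag requireFlag requireEnd : Prog
readFlag    = perform nowhere true (λ _ b m r c → effect true b m r c)
requireFlag = perform nowhere false (λ x _ m r c → effect x false m r c)
-- Every cell of the matrix tape holds a symbol, so `nothing` is read only past its end.
requireEnd  = perform nowhere false (λ x _ m r c → effect (maybe (λ _ → false) true (sym? m)) x m r c)

unmoved : ∀ rd (g : Bool → Bool → Datum → Bool) (h : Bool → Bool → Bool) o x z₀ z₁ z₂ ts u →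
  ⟦ perform nowhere rd (λ x b m r c → effect (g x b m) (h x b) m r c) ⟧ (store o x (z₀ ∷ z₁ ∷ z₂ ∷ ts) u)
    ≡ store (g x (peek u) (current z₀) ∧ o) (h x (peek u)) (z₀ ∷ z₁ ∷ z₂ ∷ ts) (popIf rd u)
unmoved rd g h o x z₀ z₁ z₂ (t₁ ∷ t₂ ∷ t₃ ∷ []) u
  rewrite put-here z₀ | put-here z₁ | put-here z₂ | keep₃ t₁ t₂ t₃ = refl

setFlag-spec : ∀ b {n} o x ms (V C : Fin n → Datum) ts u →
  (setFlag b) ∶ ready o x ms V C ts u ⟿ ready o b ms V C ts u
setFlag-spec b o x ms V C ts u = runs (unmoved false (λ _ _ _ → true) (λ _ _ → b) o x _ _ _ ts u)

readFlag-spec : ∀ {n} o x ms (V C : Fin n → Datum) ts u →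
  readFlag ∶ ready o x ms V C ts u ⟿ ready o (peek u) ms V C ts (popIf true u)
readFlag-spec o x ms V C ts u = runs (unmoved true (λ _ _ _ → true) (λ _ b → b) o x _ _ _ ts u)

requireFlag-spec : ∀ {n} o x ms (V C : Fin n → Datum) ts u →
  requireFlag ∶ ready o x ms V C ts u ⟿ ready (x ∧ o) false ms V C ts u
requireFlag-spec o x ms V C ts u = runs (unmoved false (λ x _ _ → x) (λ _ _ → false) o x _ _ _ ts u)

-- The verifier as a function of the certificate

_==_ : Entry → Entry → Bool
𝟎 == 𝟎 = true
𝟏 == 𝟏 = true
∗ == ∗ = true
_ == _ = false

agrees : Bool → Bool → Bool
agrees true  b = b
agrees false b = not b

symbolIs : Entry → Maybe Symbol → Bool
symbolIs e (just (entry e′)) = e == e′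
symbolIs e _                 = false

holds : Entry → Datum → Bool
holds e m = symbolIs e (sym? m)

record Sets (n : ℕ) : Set where
  constructor sets
  field
    D F G : Fin n → Bool
    Q     : Fin n → Fin n → Bool

open Sets public

module _ {n : ℕ} (M : Matrix n) where

  indexCell : Sets n → (Fin n → Bool) → Fin n → Datum
  indexCell A h j = datum nothing false (D A j) (F A j) (G A j) (h j) false false

  matrixCell : Sets n → Fin n → Fin n → Datum
  matrixCell A j i = datum (just (entry (M j i))) (Q A j i) false false false false false false

  holding : Sets n → (Fin n → Bool) → Bool → Bool → Zips₃ → List Bool → Store
  holding A h o x ts u = ready o x (matrixCells (matrixCell A)) (indexCell A h) (indexCell A h) ts u

  neighbours : Entry → (Fin n → Bool) → Fin n → Bool
  neighbours e S j = any₁ (λ i → S i ∧ (e == M j i)) false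

  met-with : Sets n → (Fin n → Bool) → Fin n → Bool
  met-with A S j = any₁ (λ i → S i ∧ Q A j i) false

  Situation : Set
  Situation = Sets n × List Bool

  -- Without `go` the current set is merely recorded once more. One straight-line program thus
  -- serves both cases.
  stepBy : Bool → (Fin n → Bool) → Sets n → Sets n
  stepBy go β A = sets D′ (F′ (F A)) (F′ (G A)) (λ j i → Q A j i ∨ (D′ j ∧ D′ i))
    where
    D′ : Fin n → Bool
    D′ j = if go then β j else D A j
    F′ : (Fin n → Bool) → Fin n → Bool
    F′ S j = if go then neighbours ∗ S j ∧ D′ j else S j

  step₁ : Situation → Situation
  step₁ (A , u) = stepBy (peek u) (bitAt (popIf true u)) A , dropBits n (popIf true u)

  startFrom : (Fin n → Bool) → (Fin n → Bool) → Sets n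
  startFrom β γ = sets D₁ (pickFirst false β) γ (λ j i → D₁ j ∧ D₁ i)
    where
    D₁ : Fin n → Bool
    D₁ j = pickFirst false β j ∨ γ j

  start₁ : List Bool → Situation
  start₁ u = startFrom (bitAt u) (bitAt (dropBits n u)) , dropBits n (dropBits n u)

  -- A pass sees one matrix cell at a time, hence never `M j i` together with `M i j`. With h = {j}
  -- the neighbours hold column j in the form of a set, to which row j can be compared.
  symmetricAt : Entry → (Fin n → Bool) → Bool → Bool
  symmetricAt e h = all₂ (λ j i → not (h j) ∨ agrees (neighbours e h i) (e == M j i))

  -- Impurity as a closed path a, b, b′, a′, a: an entry `𝟎`, a common set, an entry `𝟏`, a common
  -- set. Starting from {a}, four images decide whether the path closes.
  clash : Sets n → (Fin n → Bool) → Fin n → Bool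
  clash A h = met-with A (neighbours 𝟏 (met-with A (neighbours 𝟎 h)))

  pureAt : Sets n → (Fin n → Bool) → Bool → Bool
  pureAt A h = all₁ (λ j → not (clash A h j ∧ h j))

  indexChecks : Sets n → (Fin n → Bool) → Bool → Bool
  indexChecks A h = pureAt A h ∘ symmetricAt ∗ h ∘ symmetricAt 𝟏 h ∘ symmetricAt 𝟎 h

  unit : ℕ → Fin n → Bool
  unit k j = toℕ j ≡ᵇ k

  allChecks : Sets n → Bool
  allChecks A = proj₁ (iter n (λ (o , k) → indexChecks A (unit k) o , suc k) (true , 0))

  accepts : List Bool → Bool
  -- The number of steps is the number of labelled triples, see `node↔`.
  accepts u = let A = proj₁ (iter (n * (n * (n * 8))) step₁ (start₁ u)) in
    any₁ (λ j → F A j ∧ not (G A j)) false ∧ (any₁ (λ j → F A j ∧ G A j) false ∧ allChecks A)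

begin : Prog
begin = pickSweep ⨾ readSweep (λ _ b r → record r { inG = b ; inD = inF r ∨ b }) ⨾ remember ⨾ setFlag false

advanceWalk : Prog
advanceWalk =
  readFlag ⨾
  readSweep (λ x b r → record r { inD = if x then b else inD r ; cur = inF r }) ⨾
  remember ⨾
  imageOf (holds ∗) ⨾
  mapSweep (λ x r → record r { inF = if x then cur r ∧ inD r else inF r ; cur = inG r }) ⨾
  imageOf (holds ∗) ⨾
  mapSweep (λ x r → record r { inG = if x then cur r ∧ inD r else inG r ; cur = false }) ⨾
  setFlag false

repeat : ℕ → Prog → Prog
-- `Prog` has no empty program, and `advanceWalk` leaves the flag `false` anyway.
repeat zero    p = setFlag false
repeat (suc k) p = p ⨾ repeat k p

forEach : Fin 6 → Prog → Prog
forEach k p = loop k p ⨾ rewind k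

pattern ruler₁ = suc (suc (suc zero))
pattern ruler₂ = suc (suc (suc (suc zero)))
pattern ruler₃ = suc (suc (suc (suc (suc zero))))

-- A loop body may not move its driving zip, so each level of nesting has a ruler of its own. Three
-- rulers of n cells give n³, and the repetition contributes the factor 8.
walk₁ walk₂ walk : Prog
walk₁ = forEach ruler₃ (repeat 8 advanceWalk)
walk₂ = forEach ruler₂ walk₁
walk  = forEach ruler₁ walk₂

checkSymmetric : Entry → Prog
checkSymmetric e =
  mapSweep (λ _ r → record r { cur = hot r }) ⨾
  imageOf (holds e) ⨾
  checkGrid (λ m r c → not (hot r) ∨ agrees (cur c) (holds e m))

-- One lap treats one index, the one marked `hot`. The mark enters from the flag on the first lap
-- and is shifted by one place on each later lap.
checkIndex : Prog
checkIndex =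
  shiftSweep ⨾
  checkSymmetric 𝟎 ⨾ checkSymmetric 𝟏 ⨾ checkSymmetric ∗ ⨾
  mapSweep (λ _ r → record r { cur = hot r }) ⨾
  imageOf (holds 𝟎) ⨾ imageOf met ⨾ imageOf (holds 𝟏) ⨾ imageOf met ⨾
  checkSweep (λ r → not (cur r ∧ hot r)) (λ r → record r { cur = false }) ⨾
  setFlag false

finish : Prog
finish =
  mapSweep (λ _ r → record r { hot = false }) ⨾ setFlag false ⨾
  existsSweep (λ r → inF r ∧ inG r) ⨾ requireFlag ⨾
  existsSweep (λ r → inF r ∧ not (inG r)) ⨾ requireFlag

-- The programs compute the functions described above

forEach-spec : ∀ {S : Set} (g : S → S) (k : Fin 6) (here-with : S → Zip → Store) p →
  (∀ s f z → onZip k f (here-with s z) ≡ here-with s (f z)) →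
  (∀ s z → runway k (here-with s z) ≡ length (ahead z)) →
  (∀ s z → p ∶ here-with s z ⟿ here-with (g s) z) →
  ∀ s xs → forEach k p ∶ here-with s ([] ▸ xs) ⟿ here-with (iter (length xs) g s) ([] ▸ xs)
forEach-spec {S} g k here-with p on run body s xs = runs (begin-≡
  ⟦ rewind k ⟧ (iter (runway k (here-with s ([] ▸ xs))) (onZip k advance ∘ ⟦ p ⟧) (here-with s ([] ▸ xs)))
    ≡⟨ cong (λ r → ⟦ rewind k ⟧ (iter r (onZip k advance ∘ ⟦ p ⟧) (here-with s ([] ▸ xs)))) (run s ([] ▸ xs)) ⟩
  ⟦ rewind k ⟧ (iter (length xs) (onZip k advance ∘ ⟦ p ⟧) (here-with s ([] ▸ xs)))
    ≡⟨ cong ⟦ rewind k ⟧ (laps [] xs s) ⟩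
  ⟦ rewind k ⟧ (here-with s′ ((xs ʳ++ []) ▸ []))
    ≡⟨ on s′ toStart ((xs ʳ++ []) ▸ []) ⟩
  here-with s′ ([] ▸ ((xs ʳ++ []) ʳ++ []))
    ≡⟨ cong (λ ys → here-with s′ ([] ▸ ys)) (ʳ++-involutive xs) ⟩
  here-with s′ ([] ▸ xs) ∎)
  where
  open ≡-Reasoning renaming (begin_ to begin-≡_)
  s′ = iter (length xs) g s
  laps : ∀ ls rs s → iter (length rs) (onZip k advance ∘ ⟦ p ⟧) (here-with s (ls ▸ rs))
                      ≡ here-with (iter (length rs) g s) ((rs ʳ++ ls) ▸ [])
  laps ls []       s = refl
  laps ls (r ∷ rs) s = trans
    (cong (iter (length rs) (onZip k advance ∘ ⟦ p ⟧))
      (trans (cong (onZip k advance) (result (body s (ls ▸ (r ∷ rs))))) (on (g s) advance (ls ▸ (r ∷ rs)))))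
    (laps (r ∷ ls) rs (g s))

module _ {n : ℕ} (M : Matrix n) where

  private
    none : Fin n → Bool
    none _ = false

  begin-spec : ∀ o ts u → let (A , v) = start₁ M u in
    begin ∶ holding M (sets none none none (λ _ _ → false)) none o false ts u ⟿ holding M A none o false ts v
  begin-spec o ts u =
    pickSweep-spec V₀ V₀ ms ts o false u ⊚
    readSweep-spec (λ _ b r → record r { inG = b ; inD = inF r ∨ b }) V₁ V₁ ms ts o _ (dropBits n u) ⊚
    remember-spec (matrixCell M A₀) V₂ ts o _ v ⊚
    setFlag-spec false o _ (matrixCells (matrixCell M A)) V₂ V₂ ts v
    where
    A₀ = sets none none none (λ _ _ → false)
    A  = proj₁ (start₁ M u)
    v  = proj₂ (start₁ M u)
    V₀ = indexCell M A₀ none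
    V₁ = λ j → record (V₀ j) { inF = pickFirst false (bitAt u) j }
    V₂ = indexCell M A none
    ms = matrixCells (matrixCell M A₀)

  advanceWalk-spec : ∀ A o ts u → let (A′ , v) = step₁ M (A , u) in
    advanceWalk ∶ holding M A none o false ts u ⟿ holding M A′ none o false ts v
  advanceWalk-spec A o ts u =
    readFlag-spec o false (matrixCells (matrixCell M A)) V₀ V₀ ts u ⊚
    readSweep-spec _ V₀ V₀ (matrixCells (matrixCell M A)) ts o x u₁ ⊚
    remember-spec (matrixCell M A) V₁ ts o x v ⊚
    imageOf-spec (holds ∗) N V₁ ts o x v ⊚
    mapSweep-spec _ V₂ V₂ (matrixCells N) ts o x v ⊚
    imageOf-spec (holds ∗) N V₃ ts o x v ⊚
    mapSweep-spec _ V₄ V₄ (matrixCells N) ts o x v ⊚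
    setFlag-spec false o x (matrixCells N) V₅ V₅ ts v
    where
    x  = peek u
    u₁ = popIf true u
    A′ = proj₁ (step₁ M (A , u))
    v  = proj₂ (step₁ M (A , u))
    N  = matrixCell M A′
    V₀ V₁ V₂ V₃ V₄ V₅ : Fin n → Datum
    V₀ = indexCell M A none
    V₁ j = record (V₀ j) { inD = D A′ j ; cur = F A j }
    V₂ = imageRow (holds ∗) N V₁
    V₃ j = record (V₁ j) { inF = F A′ j ; cur = G A j }
    V₄ = imageRow (holds ∗) N V₃
    V₅ = indexCell M A′ none

  private
    walking : Bool → Zips₃ → Situation M → Store
    walking o ts (A , u) = holding M A none o false ts u

  repeat-spec : ∀ k o ts s → (repeat k advanceWalk) ∶ walking o ts s ⟿ walking o ts (iter k (step₁ M) s)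
  repeat-spec zero    o ts (A , u) =
    setFlag-spec false o false (matrixCells (matrixCell M A)) (indexCell M A none) (indexCell M A none) ts u
  repeat-spec (suc k) o ts (A , u) = advanceWalk-spec A o ts u ⊚ repeat-spec k o ts (step₁ M (A , u))

  private
    on-ruler₁ : ∀ t₂ t₃ o (s : Situation M) f z →
      onZip ruler₁ f (walking o (z ∷ t₂ ∷ t₃ ∷ []) s) ≡ walking o (f z ∷ t₂ ∷ t₃ ∷ []) s
    on-ruler₁ t₂ t₃ o s f z = refl

    on-ruler₂ : ∀ t₁ t₃ o (s : Situation M) f z →
      onZip ruler₂ f (walking o (t₁ ∷ z ∷ t₃ ∷ []) s) ≡ walking o (t₁ ∷ f z ∷ t₃ ∷ []) s
    on-ruler₂ t₁ t₃ o s f z = refl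

    on-ruler₃ : ∀ t₁ t₂ o (s : Situation M) f z →
      onZip ruler₃ f (walking o (t₁ ∷ t₂ ∷ z ∷ []) s) ≡ walking o (t₁ ∷ t₂ ∷ f z ∷ []) s
    on-ruler₃ t₁ t₂ o s f z = refl

    laps₁ laps₂ laps₃ : List Datum → Situation M → Situation M
    laps₁ xs = iter (length xs) (iter 8 (step₁ M))
    laps₂ xs = iter (length xs) (laps₁ xs)
    laps₃ xs = iter (length xs) (laps₂ xs)

  walk₁-spec : ∀ o t₁ t₂ xs s →
    walk₁ ∶ walking o (t₁ ∷ t₂ ∷ ([] ▸ xs) ∷ []) s ⟿ walking o (t₁ ∷ t₂ ∷ ([] ▸ xs) ∷ []) (laps₁ xs s)
  walk₁-spec o t₁ t₂ xs s = forEach-spec (iter 8 (step₁ M)) ruler₃ (λ s z → walking o (t₁ ∷ t₂ ∷ z ∷ []) s)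
    (repeat 8 advanceWalk) (on-ruler₃ t₁ t₂ o) (λ _ _ → refl) (λ s z → repeat-spec 8 o (t₁ ∷ t₂ ∷ z ∷ []) s) s xs

  walk₂-spec : ∀ o t₁ xs s →
    walk₂ ∶ walking o (t₁ ∷ ([] ▸ xs) ∷ ([] ▸ xs) ∷ []) s ⟿ walking o (t₁ ∷ ([] ▸ xs) ∷ ([] ▸ xs) ∷ []) (laps₂ xs s)
  walk₂-spec o t₁ xs s = forEach-spec (laps₁ xs) ruler₂ (λ s z → walking o (t₁ ∷ z ∷ ([] ▸ xs) ∷ []) s)
    walk₁ (on-ruler₂ t₁ ([] ▸ xs) o) (λ _ _ → refl) (λ s z → walk₁-spec o t₁ z xs s) s xs

  laps₃-count : ∀ xs s → length xs ≡ n → laps₃ xs s ≡ iter (n * (n * (n * 8))) (step₁ M) s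
  laps₃-count xs s refl = trans (iter-cong n (λ s → trans (iter-cong n (λ s → iter-* n 8 f s) s) (iter-* n (n * 8) f s)) s)
                                (iter-* n (n * (n * 8)) f s)
    where
    f = step₁ M

  walk-spec : ∀ o xs s → length xs ≡ n →
    let ts = ([] ▸ xs) ∷ ([] ▸ xs) ∷ ([] ▸ xs) ∷ [] in
    walk ∶ walking o ts s ⟿ walking o ts (iter (n * (n * (n * 8))) (step₁ M) s)
  walk-spec o xs s l = subst
    (λ s′ → walk ∶ walking o ts s ⟿ walking o ts s′) (laps₃-count xs s l)
    (forEach-spec (laps₂ xs) ruler₁ (λ s z → walking o (z ∷ ([] ▸ xs) ∷ ([] ▸ xs) ∷ []) s)
      walk₂ (on-ruler₁ ([] ▸ xs) ([] ▸ xs) o) (λ _ _ → refl) (λ s z → walk₂-spec o z xs s) s xs)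
    where ts = ([] ▸ xs) ∷ ([] ▸ xs) ∷ ([] ▸ xs) ∷ []

  checkSymmetric-spec : ∀ e A h (c : Fin n → Bool) o x ts u →
    let V = λ j → record (indexCell M A h j) { cur = c j }
        V′ = λ j → record (indexCell M A h j) { cur = neighbours M e h j } in
    (checkSymmetric e) ∶ ready o x (matrixCells (matrixCell M A)) V V ts u ⟿ ready (symmetricAt M e h o) x (matrixCells (matrixCell M A)) V′ V′ ts u
  checkSymmetric-spec e A h c o x ts u =
    mapSweep-spec _ V V ms ts o x u ⊚
    imageOf-spec (holds e) N V₁ ts o x u ⊚
    checkGrid-spec _ N V₂ ts o x u
    where
    N  = matrixCell M A
    ms = matrixCells N
    V V₁ V₂ : Fin n → Datum
    V j  = record (indexCell M A h j) { cur = c j }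
    V₁ j = record (indexCell M A h j) { cur = h j }
    V₂ = imageRow (holds e) N V₁

  checkIndex-spec : ∀ A k o ts u →
    checkIndex ∶ holding M A (λ j → suc (toℕ j) ≡ᵇ k) o (0 ≡ᵇ k) ts u ⟿ holding M A (unit M k) (indexChecks M A (unit M k) o) false ts u
  checkIndex-spec A k o ts u =
    shiftSweep-spec (indexCell M A _) (indexCell M A _) ms ts o (0 ≡ᵇ k) u (_≡ᵇ k) refl (λ _ → refl) ⊚
    checkSymmetric-spec 𝟎 A h none o (n ≡ᵇ k) ts u ⊚
    checkSymmetric-spec 𝟏 A h (neighbours M 𝟎 h) _ (n ≡ᵇ k) ts u ⊚
    checkSymmetric-spec ∗ A h (neighbours M 𝟏 h) _ (n ≡ᵇ k) ts u ⊚
    mapSweep-spec _ _ _ ms ts _ (n ≡ᵇ k) u ⊚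
    imageOf-spec (holds 𝟎) N V₁ ts _ (n ≡ᵇ k) u ⊚
    imageOf-spec met N V₂ ts _ (n ≡ᵇ k) u ⊚
    imageOf-spec (holds 𝟏) N V₃ ts _ (n ≡ᵇ k) u ⊚
    imageOf-spec met N V₄ ts _ (n ≡ᵇ k) u ⊚
    checkSweep-spec _ _ V₅ V₅ ms ts _ (n ≡ᵇ k) u ⊚
    setFlag-spec false _ (n ≡ᵇ k) ms (indexCell M A h) (indexCell M A h) ts u
    where
    h  = unit M k
    N  = matrixCell M A
    ms = matrixCells N
    V₁ V₂ V₃ V₄ V₅ : Fin n → Datum
    V₁ j = record (indexCell M A h j) { cur = h j }
    V₂ = imageRow (holds 𝟎) N V₁
    V₃ = imageRow met N V₂
    V₄ = imageRow (holds 𝟏) N V₃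
    V₅ = imageRow met N V₄

  private
    marking : Sets n → Zip → Zip → List Bool → Bool × ℕ → Zip → Store
    -- Before lap k the mark sits at index k - 1, or still in the flag if k = 0.
    marking A t₂ t₃ u (o , k) t₁ = holding M A (λ j → suc (toℕ j) ≡ᵇ k) o (0 ≡ᵇ k) (t₁ ∷ t₂ ∷ t₃ ∷ []) u

  checks-spec : ∀ A x₁ t₂ t₃ u → length x₁ ≡ n →
    ∃[ h ] ∃[ x ] (setFlag true ⨾ forEach ruler₁ checkIndex) ∶ holding M A none true false (([] ▸ x₁) ∷ t₂ ∷ t₃ ∷ []) u ⟿ holding M A h (allChecks M A) x (([] ▸ x₁) ∷ t₂ ∷ t₃ ∷ []) u
  checks-spec A x₁ t₂ t₃ u refl = _ , _ ,
    (setFlag-spec true true false (matrixCells (matrixCell M A)) (indexCell M A none) (indexCell M A none) (([] ▸ x₁) ∷ t₂ ∷ t₃ ∷ []) u ⊚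
     forEach-spec (λ (o , k) → indexChecks M A (unit M k) o , suc k) ruler₁ (marking A t₂ t₃ u) checkIndex
       (λ _ _ _ → refl) (λ _ _ → refl) (λ (o , k) z → checkIndex-spec A k o (z ∷ t₂ ∷ t₃ ∷ []) u) (true , 0) x₁)

  finish-spec : ∀ A h o x ts u →
    finish ∶ holding M A h o x ts u ⟿
      holding M A none (any₁ (λ j → F A j ∧ not (G A j)) false ∧ (any₁ (λ j → F A j ∧ G A j) false ∧ o)) false ts u
  finish-spec A h o x ts u =
    mapSweep-spec _ _ _ ms ts o x u ⊚
    setFlag-spec false o x ms V V ts u ⊚
    existsSweep-spec (λ r → inF r ∧ inG r) V ms ts o false u ⊚
    requireFlag-spec o _ ms V V ts u ⊚
    existsSweep-spec (λ r → inF r ∧ not (inG r)) V ms ts _ false u ⊚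
    requireFlag-spec _ _ ms V V ts u
    where
    ms = matrixCells (matrixCell M A)
    V = indexCell M A none

-- The input format

isEntry isEndRow : Datum → Bool
isEntry (datum (just (entry _)) _ _ _ _ _ _ _) = true
isEntry _                                      = false
isEndRow (datum (just endRow) _ _ _ _ _ _ _) = true
isEndRow _                                   = false

entryCell : Update₂
entryCell m r c = isEntry m , m , r

prepare format verifier : Prog
prepare  = rewind matrix ⨾ rewind rows ⨾ rewind columns ⨾ rewind ruler₁ ⨾ rewind ruler₂ ⨾ rewind ruler₃
format   = grid entryCell isEndRow ⨾ rewind rows ⨾ requireEnd ⨾ rewind matrix
verifier = prepare ⨾ format ⨾ begin ⨾ walk ⨾ (setFlag true ⨾ forEach ruler₁ checkIndex) ⨾ finish

wellFormed : WellFormed verifier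
-- For this concrete program the condition computes to a product of unit types.
wellFormed = _

blanks : ℕ → List Datum
blanks n = tabulate {n = n} (λ _ → vacant)

blanks-ʳ++ : ∀ k l → blanks k ʳ++ blanks l ≡ blanks (k + l)
blanks-ʳ++ zero    l = refl
blanks-ʳ++ (suc k) l = trans (blanks-ʳ++ k (suc l)) (cong blanks (+-suc k l))

blanks-toStart : ∀ n → toStart (blanks n ▸ []) ≡ ([] ▸ blanks n)
blanks-toStart n = cong ([] ▸_) (trans (blanks-ʳ++ n 0) (cong blanks (+-identityʳ n)))

widen-blanks : ∀ b w k → ∃[ n ] widen b w (blanks k) ≡ blanks n
widen-blanks b []      k = k , refl
widen-blanks b (s ∷ w) k with inFirstRow b s
... | true  = widen-blanks true w (suc k)
... | false = widen-blanks false w k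

rulers : ℕ → Zips₃
rulers n = ([] ▸ blanks n) ∷ ([] ▸ blanks n) ∷ ([] ▸ blanks n) ∷ []

prepare-spec : ∀ w u n → widen true w [] ≡ blanks n →
  prepare ∶ copied w u
    ⟿ ready {n} true false (List.map symbolDatum w) (λ _ → vacant) (λ _ → vacant) (rulers n) u
prepare-spec w u n eq rewrite eq = runs (cong₂
  (λ ms z → store true false (([] ▸ ms) ∷ z ∷ z ∷ z ∷ z ∷ z ∷ []) u)
  (ʳ++-involutive (List.map symbolDatum w)) (blanks-toStart n))

encodeRows : ∀ {k n} → (Fin k → Fin n → Entry) → List Symbol
encodeRows N = concat (tabulate λ i → tabulate (entry ∘ N i) ++ [ endRow ])

entryDatum : Entry → Datum
entryDatum e = symbolDatum (entry e)

encode-cells : ∀ {k n} (N : Fin k → Fin n → Entry) →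
  List.map symbolDatum (encodeRows N) ≡ matrixCells (λ j i → entryDatum (N j i))
encode-cells {zero}  N = refl
encode-cells {suc k} N = begin-≡
  List.map symbolDatum ((tabulate (entry ∘ N zero) ++ [ endRow ]) ++ encodeRows (N ∘ suc))
    ≡⟨ cong (List.map symbolDatum) (++-assoc (tabulate (entry ∘ N zero)) [ endRow ] _) ⟩
  List.map symbolDatum (tabulate (entry ∘ N zero) ++ endRow ∷ encodeRows (N ∘ suc))
    ≡⟨ map-++ symbolDatum (tabulate (entry ∘ N zero)) _ ⟩
  List.map symbolDatum (tabulate (entry ∘ N zero)) ++ separator ∷ List.map symbolDatum (encodeRows (N ∘ suc))
    ≡⟨ cong₂ (λ xs ys → xs ++ separator ∷ ys) (map-tabulate (entry ∘ N zero) symbolDatum) (encode-cells (N ∘ suc)) ⟩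
  matrixCells (λ j i → entryDatum (N j i)) ∎
  where open ≡-Reasoning renaming (begin_ to begin-≡_)

widen-false : ∀ w as → widen false w as ≡ as
widen-false []            as = refl
widen-false (entry _ ∷ w) as = widen-false w as
widen-false (endRow ∷ w)  as = widen-false w as

widen-row : ∀ {n} (r : Fin n → Entry) w k → widen true (tabulate (entry ∘ r) ++ endRow ∷ w) (blanks k) ≡ blanks (n + k)
widen-row {zero}  r w k = widen-false w (blanks k)
widen-row {suc n} r w k = trans (widen-row (r ∘ suc) w (suc k)) (cong blanks (+-suc n k))

widen-encode : ∀ {n} (M : Matrix n) → widen true (encode M) [] ≡ blanks n
widen-encode {zero}  M = refl
widen-encode {suc n} M = trans
  (cong (λ w → widen true w []) (++-assoc (tabulate (entry ∘ M zero)) [ endRow ] _))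
  (trans (widen-row (M zero) _ 0) (cong blanks (+-identityʳ (suc n))))

scanRow-entry : ∀ {n} (es : Fin n → Entry) (cs : Fin n → Datum) o r →
  scanRow entryCell (entryDatum ∘ es) cs o r ≡ scanned o r (tabulate (entryDatum ∘ es))
scanRow-entry {zero}  es cs o r = refl
scanRow-entry {suc n} es cs o r rewrite scanRow-entry (es ∘ suc) (cs ∘ suc) o r = refl

requireEnd-spec : ∀ o x ls zs₁ zs₂ ts u →
  ⟦ requireEnd ⟧ (store o x ((ls ▸ []) ∷ zs₁ ∷ zs₂ ∷ ts) u) ≡ store o x ((ls ▸ []) ∷ zs₁ ∷ zs₂ ∷ ts) u
requireEnd-spec o x ls z₁ z₂ ts u =
  unmoved false (λ _ _ m → maybe (λ _ → false) true (sym? m)) (λ x _ → x) o x (ls ▸ []) z₁ z₂ ts u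

format-spec : ∀ {n} (M : Matrix n) (V : Fin n → Datum) o x ts u → let ms = matrixCells (λ j i → entryDatum (M j i)) in
  format ∶ ready o x ms V V ts u ⟿ ready o x ms V V ts u
format-spec {n} M V o x ts u =
  runs {p = grid entryCell isEndRow} read ⊚
  runs {p = rewind rows} (cong (λ vs → scannedStore (matrixCells N ʳ++ []) vs) (ʳ++-involutive (tabulate V))) ⊚
  runs {p = requireEnd} (requireEnd-spec o x (matrixCells N ʳ++ []) ([] ▸ tabulate V) ([] ▸ tabulate V) ts u) ⊚
  runs {p = rewind matrix} (cong (λ ms → store o x (([] ▸ ms) ∷ ([] ▸ tabulate V) ∷ ([] ▸ tabulate V) ∷ ts) u) (ʳ++-involutive (matrixCells N)))
  where
  N : Fin n → Fin n → Datum
  N j i = entryDatum (M j i)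
  scannedStore : List Datum → List Datum → Store
  scannedStore ms vs = store o x ((ms ▸ []) ∷ ([] ▸ vs) ∷ ([] ▸ tabulate V) ∷ ts) u
  read : ⟦ grid entryCell isEndRow ⟧ (ready o x (matrixCells N) V V ts u)
    ≡ store o x (((matrixCells N ʳ++ []) ▸ []) ∷ ((tabulate V ʳ++ []) ▸ []) ∷ ([] ▸ tabulate V) ∷ ts) u
  read = trans
    (grid-spec entryCell isEndRow refl V N N V V (λ _ → id) (λ j o → scanRow-entry (M j) V o (V j)) ts o x u)
    (cong (λ o → store o x (((matrixCells N ʳ++ []) ▸ []) ∷ ((tabulate V ʳ++ []) ▸ []) ∷ ([] ▸ tabulate V) ∷ ts) u) (thread-id {n} o))

verifier-run : ∀ {n} (M : Matrix n) u →
  let s = iter (n * (n * (n * 8))) (step₁ M) (start₁ M u) in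
  verifier ∶ copied (encode M) u ⟿ holding M (proj₁ s) (λ _ → false) (accepts M u) false (rulers n) (proj₂ s)
verifier-run {n} M u =
  prepared ⊚
  format-spec M (λ _ → vacant) true false (rulers n) u ⊚
  begin-spec M true (rulers n) u ⊚
  walk-spec M true (blanks n) (start₁ M u) (length-tabulate {n = n} (λ _ → vacant)) ⊚
  proj₂ (proj₂ checked) ⊚
  finish-spec M (proj₁ s) (proj₁ checked) (allChecks M (proj₁ s)) (proj₁ (proj₂ checked)) (rulers n) (proj₂ s)
  where
  s : Situation M
  s = iter (n * (n * (n * 8))) (step₁ M) (start₁ M u)
  checked = checks-spec M (proj₁ s) (blanks n) ([] ▸ blanks n) ([] ▸ blanks n) (proj₂ s) (length-tabulate {n = n} (λ _ → vacant))
  prepared : prepare ∶ copied (encode M) u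
    ⟿ ready {n} true false (matrixCells (λ j i → entryDatum (M j i))) (λ _ → vacant) (λ _ → vacant) (rulers n) u
  prepared = subst
    (λ ms → prepare ∶ copied (encode M) u ⟿ ready {n} true false ms (λ _ → vacant) (λ _ → vacant) (rulers n) u)
    (encode-cells M) (prepare-spec (encode M) u n (widen-encode M))

record Accepts (p : Prog) (w : List Symbol) (u : List Bool) : Set where
  constructor accepted
  field accepting : ok (⟦ p ⟧ (copied w u)) ≡ true

open Accepts public

run⇒accepts : ∀ {p w u τ} → p ∶ copied w u ⟿ τ → ok τ ≡ true → Accepts p w u
run⇒accepts (runs e) t = accepted (trans (cong ok e) t)

accepts⇒run : ∀ {p w u τ} → p ∶ copied w u ⟿ τ → Accepts p w u → ok τ ≡ true
accepts⇒run (runs e) (accepted t) = trans (sym (cong ok e)) t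

-- Acceptance forces the input to encode a matrix

∧-trueʳ : ∀ a {b} → a ∧ b ≡ true → b ≡ true
∧-trueʳ true e = e

sticky-iter : ∀ {f : Store → Store} → (∀ σ → ok (f σ) ≡ true → ok σ ≡ true) →
  ∀ n σ → ok (iter n f σ) ≡ true → ok σ ≡ true
sticky-iter s zero    σ e = e
sticky-iter s (suc n) σ e = s σ (sticky-iter s n _ e)

-- Acceptance at the end yields `ok` after every prefix of the program. So on a malformed word only
-- the format check has to be analysed, not what runs after it.
sticky : ∀ p σ → ok (⟦ p ⟧ σ) ≡ true → ok σ ≡ true
sticky (perform bs rd f) σ e = ∧-trueʳ (pass (effectAt f σ)) e
sticky (p ⨾ q)    σ e = sticky p σ (sticky q (⟦ p ⟧ σ) e)
sticky (rewind k) σ e = e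
sticky (loop k p) σ e = sticky-iter (sticky p) (runway k σ) σ e

-- Nothing is assumed about `w`. On the first of the n cells without an entry, or past the end of
-- the word, `ok` is cleared for good.
row-sound : ∀ {n} (cs : Fin n → Datum) w ml rl r rs cl ts o x u →
  ok (iter n (onZip columns advance ∘ ⟦ gridCell entryCell ⟧)
       (store o x ((ml ▸ List.map symbolDatum w) ∷ (rl ▸ (r ∷ rs)) ∷ (cl ▸ tabulate cs) ∷ ts) u)) ≡ true →
  Σ[ es ∈ (Fin n → Entry) ] ∃[ w′ ] w ≡ tabulate (entry ∘ es) ++ w′
row-sound {zero}  cs w ml rl r rs cl ts o x u e = (λ ()) , w , refl
row-sound {suc n} cs [] ml rl r rs cl ts o x u e =
  contradiction (sticky-iter (sticky (gridCell entryCell)) n _ e) λ ()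
row-sound {suc n} cs (endRow ∷ w) ml rl r rs cl ts o x u e =
  contradiction (sticky-iter (sticky (gridCell entryCell)) n _ e) λ ()
row-sound {suc n} cs (entry a ∷ w) ml rl r rs cl ts o x u e
  with row-sound (cs ∘ suc) w _ rl _ rs _ _ _ x u e
... | es , w′ , refl = (λ { zero → a ; (suc i) → es i }) , w′ , refl

RowsRead : ∀ {n} → ℕ → List Symbol → Store → Set
RowsRead {n} k w σ = Σ[ N ∈ (Fin k → Fin n → Entry) ] ∃[ w′ ] w ≡ encodeRows N ++ w′ ×
  ∃[ o ] ∃[ x ] ∃[ ml ] ∃[ z₁ ] ∃[ z₂ ] ∃[ ts ] ∃[ u ]
    σ ≡ store o x ((ml ▸ List.map symbolDatum w′) ∷ z₁ ∷ z₂ ∷ ts) u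

map-row : ∀ {n} (es : Fin n → Entry) w →
  List.map symbolDatum (tabulate (entry ∘ es) ++ w) ≡ tabulate (entryDatum ∘ es) ++ List.map symbolDatum w
map-row es w = trans (map-++ symbolDatum (tabulate (entry ∘ es)) w)
  (cong (_++ List.map symbolDatum w) (map-tabulate (entry ∘ es) symbolDatum))

module _ {n} (cs : Fin n → Datum) where

  private
    rowStore : List Symbol → List Datum → List Datum → Datum → List Datum → Zips₃ → Bool → Bool → List Bool → Store
    rowStore w ml rl r rs ts o x u =
      store o x ((ml ▸ List.map symbolDatum w) ∷ (rl ▸ (r ∷ rs)) ∷ ([] ▸ tabulate cs) ∷ ts) u

    line : Prog
    line = gridRow entryCell isEndRow

    lines : ℕ → Store → Store
    lines k = iter k (onZip rows advance ∘ ⟦ line ⟧)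

  gridRow-sound : ∀ w ml rl r rs ts o x u → ok (⟦ line ⟧ (rowStore w ml rl r rs ts o x u)) ≡ true →
    Σ[ es ∈ (Fin n → Entry) ] ∃[ w′ ] w ≡ tabulate (entry ∘ es) ++ endRow ∷ w′ ×
      ∃[ ml′ ] ∃[ o′ ] ⟦ line ⟧ (rowStore w ml rl r rs ts o x u)
        ≡ store o′ x ((ml′ ▸ List.map symbolDatum w′) ∷ (rl ▸ (r ∷ rs)) ∷ ([] ▸ tabulate cs) ∷ ts) u
  gridRow-sound w ml rl r rs ts o x u e
    with row-sound cs w ml rl r rs [] ts o x u entries
    where
    entries : ok (iter n (onZip columns advance ∘ ⟦ gridCell entryCell ⟧) (rowStore w ml rl r rs ts o x u)) ≡ true
    entries = subst (λ k → ok (iter k (onZip columns advance ∘ ⟦ gridCell entryCell ⟧) (rowStore w ml rl r rs ts o x u)) ≡ true)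
      (length-tabulate cs)
      (sticky (rewind columns ⨾ gridRowEnd isEndRow) (⟦ loop columns (gridCell entryCell) ⟧ (rowStore w ml rl r rs ts o x u)) e)
  ... | es , endRow ∷ w′ , refl = es , w′ , refl , _ , _ , ran
    where
    a = scanRow entryCell (entryDatum ∘ es) cs o r
    ran : ⟦ line ⟧ (rowStore w ml rl r rs ts o x u)
      ≡ store o x (((separator ∷ (tabulate (entryDatum ∘ es) ʳ++ ml)) ▸ List.map symbolDatum w′)
                    ∷ (rl ▸ (r ∷ rs)) ∷ ([] ▸ tabulate cs) ∷ ts) u
    ran rewrite map-row es (endRow ∷ w′) = trans
      (row-spec entryCell isEndRow (entryDatum ∘ es) cs ml (List.map symbolDatum w′) rl r rs ts o x u refl)
      (cong (λ a → store (Scanned.okₛ a) x (((separator ∷ (Scanned.cellsₛ a ʳ++ ml)) ▸ List.map symbolDatum w′)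
                    ∷ (rl ▸ (Scanned.rowₛ a ∷ rs)) ∷ ([] ▸ tabulate cs) ∷ ts) u)
        (scanRow-entry es cs o r))
  ... | es , [] , refl = contradiction (trans (sym e) stopped) λ ()
    where
    stopped : ok (⟦ line ⟧ (rowStore w ml rl r rs ts o x u)) ≡ false
    stopped rewrite map-row es [] | length-tabulate cs =
      cong (ok ∘ ⟦ rewind columns ⨾ gridRowEnd isEndRow ⟧)
        (row-loop entryCell (entryDatum ∘ es) cs ml [] rl r rs [] ts o x u)
  ... | es , entry a ∷ w′ , refl = contradiction (trans (sym e) stopped) λ ()
    where
    stopped : ok (⟦ line ⟧ (rowStore w ml rl r rs ts o x u)) ≡ false
    stopped rewrite map-row es (entry a ∷ w′) | length-tabulate cs =
      cong (ok ∘ ⟦ rewind columns ⨾ gridRowEnd isEndRow ⟧)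
        (row-loop entryCell (entryDatum ∘ es) cs ml (List.map symbolDatum (entry a ∷ w′)) rl r rs [] ts o x u)

  grid-sound : ∀ {k} (V : Fin k → Datum) w ml rl ts o x u →
    let σ = lines k (store o x ((ml ▸ List.map symbolDatum w) ∷ (rl ▸ tabulate V) ∷ ([] ▸ tabulate cs) ∷ ts) u) in
    ok σ ≡ true → RowsRead {n} k w σ
  grid-sound {zero}  V w ml rl ts o x u e = (λ ()) , w , refl , _ , _ , _ , _ , _ , _ , _ , refl
  grid-sound {suc k} V w ml rl ts o x u e
    with gridRow-sound w ml rl (V zero) (tabulate (V ∘ suc)) ts o x u (sticky-iter (sticky line) k _ e)
  ... | es , w′ , refl , ml′ , o′ , ran
    with grid-sound (V ∘ suc) w′ ml′ (V zero ∷ rl) ts o′ x u (trans (cong (ok ∘ lines k ∘ onZip rows advance) (sym ran)) e)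
  ...   | N , w″ , refl , o″ , x″ , ml″ , z₁ , z₂ , ts″ , u″ , final =
    (λ { zero → es ; (suc j) → N j }) , w″ ,
    trans (sym (++-assoc (tabulate (entry ∘ es)) [ endRow ] (encodeRows N ++ w″)))
          (sym (++-assoc (tabulate (entry ∘ es) ++ [ endRow ]) (encodeRows N) w″)) ,
    o″ , x″ , ml″ , z₁ , z₂ , ts″ , u″ , trans (cong (lines k ∘ onZip rows advance) ran) final

format-sound : ∀ {n} (V : Fin n → Datum) w o x ts u →
  ok (⟦ format ⟧ (ready o x (List.map symbolDatum w) V V ts u)) ≡ true → Σ[ M ∈ Matrix n ] w ≡ encode M
format-sound {n} V w o x ts u e with grid-sound V V w [] [] ts o x u entries
  where
  σ = ready o x (List.map symbolDatum w) V V ts u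
  entries : ok (iter n (onZip rows advance ∘ ⟦ gridRow entryCell isEndRow ⟧) σ) ≡ true
  entries = subst (λ k → ok (iter k (onZip rows advance ∘ ⟦ gridRow entryCell isEndRow ⟧) σ) ≡ true) (length-tabulate V)
    (sticky (rewind rows ⨾ requireEnd ⨾ rewind matrix) (⟦ grid entryCell isEndRow ⟧ σ) e)
... | N , []     , refl , _ = N , ++-identityʳ (encodeRows N)
-- All n rows have been read but a symbol is left over, on which `requireEnd` fails.
... | N , s ∷ w′ , refl , o′ , x′ , ml , z₁ , z₂ , ts′ , u′ , final =
  contradiction (trans (sym e) stopped) λ ()
  where
  σ = ready o x (List.map symbolDatum w) V V ts u
  stopped : ok (⟦ format ⟧ σ) ≡ false
  stopped = cong (ok ∘ ⟦ rewind rows ⨾ requireEnd ⨾ rewind matrix ⟧)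
    (subst (λ k → iter k (onZip rows advance ∘ ⟦ gridRow entryCell isEndRow ⟧) σ
             ≡ store o′ x′ ((ml ▸ List.map symbolDatum (s ∷ w′)) ∷ z₁ ∷ z₂ ∷ ts′) u′)
      (sym (length-tabulate V)) final)

sticky-second : ∀ {v} p q r {w u τ} → v ≡ p ⨾ q ⨾ r → p ∶ copied w u ⟿ τ → Accepts v w u → ok (⟦ q ⟧ τ) ≡ true
sticky-second p q r {w} {u} refl (runs refl) (accepted e) = sticky r (⟦ q ⟧ (⟦ p ⟧ (copied w u))) e

-- For an arbitrary word, n is whatever length the copying phase gave to the work tapes; the format
-- check turns it into the size of the matrix.
accepts⇒encode : ∀ w u → Accepts verifier w u → ∃[ n ] Σ[ M ∈ Matrix n ] w ≡ encode M
accepts⇒encode w u a = n , format-sound {n} (λ _ → vacant) w true false (rulers n) u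
  (sticky-second {verifier} prepare format (begin ⨾ walk ⨾ (setFlag true ⨾ forEach ruler₁ checkIndex) ⨾ finish)
    refl (prepare-spec w u n (proj₂ (widen-blanks true w 0))) a)
  where
  n : ℕ
  n = proj₁ (widen-blanks true w 0)

-- Soundness

∧-true : ∀ {a b} → a ∧ b ≡ true → a ≡ true × b ≡ true
∧-true {true} e = refl , e

∧-intro : ∀ {a b} → a ≡ true → b ≡ true → a ∧ b ≡ true
∧-intro refl e = e

∨-true : ∀ {a b} → a ∨ b ≡ true → a ≡ true ⊎ b ≡ true
∨-true {true}  e = inj₁ refl
∨-true {false} e = inj₂ e

∨-introˡ : ∀ {a b} → a ≡ true → a ∨ b ≡ true
∨-introˡ refl = refl

∨-introʳ : ∀ a {b} → b ≡ true → a ∨ b ≡ true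
∨-introʳ true  e = refl
∨-introʳ false e = e

not-true : ∀ {a} → not a ≡ true → a ≢ true
not-true {true} ()
not-true {false} _ ()

not-intro : ∀ {a} → a ≢ true → not a ≡ true
not-intro {true}  ¬e = contradiction refl ¬e
not-intro {false} ¬e = refl

any-true : ∀ {n} (φ : Fin n → Bool) {b} → any₁ φ b ≡ true → b ≡ true ⊎ ∃[ i ] φ i ≡ true
any-true {zero}  φ e = inj₁ e
any-true {suc n} φ {b} e with any-true (φ ∘ suc) e
... | inj₂ (i , e′) = inj₂ (suc i , e′)
... | inj₁ e′ with ∨-true {b} e′
...   | inj₁ e″ = inj₁ e″
...   | inj₂ e″ = inj₂ (zero , e″)

any-witness : ∀ {n} (φ : Fin n → Bool) → any₁ φ false ≡ true → ∃[ i ] φ i ≡ true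
any-witness φ e with any-true φ e
... | inj₂ w = w

any-base : ∀ {n} (φ : Fin n → Bool) {b} → b ≡ true → any₁ φ b ≡ true
any-base {zero}  φ e = e
any-base {suc n} φ refl = any-base (φ ∘ suc) refl

any-intro : ∀ {n} (φ : Fin n → Bool) {b} i → φ i ≡ true → any₁ φ b ≡ true
any-intro φ {b} zero    e = any-base (φ ∘ suc) (∨-introʳ b e)
any-intro φ     (suc i) e = any-intro (φ ∘ suc) i e

all-true : ∀ {n} (φ : Fin n → Bool) {b} → all₁ φ b ≡ true → b ≡ true × (∀ i → φ i ≡ true)
all-true {zero}  φ e = e , λ ()
all-true {suc n} φ {b} e with all-true (φ ∘ suc) e
... | e′ , es with ∧-true {φ zero} e′
...   | e₀ , eb = eb , λ { zero → e₀ ; (suc i) → es i }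

all-intro : ∀ {n} (φ : Fin n → Bool) {b} → b ≡ true → (∀ i → φ i ≡ true) → all₁ φ b ≡ true
all-intro {zero}  φ e es = e
all-intro {suc n} φ e es = all-intro (φ ∘ suc) (∧-intro (es zero) e) (es ∘ suc)

all₂-true : ∀ {m n} (φ : Fin m → Fin n → Bool) {b} → all₂ φ b ≡ true → b ≡ true × (∀ j i → φ j i ≡ true)
all₂-true {zero}  φ e = e , λ ()
all₂-true {suc m} φ e with all₂-true (φ ∘ suc) e
... | e′ , es with all-true (φ zero) e′
...   | eb , e₀ = eb , λ { zero → e₀ ; (suc j) → es j }

all₂-intro : ∀ {m n} (φ : Fin m → Fin n → Bool) {b} → b ≡ true → (∀ j i → φ j i ≡ true) → all₂ φ b ≡ true
all₂-intro {zero}  φ e es = e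
all₂-intro {suc m} φ e es = all₂-intro (φ ∘ suc) (all-intro (φ zero) e (es zero)) (es ∘ suc)

==-refl : ∀ e → (e == e) ≡ true
==-refl 𝟎 = refl
==-refl 𝟏 = refl
==-refl ∗ = refl

==-sound : ∀ {e e′} → (e == e′) ≡ true → e′ ≡ e
==-sound {𝟎} {𝟎} _ = refl
==-sound {𝟏} {𝟏} _ = refl
==-sound {∗} {∗} _ = refl

==-complete : ∀ {e e′} → e′ ≡ e → (e == e′) ≡ true
==-complete refl = ==-refl _

agrees-intro : ∀ {a b} → (a ≡ true → b ≡ true) → (b ≡ true → a ≡ true) → agrees a b ≡ true
agrees-intro {true}          f g = f refl
agrees-intro {false} {true}  f g = contradiction (g refl) λ ()
agrees-intro {false} {false} f g = refl

agrees-true : ∀ {a b} → agrees a b ≡ true → b ≡ true → a ≡ true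
agrees-true {true} e eb = refl
agrees-true {false} {true} () eb

-- Ensures that the indices found in F ∩ G and F ∖ G are related to one and the same `a`.
pick-unique : ∀ {n} x (β : Fin n → Bool) {i j} → pickFirst x β i ≡ true → pickFirst x β j ≡ true → i ≡ j
pick-unique x β {i} {j} ei ej = go x β i j ei ej
  where
  none : ∀ {n} (β : Fin n → Bool) i → pickFirst true β i ≢ true
  none β zero    e = not-true (proj₂ (∧-true {β zero} e)) refl
  none β (suc i) e = none (β ∘ suc) i e
  go : ∀ {n} x (β : Fin n → Bool) i j → pickFirst x β i ≡ true → pickFirst x β j ≡ true → i ≡ j
  later : ∀ {n} x (β : Fin (suc n) → Bool) j → β zero ∧ not x ≡ true → pickFirst x β (suc j) ≢ true
  later x β j e₀ e with β zero
  later false β j e₀ e | true = none (β ∘ suc) j e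
  go x β zero    zero    ei ej = refl
  go x β zero    (suc j) ei ej = contradiction ej (later x β j ei)
  go x β (suc i) zero    ei ej = contradiction ei (later x β i ej)
  go x β (suc i) (suc j) ei ej = cong suc (go (x ∨ β zero) (β ∘ suc) i j ei ej)

is : ∀ {n} → Fin n → Fin n → Bool
is zero    zero    = true
is zero    (suc _) = false
is (suc _) zero    = false
is (suc i) (suc j) = is i j

is-refl : ∀ {n} (i : Fin n) → is i i ≡ true
is-refl zero    = refl
is-refl (suc i) = is-refl i

is-sound : ∀ {n} {i j : Fin n} → is i j ≡ true → i ≡ j
is-sound {i = zero}  {zero}  e = refl
is-sound {i = suc i} {suc j} e = cong suc (is-sound e)

pick-is : ∀ {n} (β : Fin n → Bool) a → β ≗ is a → pickFirst false β ≗ is a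
pick-is β zero    eq zero    rewrite eq zero = refl
pick-is β zero    eq (suc j) rewrite eq zero = absent (β ∘ suc) j
  where
  absent : ∀ {n} (β : Fin n → Bool) j → pickFirst true β j ≡ false
  absent β zero with β zero
  ... | true  = refl
  ... | false = refl
  absent β (suc j) = absent (β ∘ suc) j
pick-is β (suc a) eq zero    rewrite eq zero = refl
pick-is β (suc a) eq (suc j) rewrite eq zero = pick-is (β ∘ suc) a (eq ∘ suc) j

∈⇒true : ∀ {n} {X : Subset n} {j} → j ∈ X → lookup X j ≡ true
∈⇒true = []=⇒lookup

true⇒∈ : ∀ {n} {X : Subset n} {j} → lookup X j ≡ true → j ∈ X
true⇒∈ {X = X} {j} = lookup⇒[]= j X

-- What an accepting run says about walks and sets

module _ {n : ℕ} (M : Matrix n) where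

  -- Unlike `composite` this starts from a single set, as the identity on it, so a run can be
  -- followed from its first set. New sets go in front: the certificate lists the sequence
  -- backwards.
  Reach : Subset n → List (Subset n) → Fin n → Fin n → Set
  Reach X []       b a = b ≡ a × b ∈ X
  Reach X (Y ∷ Ys) b a = ∃[ c ] H M X Y b c × Reach Y Ys c a

  reach-∈ : ∀ X Xs {b a} → Reach X Xs b a → b ∈ X
  reach-∈ X []       (_ , b∈)             = b∈
  reach-∈ X (Y ∷ Ys) (c , (b∈ , _) , _) = b∈

  composite⇒reach : ∀ X Y {k} (Ys : Vec (Subset n) k) {b a} →
    composite M (X ∷ Y ∷ Ys) b a → Reach X (Y ∷ toList Ys) b a
  composite⇒reach X Y []       {a = a} h@(_ , a∈ , _) = a , h , refl , a∈
  composite⇒reach X Y (Z ∷ Zs) (c , h , rest) = c , h , composite⇒reach Y Z Zs rest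

  reach⇒composite : ∀ X Y {k} (Ys : Vec (Subset n) k) {b a} →
    Reach X (Y ∷ toList Ys) b a → composite M (X ∷ Y ∷ Ys) b a
  reach⇒composite X Y []       (c , h , refl , _) = h
  reach⇒composite X Y (Z ∷ Zs) (c , h , rest)     = c , h , reach⇒composite Y Z Zs rest

  -- The sets X ∷ Xs, latest first, are those used so far, and F₁ and G₁ the sets
  -- from which F and G have been propagated.
  record Tracks (F₁ G₁ : Fin n → Bool) (A : Sets n) (X : Subset n) (Xs : List (Subset n)) : Set where
    field
      D-lookup : ∀ j → D A j ≡ lookup X j
      F-reach  : ∀ {b} → F A b ≡ true → ∃[ a ] F₁ a ≡ true × Reach X Xs b a
      reach-F  : ∀ {a b} → F₁ a ≡ true → Reach X Xs b a → F A b ≡ true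
      G-reach  : ∀ {b} → G A b ≡ true → ∃[ a ] G₁ a ≡ true × Reach X Xs b a
      reach-G  : ∀ {a b} → G₁ a ≡ true → Reach X Xs b a → G A b ≡ true
      meet-Q   : ∀ {Z i j} → Z ∈ˡ (X ∷ Xs) → i ∈ Z → j ∈ Z → Q A i j ≡ true
      Q-meet   : ∀ {i j} → Q A i j ≡ true → ∃[ Z ] Z ∈ˡ (X ∷ Xs) × i ∈ Z × j ∈ Z

  open Tracks public

  module _ {F₁ G₁ : Fin n → Bool} where

    tracks-skip : ∀ {A X Xs} β → Tracks F₁ G₁ A X Xs → Tracks F₁ G₁ (stepBy M false β A) X Xs
    tracks-skip {A} {X} {Xs} β t = record
      { D-lookup = D-lookup t
      ; F-reach  = F-reach t
      ; reach-F  = reach-F t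
      ; G-reach  = G-reach t
      ; reach-G  = reach-G t
      ; meet-Q   = λ Z∈ i∈ j∈ → ∨-introˡ (meet-Q t Z∈ i∈ j∈)
      ; Q-meet   = λ e → met-now (∨-true e)
      }
      where
      met-now : ∀ {i j} → Q A i j ≡ true ⊎ D A i ∧ D A j ≡ true → ∃[ Z ] Z ∈ˡ (X ∷ Xs) × i ∈ Z × j ∈ Z
      met-now (inj₁ e) = Q-meet t e
      met-now {i} {j} (inj₂ e) with ∧-true e
      ... | ei , ej = X , here refl , true⇒∈ (trans (sym (D-lookup t i)) ei) , true⇒∈ (trans (sym (D-lookup t j)) ej)

    tracks-move : ∀ {A X Xs} β Z → β ≗ lookup Z → Tracks F₁ G₁ A X Xs → Tracks F₁ G₁ (stepBy M true β A) Z (X ∷ Xs)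
    tracks-move {A} {X} {Xs} β Z eq t = record
      { D-lookup = eq
      ; F-reach  = λ e → image-reach (F-reach t) e
      ; reach-F  = λ e r → reach-image (reach-F t e) r
      ; G-reach  = λ e → image-reach (G-reach t) e
      ; reach-G  = λ e r → reach-image (reach-G t e) r
      ; meet-Q   = λ { (here refl) i∈ j∈ → ∨-introʳ _ (∧-intro (here-true i∈) (here-true j∈))
                     ; (there Z∈) i∈ j∈ → ∨-introˡ (meet-Q t Z∈ i∈ j∈) }
      ; Q-meet   = λ e → met-now (∨-true e)
      }
      where
      here-true : ∀ {j} → j ∈ Z → β j ≡ true
      here-true {j} j∈ = trans (eq j) (∈⇒true j∈)
      here-∈ : ∀ {j} → β j ≡ true → j ∈ Z
      here-∈ {j} e = true⇒∈ (trans (sym (eq j)) e)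
      image-reach : ∀ {S₁ S : Fin n → Bool} → (∀ {b} → S b ≡ true → ∃[ a ] S₁ a ≡ true × Reach X Xs b a) →
        ∀ {b} → neighbours M ∗ S b ∧ β b ≡ true → ∃[ a ] S₁ a ≡ true × Reach Z (X ∷ Xs) b a
      image-reach {S = S} f {b} e with ∧-true e
      ... | eb , b∈ with any-witness (λ i → S i ∧ (∗ == M b i)) eb
      ...   | c , ec with ∧-true {S c} ec
      ...     | Sc , star with f Sc
      ...       | a , ea , r = a , ea , c , (here-∈ b∈ , reach-∈ X Xs r , ==-sound star) , r
      reach-image : ∀ {S : Fin n → Bool} {a} → (∀ {b} → Reach X Xs b a → S b ≡ true) →
        ∀ {b} → Reach Z (X ∷ Xs) b a → neighbours M ∗ S b ∧ β b ≡ true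
      reach-image {S} f {b} (c , (b∈ , c∈ , star) , r) =
        ∧-intro (any-intro (λ i → S i ∧ (∗ == M b i)) c (∧-intro (f r) (==-complete star))) (here-true b∈)
      met-now : ∀ {i j} → Q A i j ≡ true ⊎ β i ∧ β j ≡ true → ∃[ Y ] Y ∈ˡ (Z ∷ X ∷ Xs) × i ∈ Y × j ∈ Y
      met-now (inj₁ e) with Q-meet t e
      ... | Y , Y∈ , i∈ , j∈ = Y , there Y∈ , i∈ , j∈
      met-now (inj₂ e) with ∧-true e
      ... | ei , ej = Z , here refl , here-∈ ei , here-∈ ej

  tracks-start : ∀ β γ X → (∀ j → lookup X j ≡ pickFirst false β j ∨ γ j) →
    Tracks (pickFirst false β) γ (startFrom M β γ) X []
  tracks-start β γ X eq = record
    { D-lookup = λ j → sym (eq j)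
    ; F-reach  = λ {b} e → b , e , refl , true⇒∈ (trans (eq b) (∨-introˡ e))
    ; reach-F  = λ { e (refl , _) → e }
    ; G-reach  = λ {b} e → b , e , refl , true⇒∈ (trans (eq b) (∨-introʳ _ e))
    ; reach-G  = λ { e (refl , _) → e }
    ; meet-Q   = λ { (here refl) i∈ j∈ → ∧-intro (in-D i∈) (in-D j∈) }
    ; Q-meet   = λ e → X , here refl , D-in (proj₁ (∧-true e)) , D-in (proj₂ (∧-true e))
    }
    where
    in-D : ∀ {j} → j ∈ X → pickFirst false β j ∨ γ j ≡ true
    in-D {j} j∈ = trans (sym (eq j)) (∈⇒true j∈)
    D-in : ∀ {j} → pickFirst false β j ∨ γ j ≡ true → j ∈ X
    D-in {j} e = true⇒∈ (trans (eq j) e)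

  tracks-step : ∀ {F₁ G₁ X Xs} s → Tracks F₁ G₁ (proj₁ s) X Xs →
    ∃[ Y ] ∃[ Ys ] Tracks F₁ G₁ (proj₁ (step₁ M s)) Y Ys
  tracks-step (A , u) t with peek u
  ... | false = _ , _ , tracks-skip (bitAt (popIf true u)) t
  ... | true  = Vec.tabulate β , _ , tracks-move β (Vec.tabulate β) (λ j → sym (lookup∘tabulate β j)) t
    where
    β : Fin n → Bool
    β = bitAt (popIf true u)

  tracks-iter : ∀ m {F₁ G₁ X Xs} s → Tracks F₁ G₁ (proj₁ s) X Xs →
    ∃[ Y ] ∃[ Ys ] Tracks F₁ G₁ (proj₁ (iter m (step₁ M) s)) Y Ys
  tracks-iter zero    s t = _ , _ , t
  tracks-iter (suc m) s t with tracks-step s t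
  ... | _ , _ , t′ = tracks-iter m (step₁ M s) t′

  tracks-run : ∀ m u → ∃[ Y ] ∃[ Ys ]
    Tracks (pickFirst false (bitAt u)) (bitAt (dropBits n u)) (proj₁ (iter m (step₁ M) (start₁ M u))) Y Ys
  tracks-run m u = tracks-iter m (start₁ M u)
    (tracks-start (bitAt u) (bitAt (dropBits n u)) (Vec.tabulate D₁) (lookup∘tabulate D₁))
    where
    D₁ : Fin n → Bool
    D₁ j = pickFirst false (bitAt u) j ∨ bitAt (dropBits n u) j

  unit-true : ∀ k i → unit M k i ≡ true → toℕ i ≡ k
  unit-true k i e = ≡ᵇ⇒≡ (toℕ i) k (subst T (sym e) _)

  unit-self : ∀ i → unit M (toℕ i) i ≡ true
  unit-self i with toℕ i ≡ᵇ toℕ i | ≡⇒≡ᵇ (toℕ i) (toℕ i) refl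
  ... | true | _ = refl

  neighbours-true : ∀ e S {j} → neighbours M e S j ≡ true → ∃[ i ] S i ≡ true × M j i ≡ e
  neighbours-true e S {j} w with any-witness (λ i → S i ∧ (e == M j i)) w
  ... | i , w′ = i , proj₁ (∧-true w′) , ==-sound (proj₂ (∧-true {S i} w′))

  neighbours-intro : ∀ e S {i j} → S i ≡ true → M j i ≡ e → neighbours M e S j ≡ true
  neighbours-intro e S {i} {j} Si m = any-intro (λ i → S i ∧ (e == M j i)) i (∧-intro Si (==-complete m))

  met-true : ∀ A S {j} → met-with M A S j ≡ true → ∃[ i ] S i ≡ true × Q A j i ≡ true
  met-true A S {j} w with any-witness (λ i → S i ∧ Q A j i) w
  ... | i , w′ = i , ∧-true {S i} w′

  met-intro : ∀ A S {i j} → S i ≡ true → Q A j i ≡ true → met-with M A S j ≡ true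
  met-intro A S {i} {j} Si q = any-intro (λ i → S i ∧ Q A j i) i (∧-intro Si q)

  SymmetricOn : ℕ → Entry → Set
  SymmetricOn k e = ∀ j i → not (unit M k j) ∨ agrees (neighbours M e (unit M k) i) (e == M j i) ≡ true

  PassesAt : Sets n → ℕ → Set
  PassesAt A k = (∀ e → SymmetricOn k e) × (∀ j → not (clash M A (unit M k) j ∧ unit M k j) ≡ true)

  indexChecks-true : ∀ A k {o} → indexChecks M A (unit M k) o ≡ true → o ≡ true × PassesAt A k
  indexChecks-true A k e with all-true _ e
  ... | e₁ , pure with all₂-true _ e₁
  ...   | e₂ , s∗ with all₂-true _ e₂
  ...     | e₃ , s𝟏 with all₂-true _ e₃
  ...       | e₄ , s𝟎 = e₄ , (λ { 𝟎 → s𝟎 ; 𝟏 → s𝟏 ; ∗ → s∗ }) , pure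

  indexChecks-intro : ∀ A k {o} → o ≡ true → PassesAt A k → indexChecks M A (unit M k) o ≡ true
  indexChecks-intro A k e (s , pure) =
    all-intro _ (all₂-intro _ (all₂-intro _ (all₂-intro _ e (s 𝟎)) (s 𝟏)) (s ∗)) pure

  private
    checkStep : Sets n → Bool × ℕ → Bool × ℕ
    checkStep A (o , k) = indexChecks M A (unit M k) o , suc k

  checks-true : ∀ A m o k → proj₁ (iter m (checkStep A) (o , k)) ≡ true → o ≡ true × (∀ i → i < m → PassesAt A (i + k))
  checks-true A zero    o k e = e , λ _ ()
  checks-true A (suc m) o k e with checks-true A m _ (suc k) e
  ... | e′ , later with indexChecks-true A k e′
  ...   | e″ , now = e″ , λ { zero _ → now ; (suc i) (s≤s i<m) → subst (PassesAt A) (+-suc i k) (later i i<m) }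

  checks-intro : ∀ A m o k → o ≡ true → (∀ i → PassesAt A i) → proj₁ (iter m (checkStep A) (o , k)) ≡ true
  checks-intro A zero    o k e p = e
  checks-intro A (suc m) o k e p = checks-intro A m _ (suc k) (indexChecks-intro A k e (p k)) p

  allChecks-true : ∀ A → allChecks M A ≡ true → ∀ i → PassesAt A (toℕ i)
  allChecks-true A e i = subst (PassesAt A) (+-identityʳ (toℕ i)) (proj₂ (checks-true A n true 0 e) (toℕ i) (toℕ<n i))

  passes⇒symmetric : ∀ A → (∀ i → PassesAt A (toℕ i)) → Symmetric M
  -- Of the three checks at j the one for the entry `M j i` is used: its right-hand side holds, so
  -- column j has that entry at i.
  passes⇒symmetric A p j i with ∨-true {not (unit M (toℕ j) j)} (proj₁ (p j) (M j i) j i)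
  ... | inj₁ e = contradiction (unit-self j) (not-true e)
  ... | inj₂ e with neighbours-true (M j i) (unit M (toℕ j)) (agrees-true e (==-refl (M j i)))
  ...   | k , ek , m rewrite Fin.toℕ-injective (unit-true (toℕ j) k ek) = sym m

  clash-free : ∀ A → (∀ i → PassesAt A (toℕ i)) → ∀ {a b a′ b′} →
    M b a ≡ 𝟎 → Q A b′ b ≡ true → M a′ b′ ≡ 𝟏 → Q A a a′ ≡ true → ⊥
  clash-free A p {a} {b} {a′} {b′} zero′ q one q′ = not-true (proj₂ (p a) a) (∧-intro
    (met-intro A _ (neighbours-intro 𝟏 _ (met-intro A _ (neighbours-intro 𝟎 _ (unit-self a) zero′) q) one) q′)
    (unit-self a))

  accepts-parts : ∀ u → accepts M u ≡ true →
    let A = proj₁ (iter (n * (n * (n * 8))) (step₁ M) (start₁ M u)) in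
    (∃[ b ] F A b ≡ true × G A b ≢ true) × (∃[ b ] F A b ≡ true × G A b ≡ true) × allChecks M A ≡ true
  accepts-parts u e with ∧-true e
  ... | e₁ , e₂ with ∧-true e₂
  ...   | e₃ , e₄ with any-witness _ e₁ | any-witness _ e₃
  ...     | b′ , w | b , w′ =
    (b′ , proj₁ (∧-true w) , not-true (proj₂ (∧-true w))) , (b , ∧-true w′) , e₄

  final : List Bool → Sets n
  final u = proj₁ (iter (n * (n * (n * 8))) (step₁ M) (start₁ M u))

  accepts-intro : ∀ u b b′ → F (final u) b ≡ true → G (final u) b ≡ true →
    F (final u) b′ ≡ true → G (final u) b′ ≢ true → (∀ k → PassesAt (final u) k) → accepts M u ≡ true
  accepts-intro u b b′ Fb Gb Fb′ ¬Gb′ p =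
    ∧-intro (any-intro (λ j → F (final u) j ∧ not (G (final u) j)) b′ (∧-intro Fb′ (not-intro ¬Gb′)))
      (∧-intro (any-intro (λ j → F (final u) j ∧ G (final u) j) b (∧-intro Fb Gb))
        (checks-intro (final u) n true 0 refl p))

  -- A search for a `𝟎` in the block decides which alternative of `PureOn` to prove; if one is
  -- found, any `𝟏` would clash with it.
  purifying : ∀ {F₁ G₁ A X Xs} → Tracks F₁ G₁ A X Xs → (∀ i → PassesAt A (toℕ i)) →
    ∀ {Y Z} → Y ∈ˡ (X ∷ Xs) → Z ∈ˡ (X ∷ Xs) → PureOn M Y Z
  purifying {A = A} t p {Y} {Z} Y∈ Z∈
    with any? (λ i → any? (λ j → (i ∈? Y) ×-dec (j ∈? Z) ×-dec (M i j ≟𝟎)))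
    where
    _≟𝟎 : ∀ e → Dec (e ≡ 𝟎)
    𝟎 ≟𝟎 = yes refl
    𝟏 ≟𝟎 = no λ ()
    ∗ ≟𝟎 = no λ ()
  ... | no none = inj₁ λ i j i∈ j∈ e → none (i , j , i∈ , j∈ , e)
  ... | yes (i , j , i∈ , j∈ , e) = inj₂ λ i′ j′ i′∈ j′∈ e′ →
    clash-free A p {a = j} {b = i} {a′ = j′} {b′ = i′} e (meet-Q t Y∈ i′∈ i∈)
      (trans (passes⇒symmetric A p j′ i′) e′) (meet-Q t Z∈ j∈ j′∈)

  accepts⇒derect : ∀ u → accepts M u ≡ true → Symmetric M × HasDerectSeq M
  accepts⇒derect u e with accepts-parts u e | tracks-run (n * (n * (n * 8))) u
  ... | (b′ , Fb′ , ¬Gb′) , (b , Fb , Gb) , checks | X , Xs , t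
    with F-reach t Fb′ | F-reach t Fb | G-reach t Gb
  ... | a , pa , r′ | a° , pa° , r | a₂ , pa₂ , r₂ rewrite pick-unique false (bitAt u) {a°} {a} pa° pa =
    passes⇒symmetric A p , sequence X Xs t r′ r r₂ (λ r₃ → ¬Gb′ (reach-G t pa₂ r₃))
    where
    A = proj₁ (iter (n * (n * (n * 8))) (step₁ M) (start₁ M u))
    p : ∀ i → PassesAt A (toℕ i)
    p = allChecks-true A checks
    sequence : ∀ X Xs → Tracks _ _ A X Xs →
      Reach X Xs b′ a → Reach X Xs b a → Reach X Xs b a₂ → ¬ Reach X Xs b′ a₂ → HasDerectSeq M
    -- A single set gives the identity, under which `b` and `b′` both equal `a`. So an accepted run
    -- has at least the two sets that a sequence requires.
    sequence X []       t (refl , _) (refl , _) r₂ ¬r₃ = contradiction r₂ ¬r₃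
    sequence X (Y ∷ Ys) t r′ r r₂ ¬r₃ = length Ys , X ∷ Y ∷ fromList Ys ,
      (λ V W V∈ W∈ → purifying t p (∈-fromList⁻ V∈) (∈-fromList⁻ W∈)) ,
      λ rect → ¬r₃ (to (rect b b′ a a₂ (from r) (from r₂) (from r′)))
      where
      to : ∀ {b a} → composite M (X ∷ Y ∷ fromList Ys) b a → Reach X (Y ∷ Ys) b a
      to {b} {a} c = subst (λ Ys → Reach X (Y ∷ Ys) b a) (toList∘fromList Ys) (composite⇒reach X Y (fromList Ys) c)
      from : ∀ {b a} → Reach X (Y ∷ Ys) b a → composite M (X ∷ Y ∷ fromList Ys) b a
      from {b} {a} r = reach⇒composite X Y (fromList Ys)
        (subst (λ Ys → Reach X (Y ∷ Ys) b a) (sym (toList∘fromList Ys)) r)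

-- Completeness

lookup-distinct : ∀ {A : Set} {xs : List A} → Unique xs → ∀ {i j} → List.lookup xs i ≡ List.lookup xs j → i ≡ j
lookup-distinct (_ ∷ _)  {zero}  {zero}  e = refl
lookup-distinct (x∉ ∷ _) {zero}  {suc j} e = contradiction e (All.lookup x∉ (∈-lookup j))
lookup-distinct (x∉ ∷ _) {suc i} {zero}  e = contradiction (sym e) (All.lookup x∉ (∈-lookup i))
lookup-distinct (_ ∷ u)  {suc i} {suc j} e = cong suc (lookup-distinct u e)

unique-length : ∀ {A : Set} {k} → A ↔ Fin k → ∀ {xs : List A} → Unique xs → length xs ≤ k
unique-length f u = injective⇒≤ (λ e → lookup-distinct u (Injection.injective (↔⇒↣ f) e))

module _ {V : Set} (S : V → Set) (E : V → V → Set) where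

  data Trail : V → List V → Set where
    origin : ∀ {ν} → S ν → Trail ν []
    _⟵_    : ∀ {ν μ μs} → E ν μ → Trail μ μs → Trail ν (μ ∷ μs)

  shortcut : ∀ {μ μs ν} → Trail μ μs → Unique (μ ∷ μs) → ν ∈ˡ (μ ∷ μs) →
    ∃[ νs ] Trail ν νs × Unique (ν ∷ νs) × (νs ⊆ˡ μs)
  shortcut t        u       (here refl) = _ , t , u , id
  shortcut (_ ⟵ t) (_ ∷ u) (there m) with shortcut t u m
  ... | νs , t′ , u′ , sub = νs , t′ , u′ , there ∘ sub

  -- The node in front and the condition `S` at the origin are kept, so what is known at both ends
  -- survives. The inclusion serves to transfer purity.
  loop-erase : DecidableEquality V → ∀ {ν μs} → Trail ν μs → ∃[ νs ] Trail ν νs × Unique (ν ∷ νs) × (νs ⊆ˡ μs)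
  loop-erase _≟_ (origin s) = [] , origin s , [] ∷ [] , id
  loop-erase _≟_ {ν} {μ ∷ μs} (e ⟵ t) with loop-erase _≟_ t
  ... | νs , t′ , u , sub with DecMembership._∈?_ _≟_ ν (μ ∷ νs)
  ...   | no ν∉ = μ ∷ νs , e ⟵ t′ , ¬Any⇒All¬ (μ ∷ νs) ν∉ ∷ u , λ { (here e) → here e ; (there m) → there (sub m) }
  ...   | yes ν∈ with shortcut t′ u ν∈
  ...     | ρs , t″ , u″ , sub′ = ρs , t″ , u″ , there ∘ sub ∘ sub′

bitAt-toList : ∀ {n} (X : Subset n) v j → bitAt (toList X ++ v) j ≡ lookup X j
bitAt-toList (b ∷ X) v zero    = refl
bitAt-toList (b ∷ X) v (suc j) = bitAt-toList X v j

dropBits-toList : ∀ {n} (X : Subset n) v → dropBits n (toList X ++ v) ≡ v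
dropBits-toList []      v = refl
dropBits-toList (b ∷ X) v = dropBits-toList X v

dropBits-[] : ∀ n → dropBits n [] ≡ []
dropBits-[] zero    = refl
dropBits-[] (suc n) = dropBits-[] n

does-true : ∀ {A : Set} (d : Dec A) → does d ≡ true → A
does-true (yes a) _ = a

true-does : ∀ {A : Set} (d : Dec A) → A → does d ≡ true
true-does (yes _) _ = refl
true-does (no ¬a) a = contradiction a ¬a

-- The three walks that witness non-rectangularity.
data Track₃ : Set where
  w₁ w₂ w₃ : Track₃

-- Labelled triples and their certificates

module _ {n : ℕ} (M : Matrix n) where

  Node : Set
  Node = Fin n × Fin n × Fin n × Bool × Bool × Bool

  node↔ : Node ↔ Fin (n * (n * (n * 8)))
  node↔ = with-fin (with-fin (with-fin (↔-trans (↔-sym 2↔Bool ×-↔ ↔-trans (↔-sym 2↔Bool ×-↔ ↔-sym 2↔Bool) (↔-sym *↔×)) (↔-sym *↔×))))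
    where
    with-fin : ∀ {B : Set} {k} → B ↔ Fin k → (Fin n × B) ↔ Fin (n * k)
    with-fin f = ↔-trans (↔-id (Fin n) ×-↔ f) (↔-sym *↔×)

  _≟ⁿ_ : DecidableEquality Node
  _≟ⁿ_ = via-injection (↔⇒↣ node↔) Fin._≟_

  val : Node → Track₃ → Fin n
  val (p , q , r , _) w₁ = p
  val (p , q , r , _) w₂ = q
  val (p , q , r , _) w₃ = r

  mark : Node → Track₃ → Bool
  mark (_ , _ , _ , x , y , z) w₁ = x
  mark (_ , _ , _ , x , y , z) w₂ = y
  mark (_ , _ , _ , x , y , z) w₃ = z

  member : Node → Fin n → Bool
  member ν j = is (val ν w₁) j ∨ (is (val ν w₂) j ∨ is (val ν w₃) j)

  triple : Node → Subset n
  triple ν = Vec.tabulate (member ν)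

  val-∈ : ∀ ν ℓ → val ν ℓ ∈ triple ν
  val-∈ ν ℓ = true⇒∈ (trans (lookup∘tabulate (member ν) (val ν ℓ)) (present ℓ))
    where
    present : ∀ ℓ → member ν (val ν ℓ) ≡ true
    present w₁ = ∨-introˡ (is-refl (val ν w₁))
    present w₂ = ∨-introʳ (is (val ν w₁) (val ν w₂)) (∨-introˡ (is-refl (val ν w₂)))
    present w₃ = ∨-introʳ (is (val ν w₁) (val ν w₃)) (∨-introʳ (is (val ν w₂) (val ν w₃)) (is-refl (val ν w₃)))

  ∈-val : ∀ ν {j} → j ∈ triple ν → ∃[ ℓ ] val ν ℓ ≡ j
  ∈-val ν {j} j∈ with ∨-true (trans (sym (lookup∘tabulate (member ν) j)) (∈⇒true j∈))
  ... | inj₁ e = w₁ , is-sound e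
  ... | inj₂ e with ∨-true {is (val ν w₂) j} e
  ...   | inj₁ e′ = w₂ , is-sound e′
  ...   | inj₂ e′ = w₃ , is-sound e′

  module _ (a a₂ : Fin n) where

    -- The walks `w₁` and `w₂` join `b` and `b′` to `a`, and `w₃` joins `b` to `a₂`.
    end : Track₃ → Fin n
    end w₁ = a
    end w₂ = a
    end w₃ = a₂

    -- mark ν ℓ over-approximates "val ν ℓ is related to a₂".
    Starts : Node → Set
    Starts ν = (∀ ℓ → val ν ℓ ≡ end ℓ) × (∀ ℓ → val ν ℓ ≡ a₂ → mark ν ℓ ≡ true)

    Links : Node → Node → Set
    Links ν μ = (∀ ℓ → M (val ν ℓ) (val μ ℓ) ≡ ∗)
              × (∀ ℓ ℓ′ → mark μ ℓ ≡ true → M (val ν ℓ′) (val μ ℓ) ≡ ∗ → mark ν ℓ′ ≡ true)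

    Walk : Node → List Node → Set
    Walk = Trail Starts Links

    walk-reach : ∀ {ν μs} → Walk ν μs → ∀ ℓ → Reach M (triple ν) (List.map triple μs) (val ν ℓ) (end ℓ)
    walk-reach {ν} (origin (vals , _)) ℓ = vals ℓ , val-∈ ν ℓ
    walk-reach {ν} (_⟵_ {μ = μ} (stars , _) t) ℓ = val μ ℓ , (val-∈ ν ℓ , val-∈ μ ℓ , stars ℓ) , walk-reach t ℓ

    -- A walk through the triples visits only indices listed in the nodes, so the closure condition
    -- in `Links` carries the mark along it. Hence an unmarked index is not related to `a₂`, even if
    -- erasing loops has made other marks inexact.
    reach-mark : ∀ {ν μs} → Walk ν μs → ∀ ℓ → Reach M (triple ν) (List.map triple μs) (val ν ℓ) a₂ → mark ν ℓ ≡ true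
    reach-mark (origin (_ , marks)) ℓ (e , _) = marks ℓ e
    reach-mark {ν} (_⟵_ {μ = μ} (_ , closed) t) ℓ (c , (_ , c∈ , star) , r) with ∈-val μ c∈
    ... | ℓ′ , refl = closed ℓ′ ℓ (reach-mark t ℓ′ r) star

    moveBits : Subset n → List Bool → List Bool
    moveBits X v = true ∷ (toList X ++ v)

    -- A trail has its latest node in front, the certificate has it last; hence the accumulator. The
    -- origin is encoded by `certificate`.
    code : Node → List Node → List Bool → List Bool
    code ν []       v = v
    code ν (μ ∷ μs) v = code μ μs (moveBits (triple ν) v)

    module _ (β γ : Fin n → Bool) (β≗ : β ≗ is a) (γ≗ : γ ≗ is a₂) where

      run-walk : ∀ {ν μs} → Walk ν μs → ∀ v → ∃[ A ]
        iter (length μs) (step₁ M) (startFrom M β γ , code ν μs v) ≡ (A , v) ×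
        Tracks M (pickFirst false β) γ A (triple ν) (List.map triple μs)
      run-walk {ν} (origin (vals , _)) v = startFrom M β γ , refl , tracks-start M β γ (triple ν) first-set
        where
        first-set : ∀ j → lookup (triple ν) j ≡ pickFirst false β j ∨ γ j
        -- The triple at the origin is (a, a, a₂); idempotence absorbs the repeated `a`.
        first-set j rewrite lookup∘tabulate (member ν) j | vals w₁ | vals w₂ | vals w₃ | pick-is β a β≗ j | γ≗ j =
          trans (sym (Bool.∨-assoc (is a j) (is a j) (is a₂ j))) (cong (_∨ is a₂ j) (Bool.∨-idem (is a j)))
      run-walk {ν} {μ ∷ μs} (_ ⟵ t) v with run-walk t (moveBits (triple ν) v)
      ... | A , eq , tracks = A′ ,
        trans (iter-suc (length μs) (step₁ M) _)
          (trans (cong (step₁ M) eq) (cong (A′ ,_) (dropBits-toList (triple ν) v))) ,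
        tracks-move M (bitAt moved) (triple ν) (bitAt-toList (triple ν) v) tracks
        where
        moved : List Bool
        moved = toList (triple ν) ++ v
        A′ : Sets n
        A′ = stepBy M true (bitAt moved) A

  -- The exhausted certificate reads as `false`, so the steps left over stand still.
  rest-skips : ∀ m {F₁ G₁ A X Xs} → Tracks M F₁ G₁ A X Xs → Tracks M F₁ G₁ (proj₁ (iter m (step₁ M) (A , []))) X Xs
  rest-skips zero    t = t
  rest-skips (suc m) t rewrite dropBits-[] n = rest-skips m (tracks-skip M (bitAt []) t)

  certificate : Fin n → Fin n → List Bool → List Bool
  certificate a a₂ v = toList (Vec.tabulate (is a)) ++ (toList (Vec.tabulate (is a₂)) ++ v)

  walk-tracked : ∀ {a a₂ ν μs} → Walk a a₂ ν μs → length μs ≤ n * (n * (n * 8)) → ∃[ u ]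
    ∃[ F₁ ] ∃[ G₁ ] F₁ ≗ is a × G₁ ≗ is a₂ ×
    Tracks M F₁ G₁ (final M u) (triple ν) (List.map triple μs)
  walk-tracked {a} {a₂} {ν} {μs} w short with m≤n⇒∃[o]m+o≡n short
  ... | o , total = u , _ , γ , pick-is β a β≗ , γ≗ , tracked
    where
    u′ = code a a₂ ν μs []
    u  = certificate a a₂ u′
    β γ : Fin n → Bool
    β = bitAt u
    γ = bitAt (dropBits n u)
    dropped : dropBits n u ≡ toList (Vec.tabulate (is a₂)) ++ u′
    dropped = dropBits-toList (Vec.tabulate (is a)) _
    β≗ : β ≗ is a
    β≗ j = trans (bitAt-toList (Vec.tabulate (is a)) _ j) (lookup∘tabulate (is a) j)
    γ≗ : γ ≗ is a₂
    γ≗ j = trans (cong (λ v → bitAt v j) dropped)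
      (trans (bitAt-toList (Vec.tabulate (is a₂)) u′ j) (lookup∘tabulate (is a₂) j))
    tracked : Tracks M _ _ (final M u) (triple ν) (List.map triple μs)
    tracked with run-walk a a₂ β γ β≗ γ≗ w []
    ... | A , eq , t = subst (λ s → Tracks M _ _ (proj₁ s) (triple ν) (List.map triple μs))
      (sym (trans (cong (λ m → iter m (step₁ M) (start₁ M u)) (sym total))
        (trans (iter-+ (length μs) o (step₁ M) (start₁ M u))
          (cong (iter o (step₁ M)) (trans (cong (λ v → iter (length μs) (step₁ M) (startFrom M β γ , v))
            (trans (cong (dropBits n) dropped) (dropBits-toList (Vec.tabulate (is a₂)) u′))) eq)))))
      (rest-skips o t)

  module _ (symmetric : Symmetric M) {F₁ G₁ A X Xs} (t : Tracks M F₁ G₁ A X Xs)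
           (pure : ∀ {Y Z} → Y ∈ˡ (X ∷ Xs) → Z ∈ˡ (X ∷ Xs) → PureOn M Y Z) where

    unit-unique : ∀ k i j → unit M k i ≡ true → unit M k j ≡ true → i ≡ j
    unit-unique k i j ei ej = Fin.toℕ-injective (trans (unit-true M k i ei) (sym (unit-true M k j ej)))

    symmetric-on : ∀ k e → SymmetricOn M k e
    symmetric-on k e j i with unit M k j in ej
    ... | false = refl
    ... | true  = agrees-intro to from
      where
      to : neighbours M e (unit M k) i ≡ true → (e == M j i) ≡ true
      to w with neighbours-true M e (unit M k) w
      ... | j′ , ej′ , m with refl ← unit-unique k j j′ ej ej′ = ==-complete (trans (symmetric j′ i) m)
      from : (e == M j i) ≡ true → neighbours M e (unit M k) i ≡ true
      from w = neighbours-intro M e (unit M k) ej (trans (symmetric i j) (==-sound w))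

    -- The two recorded pairs come from sets Y and Z of the family. Symmetry moves the `𝟏` from (a′,
    -- b′) to (b′, a′), into the block Y × Z that contains the `𝟎`.
    no-clash : ∀ k j → clash M A (unit M k) j ∧ unit M k j ≢ true
    no-clash k j w with ∧-true w
    ... | h₄ , ej with met-true M A (neighbours M 𝟏 (met-with M A (neighbours M 𝟎 (unit M k)))) h₄
    ...   | a′ , h₃ , q′ with neighbours-true M 𝟏 (met-with M A (neighbours M 𝟎 (unit M k))) h₃
    ...     | b′ , h₂ , one with met-true M A (neighbours M 𝟎 (unit M k)) h₂
    ...       | b , h₁ , q with neighbours-true M 𝟎 (unit M k) h₁
    ...         | j′ , ej′ , zero′ with refl ← unit-unique k j j′ ej ej′ with Q-meet t q | Q-meet t q′
    ...           | Y , Y∈ , b′∈ , b∈ | Z , Z∈ , j∈ , a′∈ with pure Y∈ Z∈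
    ...             | inj₁ no0 = no0 b j b∈ j∈ zero′
    ...             | inj₂ no1 = no1 b′ a′ b′∈ a′∈ (trans (symmetric b′ a′) one)

    passes : ∀ k → PassesAt M A k
    passes k = symmetric-on k , λ j → not-intro (no-clash k j)

  Reach? : ∀ X Xs b a → Dec (Reach M X Xs b a)
  Reach? X []       b a = (b Fin.≟ a) ×-dec (b ∈? X)
  Reach? X (Y ∷ Ys) b a = any? λ c → ((b ∈? X) ×-dec (c ∈? Y) ×-dec (M b c ≟∗)) ×-dec Reach? Y Ys c a
    where
    _≟∗ : ∀ e → Dec (e ≡ ∗)
    𝟎 ≟∗ = no λ ()
    𝟏 ≟∗ = no λ ()
    ∗ ≟∗ = yes refl

  Inside : List (Subset n) → Node → Set
  Inside L ν = ∃[ Z ] Z ∈ˡ L × (∀ ℓ → val ν ℓ ∈ Z)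

  PureFamily : List (Subset n) → Set
  PureFamily L = ∀ {Y Z} → Y ∈ˡ L → Z ∈ˡ L → PureOn M Y Z

  -- Purity passes to subsets, and each triple lies within one of the original sets.
  pure-triples : ∀ {L νs} → (∀ {ν} → ν ∈ˡ νs → Inside L ν) → PureFamily L → PureFamily (List.map triple νs)
  pure-triples {L} {νs} inside pure Y∈ Z∈ with inside-triple Y∈ | inside-triple Z∈
    where
    inside-triple : ∀ {Z} → Z ∈ˡ List.map triple νs → ∃[ W ] W ∈ˡ L × (∀ {j} → j ∈ Z → j ∈ W)
    inside-triple m with ∈-map⁻ triple {xs = νs} m
    ... | ν , ν∈ , refl with inside ν∈
    ...   | W , W∈ , vals = W , W∈ , λ j∈ → subst (_∈ W) (proj₂ (∈-val ν j∈)) (vals (proj₁ (∈-val ν j∈)))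
  ... | V , V∈ , Y⊆V | W , W∈ , Z⊆W with pure V∈ W∈
  ...   | inj₁ no0 = inj₁ λ i j i∈ j∈ → no0 i j (Y⊆V i∈) (Z⊆W j∈)
  ...   | inj₂ no1 = inj₂ λ i j i∈ j∈ → no1 i j (Y⊆V i∈) (Z⊆W j∈)

  walk-accepts : Symmetric M → ∀ {L a a₂ ν μs} → PureFamily L → (∀ {ν′} → ν′ ∈ˡ (ν ∷ μs) → Inside L ν′) →
    Walk a a₂ ν μs → length μs ≤ n * (n * (n * 8)) → val ν w₃ ≡ val ν w₁ → mark ν w₂ ≢ true →
    ∃[ u ] accepts M u ≡ true
  walk-accepts symmetric {L} {a} {a₂} {ν} {μs} pure inside w short meet unmarked with walk-tracked w short
  ... | u , F₁ , G₁ , F≗ , G≗ , t = u , accepts-intro M u (val ν w₁) (val ν w₂)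
    (reach-F t Fa (walk-reach a a₂ w w₁)) (subst (λ b → G (final M u) b ≡ true) meet Gb)
    (reach-F t Fa (walk-reach a a₂ w w₂)) ¬Gb′
    (passes symmetric t (pure-triples inside pure))
    where
    Fa : F₁ a ≡ true
    Fa = trans (F≗ a) (is-refl a)
    Gb : G (final M u) (val ν w₃) ≡ true
    Gb = reach-G t (trans (G≗ a₂) (is-refl a₂)) (walk-reach a a₂ w w₃)
    ¬Gb′ : G (final M u) (val ν w₂) ≢ true
    ¬Gb′ e with G-reach t e
    ... | c , ec , rc with is-sound {i = a₂} {c} (trans (sym (G≗ c)) ec)
    ...   | refl = unmarked (reach-mark a a₂ w w₂ rc)

  module _ (L : List (Subset n)) (a a₂ : Fin n) where

    exact : Subset n → List (Subset n) → Fin n → Fin n → Fin n → Node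
    exact X Xs p q r = p , q , r , does (Reach? X Xs p a₂) , does (Reach? X Xs q a₂) , does (Reach? X Xs r a₂)

    mark-exact : ∀ X Xs p q r ℓ → let ν = exact X Xs p q r in mark ν ℓ ≡ does (Reach? X Xs (val ν ℓ) a₂)
    mark-exact X Xs p q r w₁ = refl
    mark-exact X Xs p q r w₂ = refl
    mark-exact X Xs p q r w₃ = refl

    by-track : {P : Track₃ → Set} → P w₁ → P w₂ → P w₃ → ∀ ℓ → P ℓ
    by-track p q r w₁ = p
    by-track p q r w₂ = q
    by-track p q r w₃ = r

    -- Marks that decide relatedness to `a₂` in the original sequence are closed under links: a `∗`
    -- from an index of X to a related index makes the former related too.
    exact-walk : ∀ X Xs {p q r} → (X ∷ Xs) ⊆ˡ L →
      Reach M X Xs p a → Reach M X Xs q a → Reach M X Xs r a₂ →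
      ∃[ μs ] Walk a a₂ (exact X Xs p q r) μs × (∀ {ν} → ν ∈ˡ (exact X Xs p q r ∷ μs) → Inside L ν)
    exact-walk X [] {p} {q} {r} sub (ep , p∈) (eq , q∈) (er , r∈) =
      [] , origin (by-track ep eq er , marks) , inside
      where
      ν = exact X [] p q r
      in-X : ∀ ℓ → val ν ℓ ∈ X
      in-X = by-track p∈ q∈ r∈
      marks : ∀ ℓ → val ν ℓ ≡ a₂ → mark ν ℓ ≡ true
      marks ℓ e = trans (mark-exact X [] p q r ℓ) (true-does (Reach? X [] (val ν ℓ) a₂) (e , in-X ℓ))
      inside : ∀ {ν′} → ν′ ∈ˡ (ν ∷ []) → Inside L ν′
      inside (here refl) = X , sub (here refl) , in-X
    exact-walk X (Y ∷ Ys) {p} {q} {r} sub (p′ , (p∈ , p′∈ , mp) , rp) (q′ , (q∈ , q′∈ , mq) , rq) (r′ , (r∈ , r′∈ , mr) , rr)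
      with exact-walk Y Ys (sub ∘ there) rp rq rr
    ... | μs , w , inside = μ ∷ μs , (by-track mp mq mr , closed) ⟵ w , inside′
      where
      ν = exact X (Y ∷ Ys) p q r
      μ = exact Y Ys p′ q′ r′
      in-X : ∀ ℓ → val ν ℓ ∈ X
      in-X = by-track p∈ q∈ r∈
      closed : ∀ ℓ ℓ′ → mark μ ℓ ≡ true → M (val ν ℓ′) (val μ ℓ) ≡ ∗ → mark ν ℓ′ ≡ true
      closed ℓ ℓ′ e star = trans (mark-exact X (Y ∷ Ys) p q r ℓ′)
        (true-does (Reach? X (Y ∷ Ys) (val ν ℓ′) a₂) (val μ ℓ , (in-X ℓ′ , reach-∈ M Y Ys reached , star) , reached))
        where
        reached : Reach M Y Ys (val μ ℓ) a₂
        reached = does-true (Reach? Y Ys (val μ ℓ) a₂) (trans (sym (mark-exact Y Ys p′ q′ r′ ℓ)) e)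
      inside′ : ∀ {ν′} → ν′ ∈ˡ (ν ∷ μ ∷ μs) → Inside L ν′
      inside′ (here refl) = X , sub (here refl) , in-X
      inside′ (there m)   = inside m

  derect⇒accepts : Symmetric M → HasDerectSeq M → ∃[ u ] accepts M u ≡ true
  derect⇒accepts symmetric (k , X ∷ Y ∷ Ys , pure , ¬rect)
    -- A negated universal statement yields no witnesses constructively. Relatedness is decidable,
    -- so a finite search finds them; its failure would prove rectangularity.
    with any? (λ b → any? λ b′ → any? λ a → any? λ a₂ →
           Reach? X Xs b a ×-dec Reach? X Xs b a₂ ×-dec Reach? X Xs b′ a ×-dec ¬? (Reach? X Xs b′ a₂))
    where Xs = Y ∷ toList Ys
  ... | no none = contradiction rect ¬rect
    where
    Xs = Y ∷ toList Ys
    rect : Rectangular (composite M (X ∷ Y ∷ Ys))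
    rect b b′ a a₂ c c₂ c′ with Reach? X Xs b′ a₂
    ... | yes r = reach⇒composite M X Y Ys r
    ... | no ¬r = contradiction
      (b , b′ , a , a₂ , composite⇒reach M X Y Ys c , composite⇒reach M X Y Ys c₂ , composite⇒reach M X Y Ys c′ , ¬r) none
  ... | yes (b , b′ , a , a₂ , r , r₂ , r′ , ¬r) = conclude
    where
    Xs = Y ∷ toList Ys
    L  = X ∷ Xs
    conclude : ∃[ u ] accepts M u ≡ true
    conclude with exact-walk L a a₂ X Xs id r r′ r₂
    ... | μs , w , inside with loop-erase (Starts a a₂) (Links a a₂) _≟ⁿ_ w
    ...   | νs , w′ , distinct , sub = walk-accepts symmetric
      (λ V∈ W∈ → pure _ _ (∈-toList⁻ V∈) (∈-toList⁻ W∈))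
      (λ { (here e) → inside (here e) ; (there m) → inside (there (sub m)) })
      -- The front node is untouched by loop erasure: `w₁` and `w₃` both stand at `b`, and the mark
      -- of `w₂` at `b′` is still exact, hence `false`.
      w′ (<⇒≤ (unique-length node↔ distinct)) refl (¬r ∘ does-true (Reach? X Xs b′ a₂))

-- Membership in NP

inNP : ∀ p → WellFormed p → (L : Pred (List Symbol) 0ℓ) →
  (∀ w → L w ⇔ (∃[ u ] Accepts p w u)) → InNP L
inNP p wf L correct = machine p , timeFactor p , timeDegree p ,
  (λ w u → _ , outcome w u) ,
  λ w → mk⇔
    (λ l → let (u , e) = Equivalence.to (correct w) l in u , trans (outcome w u) (cong just (accepting e)))
    (λ (u , e) → Equivalence.from (correct w) (u , accepted (just-injective (trans (sym (outcome w u)) e))))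
  where
  outcome : ∀ w u → Machine.run (machine p) (timeFactor p * length w ^ timeDegree p + timeFactor p)
                      (Machine.initial (machine p) w u) ≡ just (ok (⟦ p ⟧ (copied w u)))
  outcome w u = verdict p wf w u _ (time≤ p (length w))

verifier-correct : ∀ w → MatrixHasDerectSeq w ⇔ (∃[ u ] Accepts verifier w u)
verifier-correct w = mk⇔ complete sound
  where
  complete : MatrixHasDerectSeq w → ∃[ u ] Accepts verifier w u
  complete (n , M , refl , symmetric , derect) with derect⇒accepts M symmetric derect
  ... | u , e = u , run⇒accepts (verifier-run M u) e
  sound : (∃[ u ] Accepts verifier w u) → MatrixHasDerectSeq w
  sound (u , a) with accepts⇒encode w u a
  ... | n , M , refl = n , M , refl , accepts⇒derect M u (accepts⇒run (verifier-run M u) a)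

corollary11 : InNP MatrixHasDerectSeq
corollary11 = inNP verifier wellFormed MatrixHasDerectSeq verifier-correct
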